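{- Let $(\mathfrak{S}Sym)^*$ be the graded dual Hopf algebra of $\mathfrak{S}Sym$, with bases $\{\mathcal{F}^*_u\}$ and $\{\mathcal{M}^*_u\}$ dual to $\{\mathcal{F}_u\}$ and $\{\mathcal{M}_u\}$. The linear map $\Theta\colon(\mathfrak{S}Sym)^*\to\mathfrak{S}Sym$, $\mathcal{F}^*_u\mapsto\mathcal{F}_{u^{ -1}}$, is an isomorphism of Hopf algebras, and for every $u\in\mathfrak{S}_n$, $$\Theta(\mathcal{M}^*_u)=\sum_{v\in\mathfrak{S}_n}\theta(u,v)\,\mathcal{M}_v,\qquad\theta(u,v)=\#\{x\in\mathfrak{S}_n:x\le u,\ x^{ -1}\le v\}.$$
   Context: Permutations in one-line notation, product is composition. $\mathfrak{S}Sym$ is the graded Hopf algebra over $\mathbb{Q}$ with basis $\{\mathcal{F}_u:u\in\mathfrak{S}_n,n\ge0\}$ (degree $n$), product $\mathcal{F}_u\cdot\mathcal{F}_v=\sum_\zeta\mathcal{F}_{(u\times v)\zeta^{ -1}}$ over $\zeta\in\mathfrak{S}_{p+q}$ increasing on $[1,p]$ and on $[p+1,p+q]$ (for $u\in\mathfrak{S}_p,v\in\mathfrak{S}_q$, with $(u\times v)(i)=u_i$, $i\le p$, $(u\times v)(p+j)=p+v_j$), coproduct $\Delta(\mathcal{F}_u)=\sum_{p=0}^n\mathcal{F}_{\mathrm{st}(u_1..u_p)}\otimes\mathcal{F}_{\mathrm{st}(u_{p+1}..u_n)}$ where $\mathrm{st}$ gives the permutation with the same relative order. Weak order: $u\le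 v$ iff $\mathrm{Inv}(u)\subseteq\mathrm{Inv}(v)$, $\mathrm{Inv}(u)=\{(i,j):i<j,u_i>u_j\}$; Möbius function $\mu$; $\mathcal{M}_u=\sum_{v\ge u}\mu(u,v)\mathcal{F}_v$. The graded dual has degree-$n$ component the linear dual of the degree-$n$ component, with the dual structure maps. -}

module Defs where

open import Algebra.Bundles using (AbelianGroup; CommutativeRing)
import Algebra.Construct.Pointwise as Pointwise
import Algebra.Definitions.RawMonoid as RawMonoidSum
open import Algebra.Module.Bundles using (Module)
import Algebra.Module.Construct.TensorUnit as TensorUnit
open import Algebra.Module.Morphism.Structures using (IsModuleHomomorphism; IsModuleIsomorphism)
import Algebra.Properties.AbelianGroup as AbelianGroupProperties
import Algebra.Properties.CommutativeSemigroup as CommutativeSemigroupProperties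
import Algebra.Properties.Semiring.Sum as SemiringSum
open import Data.Bool.Base using (if_then_else_)
open import Data.Fin.Base as Fin using (Fin; zero; suc; toℕ; fromℕ<; inject≤; cast; punchOut; _↑ˡ_; _↑ʳ_; finToFun; funToFin)
import Data.Fin.Induction as FinInd
import Data.Fin.Properties as Finₚ
open import Data.List.Base as List using (List; []; _∷_; length; filter; allFin; mapMaybe)
open import Data.List.Membership.Propositional using (_∈_)
import Data.List.Membership.Propositional.Properties as Memₚ
import Data.List.Properties as Listₚ
open import Data.List.Relation.Unary.Any as Any using (here; there)
import Data.List.Relation.Unary.Any.Properties as Anyₚ
open import Data.Maybe.Base using (Maybe; just; nothing)
import Data.Maybe.Relation.Unary.Any as MAny
open import Data.Nat.Base as ℕ using (ℕ; zero; suc; _∸_; z≤n; s≤s)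
import Data.Nat.Properties as ℕₚ
open import Data.Product.Base using (Σ; ∃; _×_; _,_; proj₁; proj₂)
import Data.Product.Properties as Prodₚ
open import Data.Rational.Base as ℚ using (ℚ; 0ℚ; 1ℚ)
import Data.Rational.Properties as ℚₚ
open import Data.Sum.Base as Sum using (_⊎_; inj₁; inj₂)
import Data.Sum.Properties as Sumₚ
open import Data.Vec.Base using (Vec; lookup; tabulate)
import Data.Vec.Properties as Vecₚ
open import Data.Vec.Relation.Unary.AllPairs using (allPairs?)
open import Data.Vec.Relation.Unary.Unique.Propositional using (Unique)
import Data.Vec.Relation.Unary.Unique.Propositional.Properties as Uniqueₚ
open import Function.Base using (_∘_; _on_)
open import Function.Definitions using (Injective)
open import Induction.WellFounded as WF using (WellFounded; module Subrelation)
open import Level using (0ℓ)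
open import Relation.Binary.Core using (Rel)
import Relation.Binary.Construct.On as On
open import Relation.Binary.Definitions using (DecidableEquality; tri<; tri≈; tri>)
open import Relation.Binary.PropositionalEquality using (_≡_; _≢_; refl; sym; trans; cong; cong₂; subst; subst₂; isEquivalence; module ≡-Reasoning)
open import Relation.Binary.Structures using (IsStrictPartialOrder)
open import Relation.Nullary using (¬_; Dec; yes; no; does; ¬?; contradiction)
open import Relation.Nullary.Decidable using (_×-dec_; _→-dec_; recompute; map′)
open import Relation.Unary using (Pred; Decidable; _⊆_)

-- Permutations in one-line notation, with letters 0, …, n−1. Distinctness is
-- irrelevant, so permutations are equal when their words are.
record 𝔖 (n : ℕ) : Set where
  constructor perm
  field
    word      : Vec (Fin n) n
    .distinct : Unique word

open 𝔖 public using (word)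

private
  variable
    k m n p q : ℕ

unique? : (w : Vec (Fin n) k) → Dec (Unique w)
unique? = allPairs? (λ i j → ¬? (i Finₚ.≟ j))

infixl 9 _⟨_⟩
_⟨_⟩ : 𝔖 n → Fin n → Fin n
u ⟨ i ⟩ = lookup (word u) i

⟨⟩-injective : (u : 𝔖 n) → Injective _≡_ _≡_ (u ⟨_⟩)
⟨⟩-injective (perm w d) = Uniqueₚ.lookup-injective (recompute (unique? w) d) _ _

_≟_ : DecidableEquality (𝔖 n)
perm v _ ≟ perm w _ = map′ (λ { refl → refl }) (cong word) (Vecₚ.≡-dec Finₚ._≟_ v w)

_≟Σ_ : DecidableEquality (Σ ℕ 𝔖)
_≟Σ_ = Prodₚ.≡-dec ℕₚ._≟_ _≟_

fromInjection : (f : Fin n → Fin n) → Injective _≡_ _≡_ f → 𝔖 n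
fromInjection f inj = perm (tabulate f) (Uniqueₚ.tabulate⁺ inj)

∅ : 𝔖 0
∅ = fromInjection (λ i → i) (λ eq → eq)

infixr 8 _∘ₚ_
_∘ₚ_ : 𝔖 n → 𝔖 n → 𝔖 n
u ∘ₚ v = fromInjection (λ i → u ⟨ v ⟨ i ⟩ ⟩) (⟨⟩-injective v ∘ ⟨⟩-injective u)

⟨⟩-surjective : (u : 𝔖 n) (j : Fin n) → ∃ λ i → u ⟨ i ⟩ ≡ j
⟨⟩-surjective {suc n} u j with Finₚ.any? (λ i → u ⟨ i ⟩ Finₚ.≟ j)
... | yes hit  = hit
... | no  miss = contradiction (Finₚ.injective⇒≤ punched-injective) ℕₚ.1+n≰n
  where
  avoids : ∀ i → j ≢ u ⟨ i ⟩
  avoids i eq = miss (i , sym eq)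
  punched-injective : Injective _≡_ _≡_ (λ i → punchOut (avoids i))
  punched-injective eq = ⟨⟩-injective u (Finₚ.punchOut-injective (avoids _) (avoids _) eq)

infix 10 _⁻¹
_⁻¹ : 𝔖 n → 𝔖 n
u ⁻¹ = fromInjection (proj₁ ∘ ⟨⟩-surjective u)
  (λ {i} {j} eq → trans (sym (proj₂ (⟨⟩-surjective u i)))
                        (trans (cong (u ⟨_⟩) eq) (proj₂ (⟨⟩-surjective u j))))

private
  retraction : {A B : Set} (f : A → B) (g : B → A) → (∀ x → g (f x) ≡ x) → Injective _≡_ _≡_ f
  retraction _ g gf {x} {y} eq = trans (sym (gf x)) (trans (cong g eq) (gf y))

infixr 7 _×ₚ_
_×ₚ_ : 𝔖 p → 𝔖 q → 𝔖 (p ℕ.+ q)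
_×ₚ_ {p} {q} u v = fromInjection (Fin.join p q ∘ Sum.map (u ⟨_⟩) (v ⟨_⟩) ∘ Fin.splitAt p)
  (λ {i} {j} eq → retraction (Fin.splitAt p) (Fin.join p q) (Finₚ.join-splitAt p q)
                    (map-injective (Fin.splitAt p i) (Fin.splitAt p j)
                      (retraction (Fin.join p q) (Fin.splitAt p) (Finₚ.splitAt-join p q) eq)))
  where
  map-injective : ∀ x y → Sum.map (u ⟨_⟩) (v ⟨_⟩) x ≡ Sum.map (u ⟨_⟩) (v ⟨_⟩) y → x ≡ y
  map-injective (inj₁ _) (inj₁ _) eq = cong inj₁ (⟨⟩-injective u (Sumₚ.inj₁-injective eq))
  map-injective (inj₂ _) (inj₂ _) eq = cong inj₂ (⟨⟩-injective v (Sumₚ.inj₂-injective eq))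

private
  module _ {A : Set} {P Q : Pred A 0ℓ} (P? : Decidable P) (Q? : Decidable Q) (P⊆Q : P ⊆ Q) where

    filter-⊆ : ∀ xs → length (filter P? xs) ℕ.≤ length (filter Q? xs)
    filter-⊆ []       = z≤n
    filter-⊆ (x ∷ xs) with P? x | Q? x
    ... | yes _  | yes _  = s≤s (filter-⊆ xs)
    ... | yes px | no ¬qx = contradiction (P⊆Q px) ¬qx
    ... | no _   | yes _  = ℕₚ.m≤n⇒m≤1+n (filter-⊆ xs)
    ... | no _   | no _   = filter-⊆ xs

    filter-⊂ : ∀ {x xs} → x ∈ xs → ¬ P x → Q x → length (filter P? xs) ℕ.< length (filter Q? xs)
    filter-⊂ {xs = y ∷ ys} x∈ ¬px qx with P? y | Q? y | x∈
    ... | yes py | yes _  | here refl  = contradiction py ¬px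
    ... | yes _  | yes _  | there x∈ys = s≤s (filter-⊂ x∈ys ¬px qx)
    ... | yes py | no ¬qy | _          = contradiction (P⊆Q py) ¬qy
    ... | no _   | yes _  | _          = s≤s (filter-⊆ ys)
    ... | no _   | no ¬qy | here refl  = contradiction qx ¬qy
    ... | no _   | no _   | there x∈ys = filter-⊂ x∈ys ¬px qx

-- The standardization of a word w₁…wₖ with distinct letters: its i-th letter
-- is the number of letters of w smaller than wᵢ.
module _ (w : Fin k → Fin m) (w-injective : Injective _≡_ _≡_ w) where

  rank : Fin k → ℕ
  rank i = length (filter (λ j → w j Finₚ.<? w i) (allFin k))

  rank<k : ∀ i → rank i ℕ.< k
  rank<k i = subst (rank i ℕ.<_) (Listₚ.length-tabulate {n = k} (λ j → j))
    (Listₚ.filter-notAll (λ j → w j Finₚ.<? w i) (allFin k)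
      (Any.map (λ { refl → ℕₚ.<-irrefl refl }) (Memₚ.∈-allFin i)))

  rank-mono : ∀ {i j} → w i Fin.< w j → rank i ℕ.< rank j
  rank-mono {i} {j} wi<wj = filter-⊂ (λ l → w l Finₚ.<? w i) (λ l → w l Finₚ.<? w j)
    (λ wl<wi → ℕₚ.<-trans wl<wi wi<wj) (Memₚ.∈-allFin i) (ℕₚ.<-irrefl refl) wi<wj

  rank-injective : ∀ {i j} → rank i ≡ rank j → i ≡ j
  rank-injective {i} {j} eq with Finₚ.<-cmp (w i) (w j)
  ... | tri< wi<wj _ _ = contradiction (rank-mono wi<wj) (ℕₚ.<-irrefl eq)
  ... | tri≈ _ wi≡wj _ = w-injective wi≡wj
  ... | tri> _ _ wj<wi = contradiction (rank-mono wj<wi) (ℕₚ.<-irrefl (sym eq))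

  st : 𝔖 k
  st = fromInjection (λ i → fromℕ< (rank<k i))
         (λ {i} {j} eq → rank-injective (Finₚ.fromℕ<-injective (rank i) (rank j) (rank<k i) (rank<k j) eq))

-- stPrefix u p = st(u₁…uₚ) and stSuffix u p = st(uₚ₊₁…uₙ).
stPrefix : (u : 𝔖 n) (p : Fin (suc n)) → 𝔖 (toℕ p)
stPrefix u p = st (λ i → u ⟨ inject≤ i (Finₚ.toℕ≤pred[n] p) ⟩)
  (Finₚ.inject≤-injective _ _ _ _ ∘ ⟨⟩-injective u)

stSuffix : (u : 𝔖 n) (p : Fin (suc n)) → 𝔖 (n ∸ toℕ p)
stSuffix {n} u p = st (λ i → u ⟨ cast e (toℕ p ↑ʳ i) ⟩)
  (λ {i} {j} eq → Finₚ.↑ʳ-injective (toℕ p) i j (retraction (cast e) (cast (sym e)) (Finₚ.cast-involutive (sym e) e) (⟨⟩-injective u eq)))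
  where
  e : toℕ p ℕ.+ (n ∸ toℕ p) ≡ n
  e = ℕₚ.m+[n∸m]≡n (Finₚ.toℕ≤pred[n] p)

-- The n ^ n words of length n over Fin n, restricted to those with distinct letters.
perm? : Vec (Fin n) n → Maybe (𝔖 n)
perm? w with unique? w
... | yes d = just (perm w d)
... | no  _ = nothing

perms : ∀ n → List (𝔖 n)
perms n = mapMaybe (λ c → perm? (tabulate (finToFun {n} {n} c))) (allFin (n ℕ.^ n))

∈-perms : (u : 𝔖 n) → u ∈ perms n
∈-perms {n} u = Anyₚ.mapMaybe⁺ (λ c → perm? (code c)) (allFin (n ℕ.^ n))
  (Anyₚ.map⁺ (Any.map (λ { refl → found }) (Memₚ.∈-allFin (funToFin (u ⟨_⟩)))))
  where
  code : Fin (n ℕ.^ n) → Vec (Fin n) n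
  code c = tabulate (finToFun {n} {n} c)
  decode : code (funToFin (u ⟨_⟩)) ≡ word u
  decode = trans (Vecₚ.tabulate-cong (Finₚ.finToFun-funToFin (u ⟨_⟩))) (Vecₚ.tabulate∘lookup (word u))
  perm?-word : (u : 𝔖 n) → MAny.Any (u ≡_) (perm? (word u))
  perm?-word (perm w d) with unique? w
  ... | yes _ = MAny.just refl
  ... | no ¬d = contradiction (recompute (unique? w) d) ¬d
  found : MAny.Any (u ≡_) (perm? (code (funToFin (u ⟨_⟩))))
  found = subst (λ w → MAny.Any (u ≡_) (perm? w)) (sym decode) (perm?-word u)

private module ℚring = CommutativeRing ℚₚ.+-*-commutativeRing
private module ℚ∑ = SemiringSum ℚring.semiring

ℚ-Module : Set₁
ℚ-Module = Module ℚₚ.+-*-commutativeRing 0ℓ 0ℓ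

∣_∣ : ℚ-Module → Set
∣ M ∣ = Module.Carrierᴹ M

infix 4 EqualIn
EqualIn : (M : ℚ-Module) → ∣ M ∣ → ∣ M ∣ → Set
EqualIn M = Module._≈ᴹ_ M
syntax EqualIn M x y = x ≈[ M ] y

IsLinear : (M N : ℚ-Module) → (∣ M ∣ → ∣ N ∣) → Set
IsLinear M N = IsModuleHomomorphism (Module.rawModule M) (Module.rawModule N)

ℚ¹ : ℚ-Module
ℚ¹ = TensorUnit.⟨module⟩

∑ : (M : ℚ-Module) {A : Set} → List A → (A → ∣ M ∣) → ∣ M ∣
∑ M xs f = RawMonoidSum.sum (Module.+ᴹ-rawMonoid M) (λ i → f (List.lookup xs i))

∑< : (M : ℚ-Module) → ℕ → (ℕ → ∣ M ∣) → ∣ M ∣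
∑< M N f = RawMonoidSum.sum (Module.+ᴹ-rawMonoid M) {N} (λ i → f (toℕ i))

module _ (G : AbelianGroup 0ℓ 0ℓ) where
  open AbelianGroup G

  record IsScalarAction (_•_ : ℚ → Carrier → Carrier) : Set where
    field
      •-cong     : ∀ r {x y} → x ≈ y → (r • x) ≈ (r • y)
      •-distribˡ : ∀ r x y → (r • (x ∙ y)) ≈ ((r • x) ∙ (r • y))
      •-distribʳ : ∀ x r s → ((r ℚ.+ s) • x) ≈ ((r • x) ∙ (s • x))
      •-assoc    : ∀ r s x → ((r ℚ.* s) • x) ≈ (r • (s • x))
      •-identity : ∀ x → (1ℚ • x) ≈ x

  toModule : ∀ {_•_} → IsScalarAction _•_ → ℚ-Module
  toModule {_•_} isScalarAction = record
    { _*ₗ_     = _•_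
    ; _*ᵣ_     = λ x r → r • x
    ; isModule = record
      { isBimodule = record
        { isBisemimodule = record
          { +ᴹ-isCommutativeMonoid = isCommutativeMonoid
          ; isPreleftSemimodule = record
            { *ₗ-cong      = λ { {r} refl → •-cong r }
            ; *ₗ-zeroˡ     = zeroˡ
            ; *ₗ-distribʳ  = •-distribʳ
            ; *ₗ-identityˡ = •-identity
            ; *ₗ-assoc     = •-assoc
            ; *ₗ-zeroʳ     = zeroʳ
            ; *ₗ-distribˡ  = •-distribˡ
            }
          ; isPrerightSemimodule = record
            { *ᵣ-cong      = λ x≈y r≡s → trans′ (•-cong _ x≈y) (•-congˡ r≡s)
            ; *ᵣ-zeroʳ     = zeroˡ
            ; *ᵣ-distribˡ  = •-distribʳ
            ; *ᵣ-identityʳ = •-identity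
            ; *ᵣ-assoc     = λ x r s → trans′ (G.sym (•-assoc s r x)) (•-congˡ (ℚₚ.*-comm s r))
            ; *ᵣ-zeroˡ     = zeroʳ
            ; *ᵣ-distribʳ  = •-distribˡ
            }
          ; *ₗ-*ᵣ-assoc = λ r x s → trans′ (G.sym (•-assoc s r x)) (trans′ (•-congˡ (ℚₚ.*-comm s r)) (•-assoc r s x))
          }
        ; -ᴹ‿cong    = ⁻¹-cong
        ; -ᴹ‿inverse = inverse
        }
      ; *ₗ-*ᵣ-coincident = λ _ _ → G.refl
      }
    }
    where
    module G = AbelianGroup G
    open IsScalarAction isScalarAction
    open AbelianGroupProperties G using (identityˡ-unique)
    trans′ = G.trans
    •-congˡ : ∀ {r s x} → r ≡ s → (r • x) ≈ (s • x)
    •-congˡ refl = G.refl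
    zeroˡ : ∀ x → (0ℚ • x) ≈ ε
    zeroˡ x = identityˡ-unique _ _ (G.trans (G.sym (•-distribʳ x 0ℚ 0ℚ)) G.refl)
    zeroʳ : ∀ r → (r • ε) ≈ ε
    zeroʳ r = identityˡ-unique _ _ (G.trans (G.sym (•-distribˡ r ε ε)) (•-cong r (G.identityˡ ε)))

module _ (M N : ℚ-Module) where
  private
    module M = Module M
    module N = Module N

  mkLinear : (f : ∣ M ∣ → ∣ N ∣) →
             (∀ {x y} → x M.≈ᴹ y → f x N.≈ᴹ f y) →
             (∀ x y → f (x M.+ᴹ y) N.≈ᴹ f x N.+ᴹ f y) →
             (∀ r x → f (r M.*ₗ x) N.≈ᴹ r N.*ₗ f x) →
             IsLinear M N f
  mkLinear f f-cong f-+ f-• = record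
    { isBimoduleHomomorphism = record
      { +ᴹ-isGroupHomomorphism = record
        { isMonoidHomomorphism = record
          { isMagmaHomomorphism = record
            { isRelHomomorphism = record { cong = f-cong }
            ; homo = f-+
            }
          ; ε-homo = f-0
          }
        ; ⁻¹-homo = λ x → inverseˡ-unique _ _
            (N.≈ᴹ-trans (N.≈ᴹ-sym (f-+ _ x)) (N.≈ᴹ-trans (f-cong (M.-ᴹ‿inverseˡ x)) f-0))
        }
      ; *ₗ-homo = f-•
      ; *ᵣ-homo = λ r x → N.≈ᴹ-trans (f-cong (M.≈ᴹ-sym (M.*ₗ-*ᵣ-coincident r x)))
                            (N.≈ᴹ-trans (f-• r x) (N.*ₗ-*ᵣ-coincident r (f x)))
      }
    }
    where
    open AbelianGroupProperties N.+ᴹ-abelianGroup using (inverseˡ-unique; identityˡ-unique)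
    f-0 : f M.0ᴹ N.≈ᴹ N.0ᴹ
    f-0 = identityˡ-unique _ _ (N.≈ᴹ-trans (N.≈ᴹ-sym (f-+ M.0ᴹ M.0ᴹ)) (f-cong (M.+ᴹ-identityˡ M.0ᴹ)))

-- Functions A → ℚ; for finite A this is the space with basis A.
Functions : Set → ℚ-Module
Functions A = toModule (Pointwise.abelianGroup A ℚₚ.+-0-abelianGroup) {λ r f a → r ℚ.* f a} record
  { •-cong     = λ r eq a → cong (r ℚ.*_) (eq a)
  ; •-distribˡ = λ r f g a → ℚₚ.*-distribˡ-+ r (f a) (g a)
  ; •-distribʳ = λ f r s a → ℚₚ.*-distribʳ-+ (f a) r s
  ; •-assoc    = λ r s f a → ℚₚ.*-assoc r s (f a)
  ; •-identity = λ f a → ℚₚ.*-identityˡ (f a)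
  }

record LinearForm (M : ℚ-Module) : Set where
  constructor linearForm
  field
    form     : ∣ M ∣ → ℚ
    isLinear : IsLinear M ℚ¹ form

open LinearForm public

Dual : ℚ-Module → ℚ-Module
Dual M = toModule dualGroup {_•_} record
  { •-cong     = λ r eq x → cong (r ℚ.*_) (eq x)
  ; •-distribˡ = λ r f g x → ℚₚ.*-distribˡ-+ r (form f x) (form g x)
  ; •-distribʳ = λ f r s x → ℚₚ.*-distribʳ-+ (form f x) r s
  ; •-assoc    = λ r s f x → ℚₚ.*-assoc r s (form f x)
  ; •-identity = λ f x → ℚₚ.*-identityˡ (form f x)
  }
  where
  module M = Module M
  module L (f : LinearForm M) = IsModuleHomomorphism (isLinear f)

  zeroForm : LinearForm M
  zeroForm = linearForm (λ _ → 0ℚ) (mkLinear M ℚ¹ _ (λ _ → refl) (λ _ _ → refl) (λ r _ → sym (ℚₚ.*-zeroʳ r)))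

  _⊕_ : LinearForm M → LinearForm M → LinearForm M
  f ⊕ g = linearForm (λ x → form f x ℚ.+ form g x) (mkLinear M ℚ¹ _
    (λ eq → cong₂ ℚ._+_ (L.⟦⟧-cong f eq) (L.⟦⟧-cong g eq))
    (λ x y → trans (cong₂ ℚ._+_ (L.+ᴹ-homo f x y) (L.+ᴹ-homo g x y))
                   (interchange (form f x) (form f y) (form g x) (form g y)))
    (λ r x → trans (cong₂ ℚ._+_ (L.*ₗ-homo f r x) (L.*ₗ-homo g r x))
                   (sym (ℚₚ.*-distribˡ-+ r (form f x) (form g x)))))
    where open CommutativeSemigroupProperties ℚring.+-commutativeSemigroup using (interchange)

  _•_ : ℚ → LinearForm M → LinearForm M
  r • f = linearForm (λ x → r ℚ.* form f x) (mkLinear M ℚ¹ _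
    (λ eq → cong (r ℚ.*_) (L.⟦⟧-cong f eq))
    (λ x y → trans (cong (r ℚ.*_) (L.+ᴹ-homo f x y)) (ℚₚ.*-distribˡ-+ r (form f x) (form f y)))
    (λ s x → trans (cong (r ℚ.*_) (L.*ₗ-homo f s x)) (x∙yz≈y∙xz r s (form f x))))
    where open CommutativeSemigroupProperties ℚring.*-commutativeSemigroup using (x∙yz≈y∙xz)

  ⊖_ : LinearForm M → LinearForm M
  ⊖ f = linearForm (λ x → ℚ.- form f x) (mkLinear M ℚ¹ _
    (λ eq → cong ℚ.-_ (L.⟦⟧-cong f eq))
    (λ x y → trans (cong ℚ.-_ (L.+ᴹ-homo f x y)) (ℚₚ.neg-distrib-+ (form f x) (form f y)))
    (λ r x → trans (cong ℚ.-_ (L.*ₗ-homo f r x)) (ℚₚ.neg-distribʳ-* r (form f x))))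

  dualGroup : AbelianGroup 0ℓ 0ℓ
  dualGroup = record
    { Carrier = LinearForm M
    ; _≈_ = λ f g → ∀ x → form f x ≡ form g x
    ; _∙_ = _⊕_
    ; ε   = zeroForm
    ; _⁻¹ = ⊖_
    ; isAbelianGroup = record
      { isGroup = record
        { isMonoid = record
          { isSemigroup = record
            { isMagma = record
              { isEquivalence = record
                { refl  = λ _ → refl
                ; sym   = λ eq x → sym (eq x)
                ; trans = λ eq eq′ x → trans (eq x) (eq′ x)
                }
              ; ∙-cong = λ eq eq′ x → cong₂ ℚ._+_ (eq x) (eq′ x)
              }
            ; assoc = λ f g h x → ℚₚ.+-assoc (form f x) (form g x) (form h x)
            }
          ; identity = (λ f x → ℚₚ.+-identityˡ (form f x)) , (λ f x → ℚₚ.+-identityʳ (form f x))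
          }
        ; inverse = (λ f x → ℚₚ.+-inverseˡ (form f x)) , (λ f x → ℚₚ.+-inverseʳ (form f x))
        ; ⁻¹-cong = λ eq x → cong ℚ.-_ (eq x)
        }
      ; comm = λ f g x → ℚₚ.+-comm (form f x) (form g x)
      }
    }

module _ (M : ℕ → ℚ-Module) where
  private module M n = Module (M n)

  -- An element of ⨁ₙ Mₙ: a family of components that vanish from some degree on.
  record DirectSum : Set where
    constructor directSum
    field
      comp     : ∀ n → ∣ M n ∣
      bound    : ℕ
      vanishes : ∀ n → bound ℕ.≤ n → comp n ≈[ M n ] M.0ᴹ n

open DirectSum public

module _ (M : ℕ → ℚ-Module) where
  private module M n = Module (M n)

  ⨁ : ℚ-Module
  ⨁ = toModule sumGroup {_•_} record
    { •-cong     = λ r eq n → M.*ₗ-congˡ n (eq n)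
    ; •-distribˡ = λ r x y n → M.*ₗ-distribˡ n r (comp x n) (comp y n)
    ; •-distribʳ = λ x r s n → M.*ₗ-distribʳ n (comp x n) r s
    ; •-assoc    = λ r s x n → M.*ₗ-assoc n r s (comp x n)
    ; •-identity = λ x n → M.*ₗ-identityˡ n (comp x n)
    }
    where
    _⊕_ : DirectSum M → DirectSum M → DirectSum M
    x ⊕ y = directSum (λ n → M._+ᴹ_ n (comp x n) (comp y n)) (bound x ℕ.⊔ bound y)
      (λ n le → M.≈ᴹ-trans n
        (M.+ᴹ-cong n (vanishes x n (ℕₚ.m⊔n≤o⇒m≤o (bound x) (bound y) le))
                     (vanishes y n (ℕₚ.m⊔n≤o⇒n≤o (bound x) (bound y) le)))
        (M.+ᴹ-identityˡ n _))

    _•_ : ℚ → DirectSum M → DirectSum M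
    r • x = directSum (λ n → M._*ₗ_ n r (comp x n)) (bound x)
      (λ n le → M.≈ᴹ-trans n (M.*ₗ-congˡ n (vanishes x n le)) (M.*ₗ-zeroʳ n r))

    ⊖_ : DirectSum M → DirectSum M
    ⊖ x = directSum (λ n → M.-ᴹ_ n (comp x n)) (bound x)
      (λ n le → M.≈ᴹ-trans n (M.-ᴹ‿cong n (vanishes x n le))
                  (AbelianGroupProperties.ε⁻¹≈ε (M.+ᴹ-abelianGroup n)))

    sumGroup : AbelianGroup 0ℓ 0ℓ
    sumGroup = record
      { Carrier = DirectSum M
      ; _≈_ = λ x y → ∀ n → comp x n ≈[ M n ] comp y n
      ; _∙_ = _⊕_
      ; ε   = directSum M.0ᴹ 0 (λ n _ → M.≈ᴹ-refl n)
      ; _⁻¹ = ⊖_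
      ; isAbelianGroup = record
        { isGroup = record
          { isMonoid = record
            { isSemigroup = record
              { isMagma = record
                { isEquivalence = record
                  { refl  = λ n → M.≈ᴹ-refl n
                  ; sym   = λ eq n → M.≈ᴹ-sym n (eq n)
                  ; trans = λ eq eq′ n → M.≈ᴹ-trans n (eq n) (eq′ n)
                  }
                ; ∙-cong = λ eq eq′ n → M.+ᴹ-cong n (eq n) (eq′ n)
                }
              ; assoc = λ x y z n → M.+ᴹ-assoc n (comp x n) (comp y n) (comp z n)
              }
            ; identity = (λ x n → M.+ᴹ-identityˡ n (comp x n)) , (λ x n → M.+ᴹ-identityʳ n (comp x n))
            }
          ; inverse = (λ x n → M.-ᴹ‿inverseˡ n (comp x n)) , (λ x n → M.-ᴹ‿inverseʳ n (comp x n))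
          ; ⁻¹-cong = λ eq n → M.-ᴹ‿cong n (eq n)
          }
        ; comm = λ x y n → M.+ᴹ-comm n (comp x n) (comp y n)
        }
      }

  atDegree : ∀ m → ∣ M m ∣ → ∀ n → Dec (m ≡ n) → ∣ M n ∣
  atDegree m x _ (yes refl) = x
  atDegree m x n (no _)     = M.0ᴹ n

  ι : ∀ m → ∣ M m ∣ → ∣ ⨁ ∣
  ι m x = directSum (λ n → atDegree m x n (m ℕₚ.≟ n)) (suc m) (λ n m<n → outside n m<n (m ℕₚ.≟ n))
    where
    outside : ∀ n → m ℕ.< n → (d : Dec (m ≡ n)) → atDegree m x n d ≈[ M n ] M.0ᴹ n
    outside _ m<m (yes refl) = contradiction m<m (ℕₚ.<-irrefl refl)
    outside n _   (no _)     = M.≈ᴹ-refl n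

-- The tensor product over ℚ: formal linear combinations of pairs modulo the
-- vector space axioms and bilinearity of _⊗_.
module _ (M N : ℚ-Module) where
  private
    module M = Module M
    module N = Module N

  infix  4 _∼_
  infixl 6 _⊞_
  infixr 7 _⊡_
  infix  8 _⊗_

  data Tensor : Set where
    _⊗_ : ∣ M ∣ → ∣ N ∣ → Tensor
    𝟎   : Tensor
    _⊞_ : Tensor → Tensor → Tensor
    _⊡_ : ℚ → Tensor → Tensor

  data _∼_ : Tensor → Tensor → Set where
    ∼-refl   : ∀ {s} → s ∼ s
    ∼-sym    : ∀ {s t} → s ∼ t → t ∼ s
    ∼-trans  : ∀ {s t u} → s ∼ t → t ∼ u → s ∼ u
    ⊞-cong   : ∀ {s s′ t t′} → s ∼ s′ → t ∼ t′ → s ⊞ t ∼ s′ ⊞ t′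
    ⊡-cong   : ∀ r {s t} → s ∼ t → r ⊡ s ∼ r ⊡ t
    ⊞-assoc  : ∀ s t u → (s ⊞ t) ⊞ u ∼ s ⊞ (t ⊞ u)
    ⊞-comm   : ∀ s t → s ⊞ t ∼ t ⊞ s
    ⊞-identity : ∀ s → 𝟎 ⊞ s ∼ s
    ⊞-inverse  : ∀ s → (ℚ.- 1ℚ) ⊡ s ⊞ s ∼ 𝟎
    ⊡-distribˡ : ∀ r s t → r ⊡ (s ⊞ t) ∼ r ⊡ s ⊞ r ⊡ t
    ⊡-distribʳ : ∀ t r s → (r ℚ.+ s) ⊡ t ∼ r ⊡ t ⊞ s ⊡ t
    ⊡-assoc    : ∀ r s t → (r ℚ.* s) ⊡ t ∼ r ⊡ (s ⊡ t)
    ⊡-identity : ∀ t → 1ℚ ⊡ t ∼ t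
    ⊗-cong   : ∀ {x x′ y y′} → x M.≈ᴹ x′ → y N.≈ᴹ y′ → x ⊗ y ∼ x′ ⊗ y′
    ⊗-+ˡ     : ∀ x x′ y → (x M.+ᴹ x′) ⊗ y ∼ x ⊗ y ⊞ x′ ⊗ y
    ⊗-+ʳ     : ∀ x y y′ → x ⊗ (y N.+ᴹ y′) ∼ x ⊗ y ⊞ x ⊗ y′
    ⊗-•ˡ     : ∀ r x y → (r M.*ₗ x) ⊗ y ∼ r ⊡ x ⊗ y
    ⊗-•ʳ     : ∀ r x y → x ⊗ (r N.*ₗ y) ∼ r ⊡ x ⊗ y


infixr 8 _⊗ᴹ_
_⊗ᴹ_ : ℚ-Module → ℚ-Module → ℚ-Module
M ⊗ᴹ N = toModule tensorGroup {_⊡_} record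
  { •-cong     = ⊡-cong
  ; •-distribˡ = ⊡-distribˡ
  ; •-distribʳ = ⊡-distribʳ
  ; •-assoc    = ⊡-assoc
  ; •-identity = ⊡-identity
  }
  where
  tensorGroup : AbelianGroup 0ℓ 0ℓ
  tensorGroup = record
    { Carrier = Tensor M N
    ; _≈_ = _∼_ M N
    ; _∙_ = _⊞_
    ; ε   = 𝟎
    ; _⁻¹ = (ℚ.- 1ℚ) ⊡_
    ; isAbelianGroup = record
      { isGroup = record
        { isMonoid = record
          { isSemigroup = record
            { isMagma = record
              { isEquivalence = record { refl = ∼-refl ; sym = ∼-sym ; trans = ∼-trans }
              ; ∙-cong = ⊞-cong
              }
            ; assoc = ⊞-assoc
            }
          ; identity = ⊞-identity , (λ s → ∼-trans (⊞-comm s 𝟎) (⊞-identity s))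
          }
        ; inverse = ⊞-inverse , (λ s → ∼-trans (⊞-comm s _) (⊞-inverse s))
        ; ⁻¹-cong = ⊡-cong (ℚ.- 1ℚ)
        }
      ; comm = ⊞-comm
      }
    }

-- The linear map M ⊗ N → P induced by a bilinear map β.
module _ {M N : ℚ-Module} (P : ℚ-Module) (β : ∣ M ∣ → ∣ N ∣ → ∣ P ∣) where
  private module P = Module P

  induced : Tensor M N → ∣ P ∣
  induced (x ⊗ y) = β x y
  induced 𝟎       = P.0ᴹ
  induced (s ⊞ t) = induced s P.+ᴹ induced t
  induced (r ⊡ t) = r P.*ₗ induced t

_⊗₁_ : ∀ {M M′ N N′} → (∣ M ∣ → ∣ M′ ∣) → (∣ N ∣ → ∣ N′ ∣) → Tensor M N → Tensor M′ N′
_⊗₁_ {M′ = M′} {N′ = N′} f g = induced (M′ ⊗ᴹ N′) (λ x y → f x ⊗ g y)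

-- The structure maps only, in the style of the library's raw bundles.
record RawBialgebra : Set₁ where
  field
    space : ℚ-Module
    _·_   : ∣ space ∣ → ∣ space ∣ → ∣ space ∣
    𝟙     : ∣ space ∣
    Δ     : ∣ space ∣ → Tensor space space
    ε     : ∣ space ∣ → ℚ

record IsAntipode (H : RawBialgebra) (S : ∣ RawBialgebra.space H ∣ → ∣ RawBialgebra.space H ∣) : Set where
  open RawBialgebra H
  open Module space using (_*ₗ_)
  field
    linear : IsLinear space space S
    left   : ∀ x → induced space (λ y z → S y · z) (Δ x) ≈[ space ] ε x *ₗ 𝟙
    right  : ∀ x → induced space (λ y z → y · S z) (Δ x) ≈[ space ] ε x *ₗ 𝟙

record IsHopfIsomorphism (H K : RawBialgebra) (f : ∣ RawBialgebra.space H ∣ → ∣ RawBialgebra.space K ∣) : Set where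
  private
    module H = RawBialgebra H
    module K = RawBialgebra K
  field
    isModuleIsomorphism : IsModuleIsomorphism (Module.rawModule H.space) (Module.rawModule K.space) f
    ·-homo : ∀ x y → f (x H.· y) ≈[ K.space ] f x K.· f y
    𝟙-homo : f H.𝟙 ≈[ K.space ] K.𝟙
    Δ-homo : ∀ x → K.Δ (f x) ≈[ K.space ⊗ᴹ K.space ] (f ⊗₁ f) (H.Δ x)
    ε-homo : ∀ x → K.ε (f x) ≡ H.ε x
    -- An antipode is determined by the bialgebra, so it is not part of the data.
    S-homo : ∀ {S T} → IsAntipode H S → IsAntipode K T → ∀ x → f (S x) ≈[ K.space ] T (f x)

Inv : 𝔖 n → Pred (Fin n × Fin n) 0ℓ
Inv u (i , j) = i Fin.< j × u ⟨ j ⟩ Fin.< u ⟨ i ⟩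

infix 4 _≤_ _<_ _≤?_ _<?_
_≤_ : Rel (𝔖 n) 0ℓ
u ≤ v = Inv u ⊆ Inv v

_≤?_ : (u v : 𝔖 n) → Dec (u ≤ v)
u ≤? v = map′ (λ sub {x} → sub (proj₁ x) (proj₂ x)) (λ sub i j → sub {i , j})
  (Finₚ.all? λ i → Finₚ.all? λ j → inv? u i j →-dec inv? v i j)
  where
  inv? : (w : 𝔖 _) → ∀ i j → Dec (Inv w (i , j))
  inv? w i j = (i Finₚ.<? j) ×-dec (w ⟨ j ⟩ Finₚ.<? w ⟨ i ⟩)

-- Equivalently u ≤ v and u ≢ v, as inversion sets determine permutations.
_<_ : Rel (𝔖 n) 0ℓ
u < v = u ≤ v × ¬ (v ≤ u)

_<?_ : (u v : 𝔖 n) → Dec (u < v)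
u <? v = (u ≤? v) ×-dec ¬? (v ≤? u)

<-wellFounded : WellFounded (_<_ {n})
<-wellFounded {n} = Subrelation.wellFounded reindex (On.wellFounded index (FinInd.spo-wellFounded ⊏-isSPO))
  where
  index : 𝔖 n → Fin (length (perms n))
  index u = Any.index (∈-perms u)
  at : Fin (length (perms n)) → 𝔖 n
  at = List.lookup (perms n)
  reindex : ∀ {u v} → u < v → at (index u) < at (index v)
  reindex {u} {v} u<v = subst₂ _<_ (Anyₚ.lookup-index (∈-perms u)) (Anyₚ.lookup-index (∈-perms v)) u<v
  ⊏-isSPO : IsStrictPartialOrder _≡_ (_<_ on at)
  ⊏-isSPO = record
    { isEquivalence = isEquivalence
    ; irrefl        = λ { refl (_ , v≰v) → v≰v (λ x → x) }
    ; trans         = λ { (a , b) (c , d) → (λ x → c (a x)) , (λ e → b (λ x → e (c x))) }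
    ; <-resp-≈      = (λ { refl x → x }) , (λ { refl x → x })
    }

private
  between? : (u v w : 𝔖 n) → Dec (u ≤ w × w < v)
  between? u v w = (u ≤? w) ×-dec (w <? v)

  μ-summand : (u v : 𝔖 n) → (∀ {w} → w < v → ℚ) → ∀ w → Dec (u ≤ w × w < v) → ℚ
  μ-summand u v μ[u,-] w (yes (_ , w<v)) = μ[u,-] {w} w<v
  μ-summand u v μ[u,-] w (no _)          = 0ℚ

  μ-step : (u v : 𝔖 n) → WF.WfRec _<_ (λ _ → ℚ) v → ℚ
  μ-step {n} u v μ[u,-] =
    if does (u ≟ v) then 1ℚ else
    if does (u ≤? v) then ℚ.- ∑ ℚ¹ (perms n) (λ w → μ-summand u v (λ {w} → μ[u,-] {w}) w (between? u v w)) else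
    0ℚ

-- μ(u,u) = 1, μ(u,v) = −Σ_{u≤w<v} μ(u,w) for u < v, and μ(u,v) = 0 otherwise
-- (see μ-unfold).
μ : 𝔖 n → 𝔖 n → ℚ
μ u = WF.All.wfRec <-wellFounded 0ℓ (λ _ → ℚ) (μ-step u)

private
  ∑-cong-≡ : {A : Set} (xs : List A) {f g : A → ℚ} → (∀ x → f x ≡ g x) → ∑ ℚ¹ xs f ≡ ∑ ℚ¹ xs g
  ∑-cong-≡ []       eq = refl
  ∑-cong-≡ (x ∷ xs) eq = cong₂ ℚ._+_ (eq x) (∑-cong-≡ xs eq)

μ-unfold : (u v : 𝔖 n) → μ u v ≡
  (if does (u ≟ v) then 1ℚ else
   if does (u ≤? v) then ℚ.- ∑ ℚ¹ (perms n) (λ w → if does ((u ≤? w) ×-dec (w <? v)) then μ u w else 0ℚ) else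
   0ℚ)
μ-unfold {n} u v = trans unfold
  (cong (λ s → if does (u ≟ v) then 1ℚ else if does (u ≤? v) then ℚ.- s else 0ℚ)
    (∑-cong-≡ (perms n) (λ w → masked w (between? u v w))))
  where
  masked : ∀ w (d : Dec (u ≤ w × w < v)) → μ-summand u v (λ {w} _ → μ u w) w d ≡ (if does d then μ u w else 0ℚ)
  masked w (yes _) = refl
  masked w (no _)  = refl
  step-cong : ∀ v {f g : ∀ {w} → w < v → ℚ} → (∀ {w} (w<v : w < v) → f {w} w<v ≡ g {w} w<v) →
              μ-step u v (λ {w} → f {w}) ≡ μ-step u v (λ {w} → g {w})
  step-cong v {f} {g} eq = cong (λ s → if does (u ≟ v) then 1ℚ else if does (u ≤? v) then ℚ.- s else 0ℚ)
    (∑-cong-≡ (perms n) (λ w → go w (between? u v w)))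
    where
    go : ∀ w (d : Dec (u ≤ w × w < v)) →
         μ-summand u v (λ {w} → f {w}) w d ≡ μ-summand u v (λ {w} → g {w}) w d
    go w (yes (_ , w<v)) = eq {w} w<v
    go w (no _)          = refl
  unfold : μ u v ≡ μ-step u v (λ {w} _ → μ u w)
  unfold = WF.FixPoint.unfold-wfRec <-wellFounded (λ _ → ℚ) (μ-step u)
    (λ v {f} {g} eq → step-cong v {λ {w} → f {w}} {λ {w} → g {w}} (λ {w} → eq {w})) {v}

V : ℕ → ℚ-Module
V n = Functions (𝔖 n)

𝔖Symᴹ : ℚ-Module
𝔖Symᴹ = ⨁ V

infixr 7 _•_
_•_ : ℚ → ∣ 𝔖Symᴹ ∣ → ∣ 𝔖Symᴹ ∣
_•_ = Module._*ₗ_ 𝔖Symᴹ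

F : 𝔖 n → ∣ 𝔖Symᴹ ∣
F {n} u = ι V n (λ w → if does (u ≟ w) then 1ℚ else 0ℚ)

-- The linear map 𝔖Sym → P with F u ↦ φ u.
linearExtension : (P : ℚ-Module) → (∀ {n} → 𝔖 n → ∣ P ∣) → ∣ 𝔖Symᴹ ∣ → ∣ P ∣
linearExtension P φ x = ∑< P (bound x) λ n → ∑ P (perms n) λ u → comp x n u *ₗ φ u
  where open Module P using (_*ₗ_)

IsShuffle : ∀ p q → 𝔖 (p ℕ.+ q) → Set
IsShuffle p q ζ = (∀ i j → i Fin.< j → ζ ⟨ i ↑ˡ q ⟩ Fin.< ζ ⟨ j ↑ˡ q ⟩)
                × (∀ i j → i Fin.< j → ζ ⟨ p ↑ʳ i ⟩ Fin.< ζ ⟨ p ↑ʳ j ⟩)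

isShuffle? : ∀ p q → Decidable (IsShuffle p q)
isShuffle? p q ζ =
  Finₚ.all? (λ i → Finₚ.all? λ j → (i Finₚ.<? j) →-dec (ζ ⟨ i ↑ˡ q ⟩ Finₚ.<? ζ ⟨ j ↑ˡ q ⟩))
  ×-dec
  Finₚ.all? (λ i → Finₚ.all? λ j → (i Finₚ.<? j) →-dec (ζ ⟨ p ↑ʳ i ⟩ Finₚ.<? ζ ⟨ p ↑ʳ j ⟩))

F-product : 𝔖 p → 𝔖 q → ∣ 𝔖Symᴹ ∣
F-product {p} {q} u v =
  ∑ 𝔖Symᴹ (filter (isShuffle? p q) (perms (p ℕ.+ q))) λ ζ → F ((u ×ₚ v) ∘ₚ ζ ⁻¹)

F-coproduct : 𝔖 n → Tensor 𝔖Symᴹ 𝔖Symᴹ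
F-coproduct {n} u = ∑ (𝔖Symᴹ ⊗ᴹ 𝔖Symᴹ) (allFin (suc n)) λ p → F (stPrefix u p) ⊗ F (stSuffix u p)

𝔖Sym : RawBialgebra
𝔖Sym = record
  { space = 𝔖Symᴹ
  ; _·_   = λ x y → linearExtension 𝔖Symᴹ (λ u → linearExtension 𝔖Symᴹ (λ v → F-product u v) y) x
  ; 𝟙     = F ∅
  ; Δ     = linearExtension (𝔖Symᴹ ⊗ᴹ 𝔖Symᴹ) F-coproduct
  ; ε     = λ x → comp x 0 ∅
  }

M : 𝔖 n → ∣ 𝔖Symᴹ ∣
M {n} u = ∑ 𝔖Symᴹ (filter (u ≤?_) (perms n)) λ v → μ u v • F v

V* : ℕ → ℚ-Module
V* n = Dual (V n)

𝔖Sym*ᴹ : ℚ-Module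
𝔖Sym*ᴹ = ⨁ V*

⟪_,_⟫ : ∣ 𝔖Sym*ᴹ ∣ → ∣ 𝔖Symᴹ ∣ → ℚ
⟪ f , x ⟫ = ∑< ℚ¹ (bound f) λ n → form (comp f n) (comp x n)

IsDualTo : (∀ {n} → 𝔖 n → ∣ 𝔖Symᴹ ∣) → (∀ {n} → 𝔖 n → ∣ 𝔖Sym*ᴹ ∣) → Set
IsDualTo b b* = ∀ {m n} (u : 𝔖 m) (v : 𝔖 n) →
  ⟪ b* u , b v ⟫ ≡ (if does ((m , u) ≟Σ (n , v)) then 1ℚ else 0ℚ)

F* : 𝔖 n → ∣ 𝔖Sym*ᴹ ∣
F* {n} u = ι V* n (linearForm (λ x → x u) (mkLinear (V n) ℚ¹ _ (λ eq → eq u) (λ _ _ → refl) (λ _ _ → refl)))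

F*-coordinate : ∀ z (u : 𝔖 n) → ⟪ F* u , z ⟫ ≡ comp z n u
F*-coordinate {n} z u = top n (λ k → form (comp (F* u) k) (comp z k)) (λ k k<n → below k k<n (n ℕₚ.≟ k)) (at (n ℕₚ.≟ n))
  where
  e : ∣ V* n ∣
  e = linearForm (λ x → x u) (mkLinear (V n) ℚ¹ _ (λ eq → eq u) (λ _ _ → refl) (λ _ _ → refl))
  below : ∀ k → k ℕ.< n → (d : Dec (n ≡ k)) → form (atDegree V* n e k d) (comp z k) ≡ 0ℚ
  below k k<n (yes refl) = contradiction k<n (ℕₚ.<-irrefl refl)
  below k k<n (no _)     = refl
  at : (d : Dec (n ≡ n)) → form (atDegree V* n e n d) (comp z n) ≡ comp z n u
  at (yes eq) rewrite ℕₚ.≡-irrelevant eq refl = refl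
  at (no ≢)   = contradiction refl ≢
  top : ∀ n h {r} → (∀ k → k ℕ.< n → h k ≡ 0ℚ) → h n ≡ r → ∑< ℚ¹ (suc n) h ≡ r
  top zero    h z eq = trans (ℚₚ.+-identityʳ (h 0)) eq
  top (suc n) h z eq = trans (cong₂ ℚ._+_ (z 0 (s≤s z≤n)) (top n (h ∘ suc) (λ k k<n → z (suc k) (s≤s k<n)) eq))
                             (ℚₚ.+-identityˡ _)

F*-dual : IsDualTo F F*
F*-dual {m} {n} u v = trans (F*-coordinate (F v) u) (go u (n ℕₚ.≟ m) ((m , u) ≟Σ (n , v)))
  where
  δ : 𝔖 n → ℚ
  δ w = if does (v ≟ w) then 1ℚ else 0ℚ
  go : ∀ {m} (u : 𝔖 m) (d : Dec (n ≡ m)) (e : Dec ((m , u) ≡ (n , v))) →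
       atDegree V n δ m d u ≡ (if does e then 1ℚ else 0ℚ)
  go u (no n≢m)   (yes refl) = contradiction refl n≢m
  go u (no _)     (no _)     = refl
  go u (yes refl) e          = same u (v ≟ u) e
    where
    same : ∀ u (d : Dec (v ≡ u)) (e : Dec ((n , u) ≡ (n , v))) →
           (if does d then 1ℚ else 0ℚ) ≡ (if does e then 1ℚ else 0ℚ)
    same u (yes _)    (yes _)    = refl
    same u (yes refl) (no u≢v)   = contradiction refl u≢v
    same u (no v≢u)   (yes refl) = contradiction refl v≢u
    same u (no _)     (no _)     = refl

-- f ⊗ g as a functional on 𝔖Sym ⊗ 𝔖Sym.
pair² : ∣ 𝔖Sym*ᴹ ∣ → ∣ 𝔖Sym*ᴹ ∣ → Tensor 𝔖Symᴹ 𝔖Symᴹ → ℚ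
pair² f g = induced ℚ¹ (λ x y → ⟪ f , x ⟫ ℚ.* ⟪ g , y ⟫)

private
  *-zeroˡ′ : ∀ a b → a ≡ 0ℚ → a ℚ.* b ≡ 0ℚ
  *-zeroˡ′ a b refl = ℚₚ.*-zeroˡ b

  *-zeroʳ′ : ∀ a b → b ≡ 0ℚ → a ℚ.* b ≡ 0ℚ
  *-zeroʳ′ a b refl = ℚₚ.*-zeroʳ a

  sum-zero : ∀ {N} {h : Fin N → ℚ} → (∀ i → h i ≡ 0ℚ) → ℚ∑.sum h ≡ 0ℚ
  sum-zero {N} eq = trans (ℚ∑.sum-cong-≗ eq) (ℚ∑.sum-replicate-zero N)

  ∑<-cong : ∀ N {f g : ℕ → ℚ} → (∀ k → f k ≡ g k) → ∑< ℚ¹ N f ≡ ∑< ℚ¹ N g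
  ∑<-cong N eq = ℚ∑.sum-cong-≗ {N} λ i → eq (toℕ i)

  *-distribˡ-∑∑ : ∀ N r (h : ∀ n → 𝔖 n → ℚ) →
    r ℚ.* (∑< ℚ¹ N λ n → ∑ ℚ¹ (perms n) (h n)) ≡ (∑< ℚ¹ N λ n → ∑ ℚ¹ (perms n) λ u → r ℚ.* h n u)
  *-distribˡ-∑∑ N r h = trans (ℚ∑.*-distribˡ-sum {N} r _)
    (∑<-cong N λ n → ℚ∑.*-distribˡ-sum {length (perms n)} r (λ i → h n (List.lookup (perms n) i)))

  ∑-zero : {A : Set} (xs : List A) {h : A → ℚ} → (∀ x → h x ≡ 0ℚ) → ∑ ℚ¹ xs h ≡ 0ℚ
  ∑-zero xs eq = sum-zero λ i → eq (List.lookup xs i)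

  induced-sum : ∀ {M N : ℚ-Module} (β : ∣ M ∣ → ∣ N ∣ → ℚ) {k} (t : Fin k → Tensor M N) →
    induced ℚ¹ β (RawMonoidSum.sum (Module.+ᴹ-rawMonoid (M ⊗ᴹ N)) t) ≡ ℚ∑.sum (λ i → induced ℚ¹ β (t i))
  induced-sum β {zero}  t = refl
  induced-sum β {suc k} t = cong (induced ℚ¹ β (t zero) ℚ.+_) (induced-sum β (t ∘ suc))

  module Combination (c : ∀ {n} → 𝔖 n → ℚ) where

    combination : ℕ → (∀ n → 𝔖 n → ℚ) → ℚ
    combination N a = ∑< ℚ¹ N λ n → ∑ ℚ¹ (perms n) λ u → a n u ℚ.* c u

    combination-cong : ∀ N {a b} → (∀ n u → a n u ≡ b n u) → combination N a ≡ combination N b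
    combination-cong N eq = ℚ∑.sum-cong-≗ {N} λ n → ∑-cong-≡ (perms (toℕ n)) λ u → cong (ℚ._* c u) (eq (toℕ n) u)

    combination-+ : ∀ N a b → combination N (λ n u → a n u ℚ.+ b n u) ≡ combination N a ℚ.+ combination N b
    combination-+ N a b = trans
      (ℚ∑.sum-cong-≗ {N} λ n → trans
        (∑-cong-≡ (perms (toℕ n)) λ u → ℚₚ.*-distribʳ-+ (c u) (a (toℕ n) u) (b (toℕ n) u))
        (ℚ∑.∑-distrib-+ {length (perms (toℕ n))} _ _))
      (ℚ∑.∑-distrib-+ {N} _ _)

    combination-• : ∀ N r a → combination N (λ n u → r ℚ.* a n u) ≡ r ℚ.* combination N a
    combination-• N r a = sym (trans
      (ℚ∑.*-distribˡ-sum {N} r _)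
      (ℚ∑.sum-cong-≗ {N} λ n → trans
        (ℚ∑.*-distribˡ-sum {length (perms (toℕ n))} r _)
        (∑-cong-≡ (perms (toℕ n)) λ u → sym (ℚₚ.*-assoc r (a (toℕ n) u) (c u)))))

    combination-zero : ∀ N a → (∀ n u → a n u ℚ.* c u ≡ 0ℚ) → combination N a ≡ 0ℚ
    combination-zero N a eq = sum-zero {N} λ n → ∑-zero (perms (toℕ n)) (eq (toℕ n))

  ⟪⟫-zero : ∀ f k x → bound f ℕ.≤ k → ⟪ f , ι V k x ⟫ ≡ 0ℚ
  ⟪⟫-zero f k x le = sum-zero {bound f} λ i → go (toℕ i) (Finₚ.toℕ<n i) (k ℕₚ.≟ toℕ i)
    where
    go : ∀ i → i ℕ.< bound f → (d : Dec (k ≡ i)) → form (comp f i) (atDegree V k x i d) ≡ 0ℚ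
    go i i<b (yes refl) = contradiction (ℕₚ.<-≤-trans i<b le) (ℕₚ.<-irrefl refl)
    go i i<b (no _)     = IsModuleHomomorphism.0ᴹ-homo (isLinear (comp f i))

-- (f · g)(x) = (f ⊗ g)(Δ x)
dualProduct : ∣ 𝔖Sym*ᴹ ∣ → ∣ 𝔖Sym*ᴹ ∣ → ∣ 𝔖Sym*ᴹ ∣
dualProduct f g = directSum
  (λ n → linearForm (λ x → pair² f g (Δ (ι V n x))) (linear n))
  (bound f ℕ.+ bound g)
  vanish
  where
  open RawBialgebra 𝔖Sym using (Δ)
  open Combination (λ u → pair² f g (F-coproduct u))

  expand : ∀ x → pair² f g (Δ x) ≡ combination (bound x) (comp x)
  expand x = trans (induced-sum _ {bound x} _)
    (ℚ∑.sum-cong-≗ {bound x} λ n → induced-sum _ {length (perms (toℕ n))} _)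

  linear : ∀ n → IsLinear (V n) ℚ¹ (λ x → pair² f g (Δ (ι V n x)))
  linear n = mkLinear (V n) ℚ¹ _
    (λ {x} {y} eq → trans (expand (ι V n x)) (trans
      (combination-cong (suc n) (λ k → ι-cong eq k (n ℕₚ.≟ k)))
      (sym (expand (ι V n y)))))
    (λ x y → trans (expand (ι V n (λ w → x w ℚ.+ y w))) (trans
      (combination-cong (suc n) (λ k → ι-+ x y k (n ℕₚ.≟ k))) (trans
      (combination-+ (suc n) (comp (ι V n x)) (comp (ι V n y)))
      (sym (cong₂ ℚ._+_ (expand (ι V n x)) (expand (ι V n y)))))))
    (λ r x → trans (expand (ι V n (λ w → r ℚ.* x w))) (trans
      (combination-cong (suc n) (λ k → ι-• r x k (n ℕₚ.≟ k))) (trans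
      (combination-• (suc n) r (comp (ι V n x)))
      (sym (cong (r ℚ.*_) (expand (ι V n x)))))))
    where
    ι-cong : ∀ {x y} → (∀ w → x w ≡ y w) → ∀ k (d : Dec (n ≡ k)) u → atDegree V n x k d u ≡ atDegree V n y k d u
    ι-cong eq k (yes refl) u = eq u
    ι-cong eq k (no _)     u = refl
    ι-+ : ∀ x y k (d : Dec (n ≡ k)) u →
      atDegree V n (λ w → x w ℚ.+ y w) k d u ≡ atDegree V n x k d u ℚ.+ atDegree V n y k d u
    ι-+ x y k (yes refl) u = refl
    ι-+ x y k (no _)     u = refl
    ι-• : ∀ r x k (d : Dec (n ≡ k)) u → atDegree V n (λ w → r ℚ.* x w) k d u ≡ r ℚ.* atDegree V n x k d u
    ι-• r x k (yes refl) u = refl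
    ι-• r x k (no _)     u = sym (ℚₚ.*-zeroʳ r)

  vanish : ∀ n → bound f ℕ.+ bound g ℕ.≤ n → ∀ x → pair² f g (Δ (ι V n x)) ≡ 0ℚ
  vanish n le x = trans (expand (ι V n x)) (combination-zero (suc n) (comp (ι V n x)) (λ k u → go k u (n ℕₚ.≟ k)))
    where
    split : ∀ p → bound f ℕ.≤ p ⊎ bound g ℕ.≤ n ∸ p
    split p with bound f ℕₚ.≤? p
    ... | yes f≤p = inj₁ f≤p
    ... | no  f≰p = inj₂ (ℕₚ.m+n≤o⇒m≤o∸n (bound g) (ℕₚ.≤-trans (ℕₚ.≤-reflexive (ℕₚ.+-comm (bound g) p))
                                (ℕₚ.≤-trans (ℕₚ.+-monoˡ-≤ (bound g) (ℕₚ.≰⇒≥ f≰p)) le)))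
    term : (u : 𝔖 n) (p : Fin (suc n)) → bound f ℕ.≤ toℕ p ⊎ bound g ℕ.≤ n ∸ toℕ p →
           ⟪ f , F (stPrefix u p) ⟫ ℚ.* ⟪ g , F (stSuffix u p) ⟫ ≡ 0ℚ
    term u p (inj₁ f≤p) = *-zeroˡ′ _ ⟪ g , F (stSuffix u p) ⟫ (⟪⟫-zero f _ _ f≤p)
    term u p (inj₂ g≤q) = *-zeroʳ′ ⟪ f , F (stPrefix u p) ⟫ _ (⟪⟫-zero g _ _ g≤q)
    coproduct-zero : (u : 𝔖 n) → pair² f g (F-coproduct u) ≡ 0ℚ
    coproduct-zero u = trans
      (induced-sum (λ x y → ⟪ f , x ⟫ ℚ.* ⟪ g , y ⟫) {length (allFin (suc n))}
        (λ i → let p = List.lookup (allFin (suc n)) i in F (stPrefix u p) ⊗ F (stSuffix u p)))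
      (sum-zero {length (allFin (suc n))} λ i → let p = List.lookup (allFin (suc n)) i in term u p (split (toℕ p)))
    go : ∀ k (u : 𝔖 k) (d : Dec (n ≡ k)) → atDegree V n x k d u ℚ.* pair² f g (F-coproduct u) ≡ 0ℚ
    go k u (yes refl) = *-zeroʳ′ (x u) _ (coproduct-zero u)
    go k u (no _)     = *-zeroˡ′ _ (pair² f g (F-coproduct u)) refl

-- Σ f(F_u F_v) F*_u ⊗ F*_v, the sum being over the finitely many degrees where
-- f does not vanish; dualCoproduct-pairing shows that it is dual to the product.
dualCoproduct : ∣ 𝔖Sym*ᴹ ∣ → Tensor 𝔖Sym*ᴹ 𝔖Sym*ᴹ
dualCoproduct f =
  ∑< T (bound f) λ p → ∑ T (perms p) λ u →
  ∑< T (bound f) λ q → ∑ T (perms q) λ v → ⟪ f , F-product u v ⟫ ⊡ F* u ⊗ F* v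
  where T = 𝔖Sym*ᴹ ⊗ᴹ 𝔖Sym*ᴹ

dualCoproduct-pairing : ∀ f x y →
  induced ℚ¹ (λ g h → ⟪ g , x ⟫ ℚ.* ⟪ h , y ⟫) (dualCoproduct f) ≡ ⟪ f , RawBialgebra._·_ 𝔖Sym x y ⟫
dualCoproduct-pairing f x y = begin
  induced ℚ¹ β (dualCoproduct f)
    ≡⟨ induced-∑∑ (bound f) (λ u → row u) ⟩
  (∑< ℚ¹ (bound f) λ p → ∑ ℚ¹ (perms p) λ u → induced ℚ¹ β (row u))
    ≡⟨ ∑<-cong (bound f) (λ p → ∑-cong-≡ (perms p) (λ u → inner u)) ⟩
  ∑< ℚ¹ (bound f) H
    ≡⟨ rebound (bound f) (bound x) H
         (λ p le → ∑-zero (perms p) λ u → *-zeroʳ′ (comp x p u) (inside u) (inside-zero u le))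
         (λ p le → ∑-zero (perms p) λ u → *-zeroˡ′ (comp x p u) (inside u) (vanishes x p le u)) ⟩
  ∑< ℚ¹ (bound x) H
    ≡⟨ sym (∑<-cong (bound x) (λ p → ∑-cong-≡ (perms p) λ u →
         cong (comp x p u ℚ.*_) (pairing-extension y (λ v → F-product u v)))) ⟩
  (∑< ℚ¹ (bound x) λ p → ∑ ℚ¹ (perms p) λ u →
    comp x p u ℚ.* ⟪ f , linearExtension 𝔖Symᴹ (λ v → F-product u v) y ⟫)
    ≡⟨ sym (pairing-extension x (λ u → linearExtension 𝔖Symᴹ (λ v → F-product u v) y)) ⟩
  ⟪ f , RawBialgebra._·_ 𝔖Sym x y ⟫ ∎
  where
  open ≡-Reasoning
  T = 𝔖Sym*ᴹ ⊗ᴹ 𝔖Sym*ᴹ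

  β : ∣ 𝔖Sym*ᴹ ∣ → ∣ 𝔖Sym*ᴹ ∣ → ℚ
  β g h = ⟪ g , x ⟫ ℚ.* ⟪ h , y ⟫

  c : 𝔖 p → 𝔖 q → ℚ
  c u v = ⟪ f , F-product u v ⟫

  row : 𝔖 p → Tensor 𝔖Sym*ᴹ 𝔖Sym*ᴹ
  row u = ∑< T (bound f) λ q → ∑ T (perms q) λ v → c u v ⊡ F* u ⊗ F* v

  inside : 𝔖 p → ℚ
  inside u = ∑< ℚ¹ (bound y) λ q → ∑ ℚ¹ (perms q) λ v → comp y q v ℚ.* c u v

  H : ℕ → ℚ
  H p = ∑ ℚ¹ (perms p) λ u → comp x p u ℚ.* inside u

  induced-∑∑ : ∀ N (t : ∀ {p} → 𝔖 p → Tensor 𝔖Sym*ᴹ 𝔖Sym*ᴹ) →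
    induced ℚ¹ β (∑< T N λ p → ∑ T (perms p) λ u → t u) ≡ (∑< ℚ¹ N λ p → ∑ ℚ¹ (perms p) λ u → induced ℚ¹ β (t u))
  induced-∑∑ N t = trans (induced-sum β {N} (λ p → ∑ T (perms (toℕ p)) λ u → t u))
    (ℚ∑.sum-cong-≗ {N} λ p → induced-sum β {length (perms (toℕ p))} (λ i → t (List.lookup (perms (toℕ p)) i)))

  rebound : ∀ N N′ h → (∀ k → N ℕ.≤ k → h k ≡ 0ℚ) → (∀ k → N′ ℕ.≤ k → h k ≡ 0ℚ) → ∑< ℚ¹ N h ≡ ∑< ℚ¹ N′ h
  rebound zero    N′       h z z′ = sym (sum-zero {N′} λ i → z (toℕ i) z≤n)
  rebound (suc N) zero     h z z′ = sum-zero {suc N} λ i → z′ (toℕ i) z≤n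
  rebound (suc N) (suc N′) h z z′ = cong (h 0 ℚ.+_)
    (rebound N N′ (h ∘ suc) (λ k le → z (suc k) (s≤s le)) (λ k le → z′ (suc k) (s≤s le)))

  pairing-0 : ⟪ f , Module.0ᴹ 𝔖Symᴹ ⟫ ≡ 0ℚ
  pairing-0 = sum-zero {bound f} λ n → IsModuleHomomorphism.0ᴹ-homo (isLinear (comp f (toℕ n)))

  pairing-sum : ∀ {N} (t : Fin N → ∣ 𝔖Symᴹ ∣) →
    ⟪ f , RawMonoidSum.sum (Module.+ᴹ-rawMonoid 𝔖Symᴹ) t ⟫ ≡ ℚ∑.sum (λ i → ⟪ f , t i ⟫)
  pairing-sum {zero}  t = pairing-0
  pairing-sum {suc N} t = trans
    (trans (ℚ∑.sum-cong-≗ {bound f} λ n → IsModuleHomomorphism.+ᴹ-homo (isLinear (comp f (toℕ n))) _ _)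
           (ℚ∑.∑-distrib-+ {bound f} _ _))
    (cong (⟪ f , t zero ⟫ ℚ.+_) (pairing-sum (t ∘ suc)))

  pairing-• : ∀ r z → ⟪ f , r • z ⟫ ≡ r ℚ.* ⟪ f , z ⟫
  pairing-• r z = trans (ℚ∑.sum-cong-≗ {bound f} λ n → IsModuleHomomorphism.*ₗ-homo (isLinear (comp f (toℕ n))) r _)
    (sym (ℚ∑.*-distribˡ-sum {bound f} r _))

  pairing-extension : ∀ z (φ : ∀ {n} → 𝔖 n → ∣ 𝔖Symᴹ ∣) →
    ⟪ f , linearExtension 𝔖Symᴹ φ z ⟫ ≡ (∑< ℚ¹ (bound z) λ n → ∑ ℚ¹ (perms n) λ u → comp z n u ℚ.* ⟪ f , φ u ⟫)
  pairing-extension z φ = trans (pairing-sum {bound z} _) (ℚ∑.sum-cong-≗ {bound z} λ n → trans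
    (pairing-sum {length (perms (toℕ n))} _) (∑-cong-≡ (perms (toℕ n)) λ u → pairing-• (comp z (toℕ n) u) (φ u)))

  c-zero : ∀ {p q} (u : 𝔖 p) (v : 𝔖 q) → bound f ℕ.≤ p ℕ.+ q → c u v ≡ 0ℚ
  c-zero {p} {q} u v le = trans (pairing-sum {length ζs} (λ i → F ((u ×ₚ v) ∘ₚ (List.lookup ζs i) ⁻¹)))
    (sum-zero {length ζs} λ i → ⟪⟫-zero f (p ℕ.+ q) _ le)
    where ζs = filter (isShuffle? p q) (perms (p ℕ.+ q))

  inside-zero : ∀ {p} (u : 𝔖 p) → bound f ℕ.≤ p → inside u ≡ 0ℚ
  inside-zero {p} u le = sum-zero {bound y} λ q → ∑-zero (perms (toℕ q)) λ v →
    *-zeroʳ′ (comp y (toℕ q) v) (c u v) (c-zero u v (ℕₚ.≤-trans le (ℕₚ.m≤m+n p (toℕ q))))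

  inner : ∀ {p} (u : 𝔖 p) → induced ℚ¹ β (row u) ≡ comp x p u ℚ.* inside u
  inner {p} u = begin
    induced ℚ¹ β (row u)
      ≡⟨ induced-∑∑ (bound f) (λ v → c u v ⊡ F* u ⊗ F* v) ⟩
    (∑< ℚ¹ (bound f) λ q → ∑ ℚ¹ (perms q) λ v → c u v ℚ.* (⟪ F* u , x ⟫ ℚ.* ⟪ F* v , y ⟫))
      ≡⟨ ∑<-cong (bound f) (λ q → ∑-cong-≡ (perms q) λ v → term v) ⟩
    ∑< ℚ¹ (bound f) K
      ≡⟨ rebound (bound f) (bound y) K
           (λ q le → ∑-zero (perms q) λ v → *-zeroʳ′ (comp x p u) (comp y q v ℚ.* c u v)
             (*-zeroʳ′ (comp y q v) (c u v) (c-zero u v (ℕₚ.≤-trans le (ℕₚ.m≤n+m q p)))))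
           (λ q le → ∑-zero (perms q) λ v → *-zeroʳ′ (comp x p u) (comp y q v ℚ.* c u v)
             (*-zeroˡ′ (comp y q v) (c u v) (vanishes y q le v))) ⟩
    ∑< ℚ¹ (bound y) K
      ≡⟨ sym (*-distribˡ-∑∑ (bound y) (comp x p u) (λ q v → comp y q v ℚ.* c u v)) ⟩
    comp x p u ℚ.* inside u ∎
    where
    open CommutativeSemigroupProperties ℚring.*-commutativeSemigroup using (x∙yz≈y∙zx)
    K : ℕ → ℚ
    K q = ∑ ℚ¹ (perms q) λ v → comp x p u ℚ.* (comp y q v ℚ.* c u v)
    term : ∀ {q} (v : 𝔖 q) → c u v ℚ.* (⟪ F* u , x ⟫ ℚ.* ⟪ F* v , y ⟫) ≡ comp x p u ℚ.* (comp y q v ℚ.* c u v)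
    term {q} v = trans (cong₂ (λ a b → c u v ℚ.* (a ℚ.* b)) (F*-coordinate x u) (F*-coordinate y v))
                       (x∙yz≈y∙zx (c u v) (comp x p u) (comp y q v))

𝔖Sym* : RawBialgebra
𝔖Sym* = record
  { space = 𝔖Sym*ᴹ
  ; _·_   = dualProduct
  ; 𝟙     = F* ∅
  ; Δ     = dualCoproduct
  ; ε     = λ f → ⟪ f , F ∅ ⟫
  }

-- The linear map with F*_u ↦ F_{u⁻¹}, using f = Σ f(F_u) F*_u.
Θ : ∣ 𝔖Sym*ᴹ ∣ → ∣ 𝔖Symᴹ ∣
Θ f = ∑< 𝔖Symᴹ (bound f) λ n → ∑ 𝔖Symᴹ (perms n) λ u → ⟪ f , F u ⟫ • F (u ⁻¹)

θ : 𝔖 n → 𝔖 n → ℕ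
θ {n} u v = length (filter (λ x → (x ≤? u) ×-dec (x ⁻¹ ≤? v)) (perms n))

{-# OPTIONS --safe #-}
module Submission where

-- Everything reduces to one bijection: w ∈ 𝔖ₚ₊q has standardized parts u, v exactly when
-- w (u⁻¹ × v⁻¹) is a shuffle. Hence Θ (F*ᵤ · F*ᵥ) = F_{u⁻¹} · F_{v⁻¹}, so Θ is an algebra
-- isomorphism. Its matrix in the bases F*, F is the involution u ↦ u⁻¹, so Θ is self-adjoint,
-- and compatibility with the coproducts is the transpose of compatibility with the products.
-- Since 𝔖Sym is graded and connected, the left antipode equation determines an antipode by
-- induction on the degree, hence Θ intertwines antipodes. Finally Möbius inversion gives
-- Fᵥ = Σ_{w ≥ v} M_w and, dually, M*ᵤ = Σ_{x ≤ u} F*ₓ, so that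
-- Θ (M*ᵤ) = Σ_{x ≤ u} F_{x⁻¹} = Σ_{x ≤ u} Σ_{v ≥ x⁻¹} Mᵥ.

open import Algebra.Module.Bundles using (Module)
open import Algebra.Module.Morphism.Structures using (IsModuleHomomorphism; IsModuleIsomorphism)
import Algebra.Properties.CommutativeMonoid.Sum as MonoidSum
open import Algebra.Properties.Group using (∙-cancelʳ)
open import Data.Bool.Base using (if_then_else_)
open import Data.Fin.Base as Fin using (Fin; zero; suc; toℕ; finToFun; funToFin; _↑ˡ_; _↑ʳ_; inject≤; inject₁; cast; fromℕ<; splitAt; join)
import Data.Fin.Properties as Finₚ
open import Data.Integer.Base as ℤ using (+_)
import Data.Integer.Properties as ℤₚ
open import Data.List.Base as List using (List; []; _∷_; length; filter; allFin; mapMaybe)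
open import Data.List.Membership.Propositional using (_∈_)
import Data.List.Membership.Propositional.Properties as Memₚ
open import Data.List.Relation.Unary.All as All using (All; []; _∷_)
open import Data.List.Relation.Unary.AllPairs using ([]; _∷_)
open import Data.List.Relation.Unary.Any using (here; there)
open import Data.List.Relation.Unary.Unique.Propositional using (Unique)
import Data.List.Relation.Unary.Unique.Propositional.Properties as Uniqueₚ
open import Data.Maybe.Base using (Maybe; just; nothing)
open import Data.Nat.Base as ℕ using (ℕ; zero; suc; z≤n; s≤s)
import Data.Nat.Coprimality as Coprime
open import Data.Nat.Induction using (<-rec)
import Data.Nat.Properties as ℕₚ
open import Data.Product.Base using (_×_; _,_; proj₁; proj₂)
open import Data.Rational.Base as ℚ using (ℚ; 0ℚ; 1ℚ; _/_)
import Data.Rational.Properties as ℚₚ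
import Data.Sum.Base as Sum
import Data.Vec.Base as Vec
import Data.Vec.Properties as Vecₚ
open import Function.Base using (_∘_; id)
open import Function.Definitions using (Injective)
import Induction.WellFounded as WF
open import Level using (0ℓ)
open import Relation.Binary.Definitions using (tri<; tri≈; tri>)
open import Relation.Binary.PropositionalEquality using (_≡_; _≢_; refl; sym; trans; cong; cong₂; subst; subst₂; module ≡-Reasoning)
import Relation.Binary.Reasoning.Setoid as SetoidReasoning
open import Relation.Nullary using (¬_; Dec; yes; no; does; contradiction)
open import Relation.Nullary.Decidable using (_×-dec_)
open import Relation.Unary using (Pred; Decidable)
open import Defs

-- Equality in the three spaces is the obstacle. An element of a direct sum carries a bound that
-- equality ignores, so sums over degrees are compared at a common cutoff. An element of the dual is
-- a family of arbitrary functionals, whose basis has to be earned from the values on the `F u`. A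
-- tensor is a formal expression modulo relations, with no basis given; the functionals
-- `pair² (F* u) (F* v)` separate tensors because each expression involves finitely many degrees.
-- This is why the coproduct is handled by transposition: both sides become numbers, and the product
-- formula decides them. The structure maps come without axioms, so the usual uniqueness argument S
-- = S * id * T, which rests on associativity of convolution, has no footing. Induction on the
-- degree asks for the right unit law, and `Θ` carries that law over from the dual, where it
-- concerns a single cut of a word. The recursion for `μ` unfolds in its second argument and yields
-- `μ` times `ζ`; expressing `F` through `M` takes the product in the other order.

private
  variable
    k m n p q : ℕ
    A B : Set

-- The Iverson bracket, written exactly as the coefficients of `F` and the right side of `IsDualTo`,
-- so that those are instances of it by definition.
[_] : {X : Set} → Dec X → ℚ
[ d ] = if does d then 1ℚ else 0ℚ

module _ {X Y : Set} where

  []-cong : (X → Y) → (Y → X) → (d : Dec X) (e : Dec Y) → [ d ] ≡ [ e ]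
  []-cong _ _ (yes _) (yes _) = refl
  []-cong f _ (yes x) (no ¬y) = contradiction (f x) ¬y
  []-cong _ g (no ¬x) (yes y) = contradiction (g y) ¬x
  []-cong _ _ (no _)  (no _)  = refl

  []-× : (d : Dec X) (e : Dec Y) → [ d ×-dec e ] ≡ [ d ] ℚ.* [ e ]
  []-× (yes _) (yes _) = refl
  []-× (yes _) (no _)  = refl
  []-× (no _)  (yes _) = refl
  []-× (no _)  (no _)  = refl

if-true : ∀ {X : Set} {a b : ℚ} → X → (d : Dec X) → (if does d then a else b) ≡ a
if-true _ (yes _) = refl
if-true x (no ¬x) = contradiction x ¬x

if-false : ∀ {X : Set} {a b : ℚ} → ¬ X → (d : Dec X) → (if does d then a else b) ≡ b
if-false ¬x (yes x) = contradiction x ¬x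
if-false _  (no _)  = refl

[]-true : {X : Set} → X → (d : Dec X) → [ d ] ≡ 1ℚ
[]-true = if-true

[]-false : {X : Set} → ¬ X → (d : Dec X) → [ d ] ≡ 0ℚ
[]-false = if-false

-- Finite sums in a module

module Sums (P : ℚ-Module) where
  open Module P
  private module S = MonoidSum +ᴹ-commutativeMonoid

  ∑-cong : ∀ (xs : List A) {f g} → (∀ x → f x ≈ᴹ g x) → ∑ P xs f ≈ᴹ ∑ P xs g
  ∑-cong xs eq = S.sum-cong-≋ λ i → eq (List.lookup xs i)

  ∑-zero : ∀ (xs : List A) {f} → (∀ x → f x ≈ᴹ 0ᴹ) → ∑ P xs f ≈ᴹ 0ᴹ
  ∑-zero []       eq = ≈ᴹ-refl
  ∑-zero (x ∷ xs) eq = ≈ᴹ-trans (+ᴹ-cong (eq x) (∑-zero xs eq)) (+ᴹ-identityˡ 0ᴹ)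

  ∑-+ : ∀ (xs : List A) f g → ∑ P xs (λ x → f x +ᴹ g x) ≈ᴹ ∑ P xs f +ᴹ ∑ P xs g
  ∑-+ xs f g = S.∑-distrib-+ (f ∘ List.lookup xs) (g ∘ List.lookup xs)

  ∑-• : ∀ r (xs : List A) f → ∑ P xs (λ x → r *ₗ f x) ≈ᴹ r *ₗ ∑ P xs f
  ∑-• r []       f = ≈ᴹ-sym (*ₗ-zeroʳ r)
  ∑-• r (x ∷ xs) f = ≈ᴹ-trans (+ᴹ-congˡ (∑-• r xs f)) (≈ᴹ-sym (*ₗ-distribˡ r _ _))

  ∑-swap : ∀ (xs : List A) (ys : List B) (f : A → B → Carrierᴹ) →
    ∑ P xs (λ x → ∑ P ys (f x)) ≈ᴹ ∑ P ys (λ y → ∑ P xs (λ x → f x y))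
  ∑-swap xs ys f = S.∑-comm {length xs} {length ys} λ i j → f (List.lookup xs i) (List.lookup ys j)

  ∑-factor : ∀ (xs : List A) (c : A → ℚ) x → ∑ P xs (λ a → c a *ₗ x) ≈ᴹ ∑ ℚ¹ xs c *ₗ x
  ∑-factor []       c x = ≈ᴹ-sym (*ₗ-zeroˡ x)
  ∑-factor (a ∷ xs) c x = ≈ᴹ-trans (+ᴹ-congˡ (∑-factor xs c x)) (≈ᴹ-sym (*ₗ-distribʳ x _ _))

  ∑-only : ∀ {xs : List A} {x} f → Unique xs → x ∈ xs → (∀ y → y ≢ x → f y ≈ᴹ 0ᴹ) → ∑ P xs f ≈ᴹ f x
  ∑-only {xs = x ∷ xs} f (x∉ ∷ _) (here refl) z = ≈ᴹ-trans (+ᴹ-congˡ (rest xs x∉)) (+ᴹ-identityʳ _)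
    where
    rest : ∀ ys → All (x ≢_) ys → ∑ P ys f ≈ᴹ 0ᴹ
    rest []       []         = ≈ᴹ-refl
    rest (y ∷ ys) (x≢y ∷ x∉) = ≈ᴹ-trans (+ᴹ-cong (z y (x≢y ∘ sym)) (rest ys x∉)) (+ᴹ-identityˡ 0ᴹ)
  ∑-only {xs = y ∷ xs} f (y∉ ∷ uniq) (there x∈) z =
    ≈ᴹ-trans (+ᴹ-cong (z y (All.lookup y∉ x∈)) (∑-only f uniq x∈ z)) (+ᴹ-identityˡ _)

  ∑-filter : ∀ {Q : Pred A 0ℓ} (Q? : Decidable Q) xs f →
    ∑ P (filter Q? xs) f ≈ᴹ ∑ P xs (λ x → [ Q? x ] *ₗ f x)
  ∑-filter Q? []       f = ≈ᴹ-refl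
  ∑-filter Q? (x ∷ xs) f with Q? x
  ... | yes _ = +ᴹ-cong (≈ᴹ-sym (*ₗ-identityˡ _)) (∑-filter Q? xs f)
  ... | no _  = ≈ᴹ-trans (≈ᴹ-sym (+ᴹ-identityˡ _)) (+ᴹ-cong (≈ᴹ-sym (*ₗ-zeroˡ _)) (∑-filter Q? xs f))

  ∑<-cong : ∀ N {f g} → (∀ k → f k ≈ᴹ g k) → ∑< P N f ≈ᴹ ∑< P N g
  ∑<-cong N eq = S.sum-cong-≋ {N} λ i → eq (toℕ i)

  ∑<-zero : ∀ N {f} → (∀ k → f k ≈ᴹ 0ᴹ) → ∑< P N f ≈ᴹ 0ᴹ
  ∑<-zero zero    eq = ≈ᴹ-refl
  ∑<-zero (suc N) eq = ≈ᴹ-trans (+ᴹ-cong (eq 0) (∑<-zero N (eq ∘ suc))) (+ᴹ-identityˡ 0ᴹ)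

  ∑<-+ : ∀ N f g → ∑< P N (λ k → f k +ᴹ g k) ≈ᴹ ∑< P N f +ᴹ ∑< P N g
  ∑<-+ N f g = S.∑-distrib-+ {N} (f ∘ toℕ) (g ∘ toℕ)

  ∑<-• : ∀ r N f → ∑< P N (λ k → r *ₗ f k) ≈ᴹ r *ₗ ∑< P N f
  ∑<-• r zero    f = ≈ᴹ-sym (*ₗ-zeroʳ r)
  ∑<-• r (suc N) f = ≈ᴹ-trans (+ᴹ-congˡ (∑<-• r N (f ∘ suc))) (≈ᴹ-sym (*ₗ-distribˡ r _ _))

  -- Equal elements of a direct sum may carry different bounds; this brings their sums over degrees
  -- to a common range.
  ∑<-extend : ∀ {N N′} f → N ℕ.≤ N′ → (∀ k → N ℕ.≤ k → f k ≈ᴹ 0ᴹ) → ∑< P N f ≈ᴹ ∑< P N′ f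
  ∑<-extend {N′ = N′} f z≤n     z = ≈ᴹ-sym (∑<-zero N′ λ k → z k z≤n)
  ∑<-extend           f (s≤s l) z = +ᴹ-congˡ (∑<-extend (f ∘ suc) l λ k l′ → z (suc k) (s≤s l′))

  ∑<-only : ∀ {N k} f → k ℕ.< N → (∀ i → i ≢ k → f i ≈ᴹ 0ᴹ) → ∑< P N f ≈ᴹ f k
  ∑<-only {suc N} {zero}  f _       z = ≈ᴹ-trans (+ᴹ-congˡ (∑<-zero N λ i → z (suc i) λ ())) (+ᴹ-identityʳ _)
  ∑<-only {suc N} {suc k} f (s≤s l) z = ≈ᴹ-trans
    (+ᴹ-cong (z 0 λ ()) (∑<-only (f ∘ suc) l λ i i≢k → z (suc i) (i≢k ∘ ℕₚ.suc-injective))) (+ᴹ-identityˡ _)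

  *ₗ-zero : ∀ {r} x → r ≡ 0ℚ → r *ₗ x ≈ᴹ 0ᴹ
  *ₗ-zero x refl = *ₗ-zeroˡ x

  *ₗ-one : ∀ {r} x → r ≡ 1ℚ → r *ₗ x ≈ᴹ x
  *ₗ-one x refl = *ₗ-identityˡ x

  *ₗ-coeff : ∀ {r s} x → r ≡ s → r *ₗ x ≈ᴹ s *ₗ x
  *ₗ-coeff x refl = ≈ᴹ-refl

  -1*ₗ-inverse : ∀ x → (ℚ.- 1ℚ) *ₗ x +ᴹ x ≈ᴹ 0ᴹ
  -1*ₗ-inverse x = ≈ᴹ-trans (+ᴹ-congˡ (≈ᴹ-sym (*ₗ-identityˡ x)))
    (≈ᴹ-trans (≈ᴹ-sym (*ₗ-distribʳ x (ℚ.- 1ℚ) 1ℚ)) (*ₗ-zeroˡ x))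

module Linear (P Q : ℚ-Module) {L : ∣ P ∣ → ∣ Q ∣} (isLinear : IsLinear P Q L) where
  private module Q = Module Q
  open IsModuleHomomorphism isLinear public using (⟦⟧-cong; +ᴹ-homo; *ₗ-homo; 0ᴹ-homo)

  ∑-homo : ∀ (xs : List A) f → L (∑ P xs f) ≈[ Q ] ∑ Q xs (L ∘ f)
  ∑-homo []       f = 0ᴹ-homo
  ∑-homo (x ∷ xs) f = Q.≈ᴹ-trans (+ᴹ-homo _ _) (Q.+ᴹ-congˡ (∑-homo xs f))

  ∑<-homo : ∀ N f → L (∑< P N f) ≈[ Q ] ∑< Q N (L ∘ f)
  ∑<-homo zero    f = 0ᴹ-homo
  ∑<-homo (suc N) f = Q.≈ᴹ-trans (+ᴹ-homo _ _) (Q.+ᴹ-congˡ (∑<-homo N (f ∘ suc)))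

∘-linear : ∀ (P Q R : ℚ-Module) {K L} → IsLinear Q R K → IsLinear P Q L → IsLinear P R (K ∘ L)
∘-linear P Q R {K} {L} K-linear L-linear = mkLinear P R (K ∘ L)
  (λ eq → K.⟦⟧-cong (L.⟦⟧-cong eq))
  (λ x y → R.≈ᴹ-trans (K.⟦⟧-cong (L.+ᴹ-homo x y)) (K.+ᴹ-homo _ _))
  (λ r x → R.≈ᴹ-trans (K.⟦⟧-cong (L.*ₗ-homo r x)) (K.*ₗ-homo r _))
  where
  module R = Module R
  module K = IsModuleHomomorphism K-linear
  module L = IsModuleHomomorphism L-linear

-- A repeated permutation would be counted twice in every sum over `perms n`. None occurs, because a
-- word determines its letter function and hence its code in `Fin (n ℕ.^ n)`.
perms-unique : ∀ n → Unique (perms n)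
perms-unique n = mapMaybe⁺ decode decode-injective (Uniqueₚ.allFin⁺ (n ℕ.^ n))
  where
  decode : Fin (n ℕ.^ n) → Maybe (𝔖 n)
  decode c = perm? (Vec.tabulate (finToFun {n} {n} c))

  perm?-word : ∀ {w} {u : 𝔖 n} → perm? w ≡ just u → word u ≡ w
  perm?-word {w} eq with unique? w | eq
  ... | yes _ | refl = refl

  decode-injective : ∀ {c d u} → decode c ≡ just u → decode d ≡ just u → c ≡ d
  decode-injective {c} {d} eq eq′ = trans (sym (Finₚ.funToFin-finToFin {n} {n} c))
    (trans (funToFin-cong {n} letters) (Finₚ.funToFin-finToFin {n} {n} d))
    where
    letters : ∀ i → finToFun {n} {n} c i ≡ finToFun {n} {n} d i
    letters i = trans (sym (Vecₚ.lookup∘tabulate (finToFun {n} {n} c) i)) (trans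
      (cong (λ w → Vec.lookup w i) (trans (sym (perm?-word eq)) (perm?-word eq′)))
      (Vecₚ.lookup∘tabulate (finToFun {n} {n} d) i))
    funToFin-cong : ∀ {m n} {f g : Fin m → Fin n} → (∀ i → f i ≡ g i) → funToFin f ≡ funToFin g
    funToFin-cong {zero}  eq = refl
    funToFin-cong {suc m} eq = cong₂ Fin.combine (eq zero) (funToFin-cong (eq ∘ suc))

  mapMaybe⁺ : ∀ (g : A → Maybe B) → (∀ {x y b} → g x ≡ just b → g y ≡ just b → x ≡ y) →
              ∀ {xs} → Unique xs → Unique (mapMaybe g xs)
  mapMaybe⁺ {A} {B} g inj []                    = []
  mapMaybe⁺ {A} {B} g inj {x ∷ xs} (x∉ ∷ uniq) with g x in eq
  ... | nothing = mapMaybe⁺ g inj uniq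
  ... | just b  = fresh x∉ ∷ mapMaybe⁺ g inj uniq
    where
    fresh : ∀ {ys} → All (x ≢_) ys → All (b ≢_) (mapMaybe g ys)
    fresh []                   = []
    fresh {y ∷ ys} (x≢y ∷ x∉) with g y in eq′
    ... | nothing = fresh x∉
    ... | just c  = (λ { refl → x≢y (inj eq eq′) }) ∷ fresh x∉

module _ (P : ℚ-Module) where
  open Module P
  open Sums P

  ∑-perms-only : ∀ (u : 𝔖 n) (f : 𝔖 n → Carrierᴹ) → (∀ v → v ≢ u → f v ≈ᴹ 0ᴹ) → ∑ P (perms n) f ≈ᴹ f u
  ∑-perms-only {n} u f = ∑-only f (perms-unique n) (∈-perms u)

  ∑-perms-δ : ∀ (u : 𝔖 n) (c : 𝔖 n → ℚ) (f : 𝔖 n → Carrierᴹ) → c u ≡ 1ℚ → (∀ v → v ≢ u → c v ≡ 0ℚ) →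
    ∑ P (perms n) (λ v → c v *ₗ f v) ≈ᴹ f u
  ∑-perms-δ u c f c≡1 c≡0 = ≈ᴹ-trans
    (∑-perms-only u (λ v → c v *ₗ f v) λ v v≢u → *ₗ-zero (f v) (c≡0 v v≢u))
    (*ₗ-one (f u) c≡1)

-- Linear maps out of 𝔖Sym and its dual

module ℚ∑ = Sums ℚ¹
module 𝕊 = Module 𝔖Symᴹ
module 𝕊* = Module 𝔖Sym*ᴹ

coordinate-linear : (w : 𝔖 n) → IsLinear 𝔖Symᴹ ℚ¹ (λ x → comp x n w)
coordinate-linear {n} w = mkLinear 𝔖Symᴹ ℚ¹ _ (λ eq → eq n w) (λ _ _ → refl) (λ _ _ → refl)

module _ (P : ℚ-Module) where
  open Module P
  open Sums P

  module _ (φ : ∀ {n} → 𝔖 n → ∣ P ∣) where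

    private
      row : ∣ 𝔖Symᴹ ∣ → ℕ → ∣ P ∣
      row x n = ∑ P (perms n) λ u → comp x n u *ₗ φ u

      row-cong : ∀ {x y} → x ≈[ 𝔖Symᴹ ] y → ∀ n → row x n ≈ᴹ row y n
      row-cong eq n = ∑-cong (perms n) λ u → *ₗ-coeff (φ u) (eq n u)

    -- The definition stops at `bound x`, which is not an invariant of `x`. Any later cutoff gives
    -- the same value, and this is what makes the extension respect equality and addition.
    linearExtension-truncate : ∀ {N} x → bound x ℕ.≤ N → linearExtension P φ x ≈ᴹ ∑< P N (row x)
    linearExtension-truncate x le = ∑<-extend (row x) le λ n le′ → ∑-zero (perms n) λ u →
      *ₗ-zero (φ u) (vanishes x n le′ u)

    linearExtension-linear : IsLinear 𝔖Symᴹ P (linearExtension P φ)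
    linearExtension-linear = mkLinear 𝔖Symᴹ P _
      (λ {x} {y} eq → ≈ᴹ-trans (linearExtension-truncate x (ℕₚ.m≤m⊔n (bound x) (bound y)))
        (≈ᴹ-trans (∑<-cong (bound x ℕ.⊔ bound y) (row-cong {x} {y} eq))
          (≈ᴹ-sym (linearExtension-truncate y (ℕₚ.m≤n⊔m (bound x) (bound y))))))
      (λ x y → ≈ᴹ-trans
        (∑<-cong (bound x ℕ.⊔ bound y) λ n →
          ≈ᴹ-trans (∑-cong (perms n) λ u → *ₗ-distribʳ (φ u) (comp x n u) (comp y n u))
            (∑-+ (perms n) (λ u → comp x n u *ₗ φ u) (λ u → comp y n u *ₗ φ u)))
        (≈ᴹ-trans (∑<-+ (bound x ℕ.⊔ bound y) (row x) (row y))
          (≈ᴹ-sym (+ᴹ-cong (linearExtension-truncate x (ℕₚ.m≤m⊔n (bound x) (bound y)))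
                           (linearExtension-truncate y (ℕₚ.m≤n⊔m (bound x) (bound y)))))))
      (λ r x → ≈ᴹ-trans
        (∑<-cong (bound x) λ n →
          ≈ᴹ-trans (∑-cong (perms n) λ u → *ₗ-assoc r (comp x n u) (φ u)) (∑-• r (perms n) λ u → comp x n u *ₗ φ u))
        (∑<-• r (bound x) (row x)))

  linearExtension-cong : ∀ (φ ψ : ∀ {n} → 𝔖 n → ∣ P ∣) → (∀ {n} (u : 𝔖 n) → φ u ≈ᴹ ψ u) →
    ∀ x → linearExtension P φ x ≈ᴹ linearExtension P ψ x
  linearExtension-cong φ ψ eq x = ∑<-cong (bound x) λ n → ∑-cong (perms n) λ u → *ₗ-congˡ {comp x n u} (eq u)

-- Reading the coordinate as a pairing with `F* w` reduces this to `F*-dual` and avoids a second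
-- analysis of the degree test inside `ι`.
comp-F : ∀ (u : 𝔖 n) m (w : 𝔖 m) → comp (F u) m w ≡ [ (m , w) ≟Σ (n , u) ]
comp-F u m w = trans (sym (F*-coordinate (F u) w)) (F*-dual w u)

comp-F-same : (u w : 𝔖 n) → comp (F u) n w ≡ [ u ≟ w ]
comp-F-same {n} u w = trans (comp-F u n w)
  ([]-cong (λ { refl → refl }) (λ { refl → refl }) ((n , w) ≟Σ (n , u)) (u ≟ w))

comp-F-other : ∀ (u : 𝔖 n) {m} (w : 𝔖 m) → m ≢ n → comp (F u) m w ≡ 0ℚ
comp-F-other {n} u {m} w m≢n = trans (comp-F u m w) ([]-false (m≢n ∘ cong proj₁) ((m , w) ≟Σ (n , u)))

linearExtension-F : ∀ P (φ : ∀ {n} → 𝔖 n → ∣ P ∣) (u : 𝔖 n) → linearExtension P φ (F u) ≈[ P ] φ u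
linearExtension-F {n} P φ u = ≈ᴹ-trans
  (∑<-only {suc n} {n} (λ k → ∑ P (perms k) λ v → comp (F u) k v *ₗ φ v) ℕₚ.≤-refl λ k k≢n →
    ∑-zero (perms k) λ v → *ₗ-zero (φ v) (comp-F-other u v k≢n))
  (∑-perms-δ P u (comp (F u) n) φ
    (trans (comp-F-same u u) ([]-true refl (u ≟ u)))
    (λ v v≢u → trans (comp-F-same u v) ([]-false (v≢u ∘ sym) (u ≟ v))))
  where
  open Module P
  open Sums P

F-expansion : ∀ x → linearExtension 𝔖Symᴹ F x ≈[ 𝔖Symᴹ ] x
F-expansion x m w = begin
  comp (linearExtension 𝔖Symᴹ F x) m w
    ≡⟨ linearExtension-truncate 𝔖Symᴹ F {N} x (ℕₚ.m≤m⊔n (bound x) (suc m)) m w ⟩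
  comp (∑< 𝔖Symᴹ N (λ n → ∑ 𝔖Symᴹ (perms n) (term n))) m w
    ≡⟨ Coordinate.∑<-homo N (λ n → ∑ 𝔖Symᴹ (perms n) (term n)) ⟩
  (∑< ℚ¹ N λ n → comp (∑ 𝔖Symᴹ (perms n) (term n)) m w)
    ≡⟨ ℚ∑.∑<-cong N (λ n → Coordinate.∑-homo (perms n) (term n)) ⟩
  (∑< ℚ¹ N λ n → ∑ ℚ¹ (perms n) λ u → comp x n u ℚ.* comp (F u) m w)
    ≡⟨ ℚ∑.∑<-only {N} {m} (λ n → ∑ ℚ¹ (perms n) λ u → comp x n u ℚ.* comp (F u) m w)
         (ℕₚ.m≤n⊔m (bound x) (suc m)) (λ n n≢m → ℚ∑.∑-zero (perms n) λ u →
         trans (cong (comp x n u ℚ.*_) (comp-F-other u w (n≢m ∘ sym))) (ℚₚ.*-zeroʳ (comp x n u))) ⟩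
  (∑ ℚ¹ (perms m) λ u → comp x m u ℚ.* comp (F u) m w)
    ≡⟨ ∑-perms-only ℚ¹ w (λ u → comp x m u ℚ.* comp (F u) m w) (λ u u≢w →
         trans (cong (comp x m u ℚ.*_) (trans (comp-F-same u w) ([]-false u≢w (u ≟ w)))) (ℚₚ.*-zeroʳ (comp x m u))) ⟩
  comp x m w ℚ.* comp (F w) m w
    ≡⟨ cong (comp x m w ℚ.*_) (trans (comp-F-same w w) ([]-true refl (w ≟ w))) ⟩
  comp x m w ℚ.* 1ℚ
    ≡⟨ ℚₚ.*-identityʳ (comp x m w) ⟩
  comp x m w ∎
  where
  open ≡-Reasoning
  module Coordinate = Linear 𝔖Symᴹ ℚ¹ (coordinate-linear w)
  -- Degree `m` has to lie below the cutoff even if `x` is already bounded by `m`, for otherwise the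
  -- sum would have no term to single out.
  N = bound x ℕ.⊔ suc m
  term : ∀ n → 𝔖 n → ∣ 𝔖Symᴹ ∣
  term n u = comp x n u • F u

module _ (P : ℚ-Module) where
  open Module P

  expand-linear : ∀ {L} → IsLinear 𝔖Symᴹ P L → ∀ x → L x ≈ᴹ linearExtension P (λ u → L (F u)) x
  expand-linear {L} L-linear x = ≈ᴹ-trans (⟦⟧-cong (𝕊.≈ᴹ-sym {linearExtension 𝔖Symᴹ F x} {x} (F-expansion x))) (≈ᴹ-trans
    (∑<-homo (bound x) λ n → ∑ 𝔖Symᴹ (perms n) λ u → comp x n u • F u) (∑<-cong (bound x) λ n → ≈ᴹ-trans
      (∑-homo (perms n) λ u → comp x n u • F u) (∑-cong (perms n) λ u → *ₗ-homo (comp x n u) (F u))))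
    where
    open Linear 𝔖Symᴹ P L-linear
    open Sums P

  linear-unique : ∀ {K L} → IsLinear 𝔖Symᴹ P K → IsLinear 𝔖Symᴹ P L →
    (∀ {n} (u : 𝔖 n) → K (F u) ≈ᴹ L (F u)) → ∀ x → K x ≈ᴹ L x
  linear-unique {K} {L} K-linear L-linear eq x = ≈ᴹ-trans (expand-linear K-linear x) (≈ᴹ-trans
    (linearExtension-cong P (λ u → K (F u)) (λ u → L (F u)) eq x) (≈ᴹ-sym (expand-linear L-linear x)))

-- The pairing and the basis F* of the graded dual

⟪⟫-truncate : ∀ {N} f x → bound f ℕ.≤ N → ⟪ f , x ⟫ ≡ (∑< ℚ¹ N λ n → form (comp f n) (comp x n))
⟪⟫-truncate f x le = ℚ∑.∑<-extend (λ n → form (comp f n) (comp x n)) le λ n le′ → vanishes f n le′ (comp x n)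

⟪⟫-linearʳ : ∀ f → IsLinear 𝔖Symᴹ ℚ¹ ⟪ f ,_⟫
⟪⟫-linearʳ f = mkLinear 𝔖Symᴹ ℚ¹ _
  (λ eq → ℚ∑.∑<-cong (bound f) λ n → Form.⟦⟧-cong n (eq n))
  (λ x y → trans (ℚ∑.∑<-cong (bound f) λ n → Form.+ᴹ-homo n (comp x n) (comp y n)) 
    (ℚ∑.∑<-+ (bound f) (λ n → form (comp f n) (comp x n)) (λ n → form (comp f n) (comp y n))))
  (λ r x → trans (ℚ∑.∑<-cong (bound f) λ n → Form.*ₗ-homo n r (comp x n))
    (ℚ∑.∑<-• r (bound f) λ n → form (comp f n) (comp x n)))
  where module Form n = IsModuleHomomorphism (isLinear (comp f n))

⟪⟫-linearˡ : ∀ x → IsLinear 𝔖Sym*ᴹ ℚ¹ ⟪_, x ⟫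
⟪⟫-linearˡ x = mkLinear 𝔖Sym*ᴹ ℚ¹ _
  (λ {f} {g} eq → trans (⟪⟫-truncate f x (ℕₚ.m≤m⊔n (bound f) (bound g))) (trans
    (ℚ∑.∑<-cong (bound f ℕ.⊔ bound g) λ n → eq n (comp x n))
    (sym (⟪⟫-truncate g x (ℕₚ.m≤n⊔m (bound f) (bound g))))))
  (λ f g → trans
    (ℚ∑.∑<-+ (bound f ℕ.⊔ bound g) (λ n → form (comp f n) (comp x n)) (λ n → form (comp g n) (comp x n)))
    (sym (cong₂ ℚ._+_
    (⟪⟫-truncate f x (ℕₚ.m≤m⊔n (bound f) (bound g)))
    (⟪⟫-truncate g x (ℕₚ.m≤n⊔m (bound f) (bound g))))))
  (λ r f → ℚ∑.∑<-• r (bound f) λ n → form (comp f n) (comp x n))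

⟪⟫-ι : ∀ f n (x : ∣ V n ∣) → ⟪ f , ι V n x ⟫ ≡ form (comp f n) x
⟪⟫-ι f n x = trans (⟪⟫-truncate f (ι V n x) (ℕₚ.m≤m⊔n (bound f) (suc n))) (trans
  (ℚ∑.∑<-only {bound f ℕ.⊔ suc n} {n} (λ k → form (comp f k) (comp (ι V n x) k))
    (ℕₚ.m≤n⊔m (bound f) (suc n)) λ k k≢n → other k k≢n (n ℕₚ.≟ k))
  (same (n ℕₚ.≟ n)))
  where
  other : ∀ k → k ≢ n → (d : Dec (n ≡ k)) → form (comp f k) (atDegree V n x k d) ≡ 0ℚ
  other k k≢n (yes refl) = contradiction refl k≢n
  other k k≢n (no _)     = IsModuleHomomorphism.0ᴹ-homo (isLinear (comp f k))
  same : (d : Dec (n ≡ n)) → form (comp f n) (atDegree V n x n d) ≡ form (comp f n) x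
  same (yes refl) = refl
  same (no n≢n)   = contradiction refl n≢n

-- The identification of F* with F. Since the bound of `f` is kept, `Θ f` is by definition the
-- linear extension of u ↦ F(u⁻¹) applied to `coordinates f`.
coordinates : ∣ 𝔖Sym*ᴹ ∣ → ∣ 𝔖Symᴹ ∣
coordinates f = directSum (λ n u → ⟪ f , F u ⟫) (bound f)
  (λ n le u → trans (⟪⟫-ι f n _) (vanishes f n le _))

coordinates-linear : IsLinear 𝔖Sym*ᴹ 𝔖Symᴹ coordinates
coordinates-linear = mkLinear 𝔖Sym*ᴹ 𝔖Symᴹ _
  (λ {f} {g} eq n u → Pair.⟦⟧-cong u {f} {g} eq)
  (λ f g n u → Pair.+ᴹ-homo u f g)
  (λ r f n u → Pair.*ₗ-homo u r f)
  where module Pair {n} (u : 𝔖 n) = IsModuleHomomorphism (⟪⟫-linearˡ (F u))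

-- The component in degree n is recovered as the pairing with `ι V n x`, and a pairing is linear in
-- its second argument, so its values on the `F u` decide it.
coordinates-injective : ∀ {f g} → coordinates f ≈[ 𝔖Symᴹ ] coordinates g → f ≈[ 𝔖Sym*ᴹ ] g
coordinates-injective {f} {g} eq n x = trans (sym (⟪⟫-ι f n x)) (trans
  (linear-unique ℚ¹ (⟪⟫-linearʳ f) (⟪⟫-linearʳ g) (λ {n} u → eq n u) (ι V n x)) (⟪⟫-ι g n x))

fromCoordinates : ∣ 𝔖Symᴹ ∣ → ∣ 𝔖Sym*ᴹ ∣
fromCoordinates = linearExtension 𝔖Sym*ᴹ F*

fromCoordinates-linear : IsLinear 𝔖Symᴹ 𝔖Sym*ᴹ fromCoordinates
fromCoordinates-linear = linearExtension-linear 𝔖Sym*ᴹ F*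

coordinates-F* : (u : 𝔖 n) → coordinates (F* u) ≈[ 𝔖Symᴹ ] F u
coordinates-F* {n} u m w = trans (F*-dual u w) (trans
  ([]-cong sym sym ((n , u) ≟Σ (m , w)) ((m , w) ≟Σ (n , u))) (sym (comp-F u m w)))

coordinates-fromCoordinates : ∀ x → coordinates (fromCoordinates x) ≈[ 𝔖Symᴹ ] x
coordinates-fromCoordinates x = linear-unique 𝔖Symᴹ
  (∘-linear 𝔖Symᴹ 𝔖Sym*ᴹ 𝔖Symᴹ coordinates-linear fromCoordinates-linear)
  (mkLinear 𝔖Symᴹ 𝔖Symᴹ id id (λ _ _ _ _ → refl) (λ _ _ _ _ → refl))
  (λ u n w → trans
    (IsModuleHomomorphism.⟦⟧-cong coordinates-linear {fromCoordinates (F u)} {F* u} (linearExtension-F 𝔖Sym*ᴹ F* u) n w)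
    (coordinates-F* u n w)) x

fromCoordinates-coordinates : ∀ f → fromCoordinates (coordinates f) ≈[ 𝔖Sym*ᴹ ] f
fromCoordinates-coordinates f = coordinates-injective {fromCoordinates (coordinates f)} {f}
  (coordinates-fromCoordinates (coordinates f))

module _ (P : ℚ-Module) where
  open Module P

  -- Every functional is hit by `fromCoordinates`; composing with that map turns the claim into
  -- `linear-unique` on 𝔖Sym.
  linear-unique* : ∀ {K L} → IsLinear 𝔖Sym*ᴹ P K → IsLinear 𝔖Sym*ᴹ P L →
    (∀ {n} (u : 𝔖 n) → K (F* u) ≈ᴹ L (F* u)) → ∀ f → K f ≈ᴹ L f
  linear-unique* {K} {L} K-linear L-linear eq f = ≈ᴹ-trans
    (K.⟦⟧-cong {f} {f′} (𝕊*.≈ᴹ-sym {f′} {f} (fromCoordinates-coordinates f))) (≈ᴹ-trans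
    (linear-unique P {K ∘ fromCoordinates} {L ∘ fromCoordinates}
      (∘-linear 𝔖Symᴹ 𝔖Sym*ᴹ P K-linear fromCoordinates-linear)
      (∘-linear 𝔖Symᴹ 𝔖Sym*ᴹ P L-linear fromCoordinates-linear)
      (λ u → ≈ᴹ-trans (K.⟦⟧-cong {fromCoordinates (F u)} {F* u} (linearExtension-F 𝔖Sym*ᴹ F* u))
        (≈ᴹ-trans (eq u) (≈ᴹ-sym (L.⟦⟧-cong {fromCoordinates (F u)} {F* u} (linearExtension-F 𝔖Sym*ᴹ F* u)))))
      (coordinates f))
    (L.⟦⟧-cong {f′} {f} (fromCoordinates-coordinates f)))
    where
    module K = IsModuleHomomorphism K-linear
    module L = IsModuleHomomorphism L-linear
    f′ = fromCoordinates (coordinates f)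

-- Permutations and standardization

word-injective : {u v : 𝔖 n} → word u ≡ word v → u ≡ v
word-injective {u = perm _ _} {perm _ _} refl = refl

𝔖-ext : {u v : 𝔖 n} → (∀ i → u ⟨ i ⟩ ≡ v ⟨ i ⟩) → u ≡ v
𝔖-ext {u = u} {v} eq = word-injective (trans (sym (Vecₚ.tabulate∘lookup (word u)))
  (trans (Vecₚ.tabulate-cong eq) (Vecₚ.tabulate∘lookup (word v))))

∘ₚ-⟨⟩ : (u v : 𝔖 n) (i : Fin n) → (u ∘ₚ v) ⟨ i ⟩ ≡ u ⟨ v ⟨ i ⟩ ⟩
∘ₚ-⟨⟩ u v i = Vecₚ.lookup∘tabulate (λ i → u ⟨ v ⟨ i ⟩ ⟩) i

⁻¹-inverseʳ : (u : 𝔖 n) (i : Fin n) → u ⟨ (u ⁻¹) ⟨ i ⟩ ⟩ ≡ i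
⁻¹-inverseʳ u i = trans (cong (u ⟨_⟩) (Vecₚ.lookup∘tabulate (proj₁ ∘ ⟨⟩-surjective u) i)) (proj₂ (⟨⟩-surjective u i))

⁻¹-inverseˡ : (u : 𝔖 n) (i : Fin n) → (u ⁻¹) ⟨ u ⟨ i ⟩ ⟩ ≡ i
⁻¹-inverseˡ u i = ⟨⟩-injective u (⁻¹-inverseʳ u (u ⟨ i ⟩))

⁻¹-involutive : (u : 𝔖 n) → (u ⁻¹) ⁻¹ ≡ u
⁻¹-involutive u = 𝔖-ext λ i → ⟨⟩-injective (u ⁻¹) (trans (⁻¹-inverseʳ (u ⁻¹) i) (sym (⁻¹-inverseˡ u i)))

⁻¹-swap : {u v : 𝔖 n} → u ⁻¹ ≡ v → u ≡ v ⁻¹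
⁻¹-swap {u = u} refl = sym (⁻¹-involutive u)

×ₚ-⟨↑ˡ⟩ : (u : 𝔖 p) (v : 𝔖 q) (i : Fin p) → (u ×ₚ v) ⟨ i ↑ˡ q ⟩ ≡ u ⟨ i ⟩ ↑ˡ q
×ₚ-⟨↑ˡ⟩ {p} {q} u v i = trans (Vecₚ.lookup∘tabulate (join p q ∘ Sum.map (u ⟨_⟩) (v ⟨_⟩) ∘ splitAt p) (i ↑ˡ q))
  (cong (join p q ∘ Sum.map (u ⟨_⟩) (v ⟨_⟩)) (Finₚ.splitAt-↑ˡ p i q))

×ₚ-⟨↑ʳ⟩ : (u : 𝔖 p) (v : 𝔖 q) (j : Fin q) → (u ×ₚ v) ⟨ p ↑ʳ j ⟩ ≡ p ↑ʳ v ⟨ j ⟩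
×ₚ-⟨↑ʳ⟩ {p} {q} u v j = trans (Vecₚ.lookup∘tabulate (join p q ∘ Sum.map (u ⟨_⟩) (v ⟨_⟩) ∘ splitAt p) (p ↑ʳ j))
  (cong (join p q ∘ Sum.map (u ⟨_⟩) (v ⟨_⟩)) (Finₚ.splitAt-↑ʳ p q j))

-- Along 0 < 1 < ... < i every step raises the value by at least one. The predecessor of `suc i` is
-- taken as `inject₁ i`, which stays in `Fin m`.
increasing⇒inflationary : (f : Fin m → Fin n) → (∀ {i j} → i Fin.< j → f i Fin.< f j) → ∀ i → i Fin.≤ f i
increasing⇒inflationary f mono i = go (toℕ i) i refl
  where
  go : ∀ k i → toℕ i ≡ k → k ℕ.≤ toℕ (f i)
  go zero    i       _  = z≤n
  go (suc k) (suc i) eq = ℕₚ.≤-<-trans (go k (inject₁ i) (trans (Finₚ.toℕ-inject₁ i) (ℕₚ.suc-injective eq)))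
    (mono (s≤s (ℕₚ.≤-reflexive (Finₚ.toℕ-inject₁ i))))

order-reflecting : (f : Fin k → Fin m) (g : Fin k → Fin n) → Injective _≡_ _≡_ f →
  (∀ i j → f i Fin.< f j → g i Fin.< g j) → ∀ i j → g i Fin.< g j → f i Fin.< f j
order-reflecting f g f-injective mono i j gi<gj with Finₚ.<-cmp (f i) (f j)
... | tri< fi<fj _ _ = fi<fj
... | tri≈ _ fi≡fj _ = contradiction gi<gj (ℕₚ.<-irrefl (cong (toℕ ∘ g) (f-injective fi≡fj)))
... | tri> _ _ fj<fi = contradiction gi<gj (ℕₚ.<-asym (mono j i fj<fi))

-- The map v u⁻¹ is an increasing self-map of `Fin n`, hence inflationary, and so is its inverse;
-- therefore it is the identity.
order-determines : (u v : 𝔖 n) → (∀ i j → u ⟨ i ⟩ Fin.< u ⟨ j ⟩ → v ⟨ i ⟩ Fin.< v ⟨ j ⟩) → u ≡ v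
order-determines u v mono = 𝔖-ext λ i → Finₚ.≤-antisym (below u v mono i)
  (below v u (order-reflecting (u ⟨_⟩) (v ⟨_⟩) (⟨⟩-injective u) mono) i)
  where
  below : ∀ (u v : 𝔖 _) → (∀ i j → u ⟨ i ⟩ Fin.< u ⟨ j ⟩ → v ⟨ i ⟩ Fin.< v ⟨ j ⟩) → ∀ i → u ⟨ i ⟩ Fin.≤ v ⟨ i ⟩
  below u v mono i = subst (λ a → u ⟨ i ⟩ Fin.≤ v ⟨ a ⟩) (⁻¹-inverseˡ u i)
    (increasing⇒inflationary (λ a → v ⟨ u ⁻¹ ⟨ a ⟩ ⟩)
      (λ {a} {b} a<b → mono _ _ (subst₂ Fin._<_ (sym (⁻¹-inverseʳ u a)) (sym (⁻¹-inverseʳ u b)) a<b)) (u ⟨ i ⟩))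

module _ (w : Fin k → Fin m) (w-injective : Injective _≡_ _≡_ w) where

  st-mono : ∀ i j → w i Fin.< w j → st w w-injective ⟨ i ⟩ Fin.< st w w-injective ⟨ j ⟩
  st-mono i j wi<wj = subst₂ ℕ._<_ (letter i) (letter j) (rank-mono w w-injective wi<wj)
    where
    letter : ∀ i → rank w w-injective i ≡ toℕ (st w w-injective ⟨ i ⟩)
    letter i = sym (trans (cong toℕ (Vecₚ.lookup∘tabulate (λ i → fromℕ< (rank<k w w-injective i)) i))
      (Finₚ.toℕ-fromℕ< (rank<k w w-injective i)))

  st-reflects : ∀ i j → st w w-injective ⟨ i ⟩ Fin.< st w w-injective ⟨ j ⟩ → w i Fin.< w j
  st-reflects = order-reflecting w (st w w-injective ⟨_⟩) w-injective st-mono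

  -- Characterizes standardization by relative order alone, so that the counting in `rank` can be
  -- forgotten from here on.
  st-unique : (u : 𝔖 k) → (∀ i j → u ⟨ i ⟩ Fin.< u ⟨ j ⟩ → w i Fin.< w j) → st w w-injective ≡ u
  st-unique u mono = sym (order-determines u (st w w-injective) λ i j lt → st-mono i j (mono i j lt))

-- st(u₁…uₚ) and st(uₚ₊₁…uₙ) with the lengths p and q as variables; for p = toℕ i and
-- q = n ∸ toℕ i these are stPrefix u i and stSuffix u i.
module _ (u : 𝔖 n) (p q : ℕ) (e : p ℕ.+ q ≡ n) where

  private
    p≤n : p ℕ.≤ n
    p≤n = ℕₚ.m+n≤o⇒m≤o p (ℕₚ.≤-reflexive e)

    prefixWord : Fin p → Fin n
    prefixWord i = u ⟨ inject≤ i p≤n ⟩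

    prefixWord-injective : Injective _≡_ _≡_ prefixWord
    prefixWord-injective = Finₚ.inject≤-injective p≤n p≤n _ _ ∘ ⟨⟩-injective u

    suffixWord : Fin q → Fin n
    suffixWord i = u ⟨ cast e (p ↑ʳ i) ⟩

    suffixWord-injective : Injective _≡_ _≡_ suffixWord
    suffixWord-injective {i} {j} eq = Finₚ.↑ʳ-injective p i j (Finₚ.toℕ-injective (trans
      (sym (Finₚ.toℕ-cast e (p ↑ʳ i))) (trans (cong toℕ (⟨⟩-injective u eq)) (Finₚ.toℕ-cast e (p ↑ʳ j)))))

  prefix : 𝔖 p
  prefix = st prefixWord prefixWord-injective

  suffix : 𝔖 q
  suffix = st suffixWord suffixWord-injective

  prefix-unique = st-unique prefixWord prefixWord-injective
  prefix-reflects = st-reflects prefixWord prefixWord-injective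
  suffix-unique = st-unique suffixWord suffixWord-injective
  suffix-reflects = st-reflects suffixWord suffixWord-injective

splitting : (i : Fin (suc n)) → toℕ i ℕ.+ (n ℕ.∸ toℕ i) ≡ n
splitting i = ℕₚ.m+[n∸m]≡n (Finₚ.toℕ≤pred[n] i)

-- w = ζ (u × v) for a shuffle ζ exactly when u and v are the standardized parts of w:
-- this one bijection governs both the product and the coproduct.
module _ (u : 𝔖 p) (v : 𝔖 q) (w : 𝔖 (p ℕ.+ q)) where

  private
    shuffle : 𝔖 (p ℕ.+ q)
    shuffle = w ∘ₚ (u ⁻¹ ×ₚ v ⁻¹)

    shuffleˡ : ∀ i → shuffle ⟨ i ↑ˡ q ⟩ ≡ w ⟨ u ⁻¹ ⟨ i ⟩ ↑ˡ q ⟩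
    shuffleˡ i = trans (∘ₚ-⟨⟩ w (u ⁻¹ ×ₚ v ⁻¹) (i ↑ˡ q)) (cong (w ⟨_⟩) (×ₚ-⟨↑ˡ⟩ (u ⁻¹) (v ⁻¹) i))

    shuffleʳ : ∀ i → shuffle ⟨ p ↑ʳ i ⟩ ≡ w ⟨ p ↑ʳ v ⁻¹ ⟨ i ⟩ ⟩
    shuffleʳ i = trans (∘ₚ-⟨⟩ w (u ⁻¹ ×ₚ v ⁻¹) (p ↑ʳ i)) (cong (w ⟨_⟩) (×ₚ-⟨↑ʳ⟩ (u ⁻¹) (v ⁻¹) i))

    inject≤≡↑ˡ : ∀ .(le : p ℕ.≤ p ℕ.+ q) i → inject≤ i le ≡ i ↑ˡ q
    inject≤≡↑ˡ le i = Finₚ.toℕ-injective (trans (Finₚ.toℕ-inject≤ i le) (sym (Finₚ.toℕ-↑ˡ i q)))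

    wˡ : ∀ i → w ⟨ inject≤ i (ℕₚ.m≤m+n p q) ⟩ ≡ shuffle ⟨ u ⟨ i ⟩ ↑ˡ q ⟩
    wˡ i = trans (cong (w ⟨_⟩) (trans (inject≤≡↑ˡ _ i) (cong (_↑ˡ q) (sym (⁻¹-inverseˡ u i))))) (sym (shuffleˡ (u ⟨ i ⟩)))

    wʳ : ∀ i → w ⟨ cast refl (p ↑ʳ i) ⟩ ≡ shuffle ⟨ p ↑ʳ v ⟨ i ⟩ ⟩
    wʳ i = trans (cong (w ⟨_⟩) (trans (Finₚ.cast-is-id refl (p ↑ʳ i)) (cong (p ↑ʳ_) (sym (⁻¹-inverseˡ v i)))))
      (sym (shuffleʳ (v ⟨ i ⟩)))

  shuffle⇒prefix-suffix : IsShuffle p q (w ∘ₚ (u ⁻¹ ×ₚ v ⁻¹)) → prefix w p q refl ≡ u × suffix w p q refl ≡ v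
  shuffle⇒prefix-suffix (incˡ , incʳ) =
    prefix-unique w p q refl u (λ i j lt → subst₂ Fin._<_ (sym (wˡ i)) (sym (wˡ j)) (incˡ _ _ lt)) ,
    suffix-unique w p q refl v (λ i j lt → subst₂ Fin._<_ (sym (wʳ i)) (sym (wʳ j)) (incʳ _ _ lt))

  prefix-suffix⇒shuffle : prefix w p q refl ≡ u × suffix w p q refl ≡ v → IsShuffle p q (w ∘ₚ (u ⁻¹ ×ₚ v ⁻¹))
  prefix-suffix⇒shuffle (eqˡ , eqʳ) = incˡ , incʳ
    where
    incˡ : ∀ i j → i Fin.< j → shuffle ⟨ i ↑ˡ q ⟩ Fin.< shuffle ⟨ j ↑ˡ q ⟩
    incˡ i j i<j = subst₂ (λ a b → shuffle ⟨ a ↑ˡ q ⟩ Fin.< shuffle ⟨ b ↑ˡ q ⟩) (⁻¹-inverseʳ u i) (⁻¹-inverseʳ u j)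
      (subst₂ Fin._<_ (wˡ (u ⁻¹ ⟨ i ⟩)) (wˡ (u ⁻¹ ⟨ j ⟩)) (prefix-reflects w p q refl _ _
        (subst (λ x → x ⟨ u ⁻¹ ⟨ i ⟩ ⟩ Fin.< x ⟨ u ⁻¹ ⟨ j ⟩ ⟩) (sym eqˡ)
          (subst₂ Fin._<_ (sym (⁻¹-inverseʳ u i)) (sym (⁻¹-inverseʳ u j)) i<j))))
    incʳ : ∀ i j → i Fin.< j → shuffle ⟨ p ↑ʳ i ⟩ Fin.< shuffle ⟨ p ↑ʳ j ⟩
    incʳ i j i<j = subst₂ (λ a b → shuffle ⟨ p ↑ʳ a ⟩ Fin.< shuffle ⟨ p ↑ʳ b ⟩) (⁻¹-inverseʳ v i) (⁻¹-inverseʳ v j)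
      (subst₂ Fin._<_ (wʳ (v ⁻¹ ⟨ i ⟩)) (wʳ (v ⁻¹ ⟨ j ⟩)) (suffix-reflects w p q refl (v ⁻¹ ⟨ i ⟩) (v ⁻¹ ⟨ j ⟩)
        (subst (λ (x : 𝔖 q) → x ⟨ v ⁻¹ ⟨ i ⟩ ⟩ Fin.< x ⟨ v ⁻¹ ⟨ j ⟩ ⟩) (sym eqʳ)
          (subst₂ Fin._<_ (sym (⁻¹-inverseʳ v i)) (sym (⁻¹-inverseʳ v j)) i<j))))

prefix-all : (u : 𝔖 n) (e : n ℕ.+ 0 ≡ n) → prefix u n 0 e ≡ u
prefix-all {n} u e = prefix-unique u n 0 e u λ i j lt →
  subst₂ (λ a b → u ⟨ a ⟩ Fin.< u ⟨ b ⟩) (sym (inject≤-id _ i)) (sym (inject≤-id _ j)) lt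
  where
  inject≤-id : ∀ .(le : n ℕ.≤ n) (i : Fin n) → inject≤ i le ≡ i
  inject≤-id le i = Finₚ.toℕ-injective (Finₚ.toℕ-inject≤ i le)

𝔖₀-unique : (u v : 𝔖 0) → u ≡ v
𝔖₀-unique u v = 𝔖-ext λ ()

module _ (P : ℚ-Module) where
  open Module P

  -- Both sums are the same by definition, because the words of the standardizations do not depend
  -- on the proofs of bounds and injectivity. It serves to pass to summands indexed by lengths and
  -- an equation between them.
  ∑-st-cong : ∀ {n} (K : ∀ {p q} → 𝔖 p → 𝔖 q → ∣ P ∣) (u : 𝔖 n) →
    ∑ P (allFin (suc n)) (λ i → K (stPrefix u i) (stSuffix u i)) ≈ᴹ
    ∑ P (allFin (suc n)) (λ i → K (prefix u (toℕ i) (n ℕ.∸ toℕ i) (splitting i))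
                                      (suffix u (toℕ i) (n ℕ.∸ toℕ i) (splitting i)))
  ∑-st-cong K u = ≈ᴹ-refl

  -- The index `i` satisfies `toℕ i ≡ p` only propositionally. Letting `G` take arbitrary lengths
  -- and an equation allows matching on these equalities, and proofs of equality in ℕ are unique.
  ∑-splittings-only : ∀ {n} (G : ∀ p q → p ℕ.+ q ≡ n → ∣ P ∣) p q (e : p ℕ.+ q ≡ n) →
    (∀ p′ q′ e′ → p′ ≢ p → G p′ q′ e′ ≈ᴹ 0ᴹ) →
    ∑ P (allFin (suc n)) (λ i → G (toℕ i) (n ℕ.∸ toℕ i) (splitting i)) ≈ᴹ G p q e
  ∑-splittings-only {n} G p q e G≈0 = ≈ᴹ-trans
    (Sums.∑-only P {x = i} (λ i → G (toℕ i) (n ℕ.∸ toℕ i) (splitting i))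
      (Uniqueₚ.allFin⁺ (suc n)) (Memₚ.∈-allFin i)
      (λ j j≢i → G≈0 _ _ _ λ j≡p → j≢i (Finₚ.toℕ-injective (trans j≡p (sym i≡p)))))
    (reindex _ _ _ i≡p (ℕₚ.+-cancelˡ-≡ p _ _ (trans (cong (ℕ._+ (n ℕ.∸ toℕ i)) (sym i≡p))
      (trans (splitting i) (sym e)))))
    where
    p<1+n : p ℕ.< suc n
    p<1+n = s≤s (ℕₚ.m+n≤o⇒m≤o p (ℕₚ.≤-reflexive e))
    i : Fin (suc n)
    i = fromℕ< p<1+n
    i≡p : toℕ i ≡ p
    i≡p = Finₚ.toℕ-fromℕ< p<1+n
    reindex : ∀ p′ q′ e′ → p′ ≡ p → q′ ≡ q → G p′ q′ e′ ≈ᴹ G p q e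
    reindex _ _ e′ refl refl with refl ← ℕₚ.≡-irrelevant e′ e = ≈ᴹ-refl

-- With `quotient-inverse`: ζ ↦ s ζ⁻¹ is a bijection, so each basis element occurs at most once in
-- `F-product` and its coefficient is an indicator.
quotient-unique : (s w ζ : 𝔖 n) → s ∘ₚ ζ ⁻¹ ≡ w → ζ ≡ w ⁻¹ ∘ₚ s
quotient-unique s _ ζ refl = 𝔖-ext λ i → ⟨⟩-injective w (begin
  w ⟨ ζ ⟨ i ⟩ ⟩             ≡⟨ ∘ₚ-⟨⟩ s (ζ ⁻¹) (ζ ⟨ i ⟩) ⟩
  s ⟨ ζ ⁻¹ ⟨ ζ ⟨ i ⟩ ⟩ ⟩    ≡⟨ cong (s ⟨_⟩) (⁻¹-inverseˡ ζ i) ⟩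
  s ⟨ i ⟩                   ≡⟨ sym (⁻¹-inverseʳ w (s ⟨ i ⟩)) ⟩
  w ⟨ w ⁻¹ ⟨ s ⟨ i ⟩ ⟩ ⟩    ≡⟨ cong (w ⟨_⟩) (sym (∘ₚ-⟨⟩ (w ⁻¹) s i)) ⟩
  w ⟨ (w ⁻¹ ∘ₚ s) ⟨ i ⟩ ⟩   ∎)
  where
  open ≡-Reasoning
  w = s ∘ₚ ζ ⁻¹

quotient-inverse : (s w : 𝔖 n) → s ∘ₚ (w ⁻¹ ∘ₚ s) ⁻¹ ≡ w
quotient-inverse s w = 𝔖-ext λ j → ⟨⟩-injective (w ⁻¹) (begin
  w ⁻¹ ⟨ (s ∘ₚ ζ ⁻¹) ⟨ j ⟩ ⟩   ≡⟨ cong (w ⁻¹ ⟨_⟩) (∘ₚ-⟨⟩ s (ζ ⁻¹) j) ⟩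
  w ⁻¹ ⟨ s ⟨ ζ ⁻¹ ⟨ j ⟩ ⟩ ⟩    ≡⟨ sym (∘ₚ-⟨⟩ (w ⁻¹) s (ζ ⁻¹ ⟨ j ⟩)) ⟩
  ζ ⟨ ζ ⁻¹ ⟨ j ⟩ ⟩             ≡⟨ ⁻¹-inverseʳ ζ j ⟩
  j                            ≡⟨ sym (⁻¹-inverseˡ w j) ⟩
  w ⁻¹ ⟨ w ⟨ j ⟩ ⟩             ∎)
  where
  open ≡-Reasoning
  ζ = w ⁻¹ ∘ₚ s

-- Bilinear maps

module _ (Q P : ℚ-Module) where
  open Module P
  open Sums P

  ∑-linear : ∀ (xs : List A) {φ : A → ∣ Q ∣ → ∣ P ∣} → (∀ a → IsLinear Q P (φ a)) →
    IsLinear Q P (λ y → ∑ P xs λ a → φ a y)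
  ∑-linear xs {φ} lin = mkLinear Q P _
    (λ eq → ∑-cong xs λ a → φ.⟦⟧-cong a eq)
    (λ x y → ≈ᴹ-trans (∑-cong xs λ a → φ.+ᴹ-homo a x y) (∑-+ xs (λ a → φ a x) (λ a → φ a y)))
    (λ r x → ≈ᴹ-trans (∑-cong xs λ a → φ.*ₗ-homo a r x) (∑-• r xs (λ a → φ a x)))
    where module φ a = IsModuleHomomorphism (lin a)

  ∑<-linear : ∀ N {φ : ℕ → ∣ Q ∣ → ∣ P ∣} → (∀ k → IsLinear Q P (φ k)) → IsLinear Q P (λ y → ∑< P N λ k → φ k y)
  ∑<-linear N {φ} lin = mkLinear Q P _
    (λ eq → ∑<-cong N λ k → φ.⟦⟧-cong k eq)
    (λ x y → ≈ᴹ-trans (∑<-cong N λ k → φ.+ᴹ-homo k x y) (∑<-+ N (λ k → φ k x) (λ k → φ k y)))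
    (λ r x → ≈ᴹ-trans (∑<-cong N λ k → φ.*ₗ-homo k r x) (∑<-• r N (λ k → φ k x)))
    where module φ k = IsModuleHomomorphism (lin k)

  *ₗ-linear : ∀ c {φ : ∣ Q ∣ → ∣ P ∣} → IsLinear Q P φ → IsLinear Q P (λ y → c *ₗ φ y)
  *ₗ-linear c {φ} lin = mkLinear Q P _
    (λ eq → *ₗ-congˡ {c} (φ.⟦⟧-cong eq))
    (λ x y → ≈ᴹ-trans (*ₗ-congˡ {c} (φ.+ᴹ-homo x y)) (*ₗ-distribˡ c (φ x) (φ y)))
    (λ r x → ≈ᴹ-trans (*ₗ-congˡ {c} (φ.*ₗ-homo r x)) (≈ᴹ-trans (≈ᴹ-sym (*ₗ-assoc c r (φ x)))
      (≈ᴹ-trans (*ₗ-coeff (φ x) (ℚₚ.*-comm c r)) (*ₗ-assoc r c (φ x)))))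
    where module φ = IsModuleHomomorphism lin

  linearExtension-linearʳ : ∀ (φ : ∀ {n} → 𝔖 n → ∣ Q ∣ → ∣ P ∣) → (∀ {n} (u : 𝔖 n) → IsLinear Q P (φ u)) →
    ∀ x → IsLinear Q P (λ y → linearExtension P (λ u → φ u y) x)
  linearExtension-linearʳ φ lin x = ∑<-linear (bound x) λ n → ∑-linear (perms n) λ u → *ₗ-linear (comp x n u) (lin u)

*-linearˡ : ∀ Q c {φ : ∣ Q ∣ → ℚ} → IsLinear Q ℚ¹ φ → IsLinear Q ℚ¹ (λ y → φ y ℚ.* c)
*-linearˡ Q c {φ} lin = mkLinear Q ℚ¹ _
  (λ eq → cong (ℚ._* c) (φ.⟦⟧-cong eq))
  (λ x y → trans (cong (ℚ._* c) (φ.+ᴹ-homo x y)) (ℚₚ.*-distribʳ-+ c (φ x) (φ y)))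
  (λ r x → trans (cong (ℚ._* c) (φ.*ₗ-homo r x)) (ℚₚ.*-assoc r (φ x) c))
  where module φ = IsModuleHomomorphism lin

record IsBilinear (P Q R : ℚ-Module) (β : ∣ P ∣ → ∣ Q ∣ → ∣ R ∣) : Set where
  constructor bilinear
  field
    linearˡ : ∀ y → IsLinear P R (λ x → β x y)
    linearʳ : ∀ x → IsLinear Q R (β x)

module _ (P Q R : ℚ-Module) {β : ∣ P ∣ → ∣ Q ∣ → ∣ R ∣} (β-bilinear : IsBilinear P Q R β) where
  private
    module R = Module R
    module ˡ y = IsModuleHomomorphism (IsBilinear.linearˡ β-bilinear y)
    module ʳ x = IsModuleHomomorphism (IsBilinear.linearʳ β-bilinear x)

  -- The universal property of the tensor product. Relations that mention `_⊗_` are paid for by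
  -- bilinearity of `β`; the remaining ones hold in every module.
  induced-cong : ∀ {s t} → s ≈[ P ⊗ᴹ Q ] t → induced R β s ≈[ R ] induced R β t
  induced-cong ∼-refl             = R.≈ᴹ-refl
  induced-cong (∼-sym eq)         = R.≈ᴹ-sym (induced-cong eq)
  induced-cong (∼-trans eq eq′)   = R.≈ᴹ-trans (induced-cong eq) (induced-cong eq′)
  induced-cong (⊞-cong eq eq′)    = R.+ᴹ-cong (induced-cong eq) (induced-cong eq′)
  induced-cong (⊡-cong r eq)      = R.*ₗ-congˡ {r} (induced-cong eq)
  induced-cong (⊞-assoc s t u)    = R.+ᴹ-assoc _ _ _
  induced-cong (⊞-comm s t)       = R.+ᴹ-comm _ _
  induced-cong (⊞-identity s)     = R.+ᴹ-identityˡ _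
  induced-cong (⊞-inverse s)      = Sums.-1*ₗ-inverse R _
  induced-cong (⊡-distribˡ r s t) = R.*ₗ-distribˡ r _ _
  induced-cong (⊡-distribʳ t r s) = R.*ₗ-distribʳ _ r s
  induced-cong (⊡-assoc r s t)    = R.*ₗ-assoc r s _
  induced-cong (⊡-identity t)     = R.*ₗ-identityˡ _
  induced-cong (⊗-cong {x} {x′} {y} {y′} eq eq′) = R.≈ᴹ-trans (ˡ.⟦⟧-cong y eq) (ʳ.⟦⟧-cong x′ eq′)
  induced-cong (⊗-+ˡ x x′ y)      = ˡ.+ᴹ-homo y x x′
  induced-cong (⊗-+ʳ x y y′)      = ʳ.+ᴹ-homo x y y′
  induced-cong (⊗-•ˡ r x y)       = ˡ.*ₗ-homo y r x
  induced-cong (⊗-•ʳ r x y)       = ʳ.*ₗ-homo x r y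

  induced-linear : IsLinear (P ⊗ᴹ Q) R (induced R β)
  induced-linear = mkLinear (P ⊗ᴹ Q) R _ induced-cong (λ _ _ → R.≈ᴹ-refl) (λ _ _ → R.≈ᴹ-refl)

-- Linearity of the structure maps

open RawBialgebra 𝔖Sym using (_·_; Δ; ε)

·-bilinear : IsBilinear 𝔖Symᴹ 𝔖Symᴹ 𝔖Symᴹ _·_
·-bilinear = bilinear
  (λ y → linearExtension-linear 𝔖Symᴹ λ u → linearExtension 𝔖Symᴹ (λ v → F-product u v) y)
  (linearExtension-linearʳ 𝔖Symᴹ 𝔖Symᴹ (λ u → linearExtension 𝔖Symᴹ λ v → F-product u v)
    λ u → linearExtension-linear 𝔖Symᴹ λ v → F-product u v)

·-F-F : (u : 𝔖 p) (v : 𝔖 q) → F u · F v ≈[ 𝔖Symᴹ ] F-product u v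
·-F-F u v = 𝕊.≈ᴹ-trans {F u · F v} {linearExtension 𝔖Symᴹ (λ v → F-product u v) (F v)} {F-product u v}
  (linearExtension-F 𝔖Symᴹ (λ u → linearExtension 𝔖Symᴹ (λ v → F-product u v) (F v)) u)
  (linearExtension-F 𝔖Symᴹ (λ v → F-product u v) v)

Δ-linear : IsLinear 𝔖Symᴹ (𝔖Symᴹ ⊗ᴹ 𝔖Symᴹ) Δ
Δ-linear = linearExtension-linear (𝔖Symᴹ ⊗ᴹ 𝔖Symᴹ) F-coproduct

Δ-F : (u : 𝔖 n) → Δ (F u) ≈[ 𝔖Symᴹ ⊗ᴹ 𝔖Symᴹ ] F-coproduct u
Δ-F = linearExtension-F (𝔖Symᴹ ⊗ᴹ 𝔖Symᴹ) F-coproduct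

pairing-bilinear : ∀ f g → IsBilinear 𝔖Symᴹ 𝔖Symᴹ ℚ¹ (λ x y → ⟪ f , x ⟫ ℚ.* ⟪ g , y ⟫)
pairing-bilinear f g = bilinear
  (λ y → *-linearˡ 𝔖Symᴹ ⟪ g , y ⟫ (⟪⟫-linearʳ f))
  (λ x → *ₗ-linear 𝔖Symᴹ ℚ¹ ⟪ f , x ⟫ (⟪⟫-linearʳ g))

pair²-linear : ∀ f g → IsLinear (𝔖Symᴹ ⊗ᴹ 𝔖Symᴹ) ℚ¹ (pair² f g)
pair²-linear f g = induced-linear 𝔖Symᴹ 𝔖Symᴹ ℚ¹ (pairing-bilinear f g)

-- The value of the dual product on `F w`, as a sum over cuts of the word w. In this form its
-- bilinearity in the two functionals is visible.
convolution : ∣ 𝔖Sym*ᴹ ∣ → ∣ 𝔖Sym*ᴹ ∣ → 𝔖 n → ℚ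
convolution {n} f g w = ∑ ℚ¹ (allFin (suc n)) λ i → ⟪ f , F (stPrefix w i) ⟫ ℚ.* ⟪ g , F (stSuffix w i) ⟫

convolution-bilinear : (w : 𝔖 n) → IsBilinear 𝔖Sym*ᴹ 𝔖Sym*ᴹ ℚ¹ (λ f g → convolution f g w)
convolution-bilinear {n} w = bilinear
  (λ g → ∑-linear 𝔖Sym*ᴹ ℚ¹ (allFin (suc n)) λ i →
    *-linearˡ 𝔖Sym*ᴹ ⟪ g , F (stSuffix w i) ⟫ (⟪⟫-linearˡ (F (stPrefix w i))))
  (λ f → ∑-linear 𝔖Sym*ᴹ ℚ¹ (allFin (suc n)) λ i →
    *ₗ-linear 𝔖Sym*ᴹ ℚ¹ ⟪ f , F (stPrefix w i) ⟫ (⟪⟫-linearˡ (F (stSuffix w i))))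

dualProduct-F : ∀ f g (w : 𝔖 n) → ⟪ dualProduct f g , F w ⟫ ≡ convolution f g w
dualProduct-F {n} f g w = trans (⟪⟫-ι (dualProduct f g) n _) (trans
  (Pair.⟦⟧-cong (Δ-F w))
  (Pair.∑-homo (allFin (suc n)) λ i → F (stPrefix w i) ⊗ F (stSuffix w i)))
  where module Pair = Linear (𝔖Symᴹ ⊗ᴹ 𝔖Symᴹ) ℚ¹ (pair²-linear f g)

-- The map Θ

Ψ : ∣ 𝔖Symᴹ ∣ → ∣ 𝔖Symᴹ ∣
Ψ = linearExtension 𝔖Symᴹ (λ u → F (u ⁻¹))

Ψ-linear : IsLinear 𝔖Symᴹ 𝔖Symᴹ Ψ
Ψ-linear = linearExtension-linear 𝔖Symᴹ (λ u → F (u ⁻¹))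

Ψ-F : (u : 𝔖 n) → Ψ (F u) ≈[ 𝔖Symᴹ ] F (u ⁻¹)
Ψ-F = linearExtension-F 𝔖Symᴹ (λ u → F (u ⁻¹))

Ψ-involutive : ∀ x → Ψ (Ψ x) ≈[ 𝔖Symᴹ ] x
Ψ-involutive = linear-unique 𝔖Symᴹ {Ψ ∘ Ψ} {id} (∘-linear 𝔖Symᴹ 𝔖Symᴹ 𝔖Symᴹ Ψ-linear Ψ-linear)
  (mkLinear 𝔖Symᴹ 𝔖Symᴹ id id (λ _ _ _ _ → refl) (λ _ _ _ _ → refl))
  λ u → 𝕊.≈ᴹ-trans {Ψ (Ψ (F u))} {Ψ (F (u ⁻¹))} {F u}
    (IsModuleHomomorphism.⟦⟧-cong Ψ-linear {Ψ (F u)} {F (u ⁻¹)} (Ψ-F u))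
    (subst (λ v → Ψ (F (u ⁻¹)) ≈[ 𝔖Symᴹ ] F v) (⁻¹-involutive u) (Ψ-F (u ⁻¹)))

Θ-linear : IsLinear 𝔖Sym*ᴹ 𝔖Symᴹ Θ
Θ-linear = ∘-linear 𝔖Sym*ᴹ 𝔖Symᴹ 𝔖Symᴹ Ψ-linear coordinates-linear

Θ-F* : (u : 𝔖 n) → Θ (F* u) ≈[ 𝔖Symᴹ ] F (u ⁻¹)
Θ-F* u = 𝕊.≈ᴹ-trans {Θ (F* u)} {Ψ (F u)} {F (u ⁻¹)}
  (IsModuleHomomorphism.⟦⟧-cong Ψ-linear {coordinates (F* u)} {F u} (coordinates-F* u)) (Ψ-F u)

-- On basis functionals both sides are indicators, of w = u⁻¹ and of u = w⁻¹, which are the same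
-- condition.
comp-Θ : ∀ f (w : 𝔖 n) → comp (Θ f) n w ≡ ⟪ f , F (w ⁻¹) ⟫
comp-Θ {n} f w = linear-unique* ℚ¹ {λ f → comp (Θ f) n w} {⟪_, F (w ⁻¹) ⟫}
  (∘-linear 𝔖Sym*ᴹ 𝔖Symᴹ ℚ¹ (coordinate-linear w) Θ-linear) (⟪⟫-linearˡ (F (w ⁻¹)))
  (λ {m} u → begin
    comp (Θ (F* u)) n w           ≡⟨ Θ-F* u n w ⟩
    comp (F (u ⁻¹)) n w           ≡⟨ comp-F (u ⁻¹) n w ⟩
    [ (n , w) ≟Σ (m , u ⁻¹) ]     ≡⟨ []-cong (λ { refl → cong (m ,_) (⁻¹-swap refl) })
                                       (λ { refl → cong (n ,_) (⁻¹-swap refl) })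
                                       ((n , w) ≟Σ (m , u ⁻¹)) ((m , u) ≟Σ (n , w ⁻¹)) ⟩
    [ (m , u) ≟Σ (n , w ⁻¹) ]     ≡⟨ sym (F*-dual u (w ⁻¹)) ⟩
    ⟪ F* u , F (w ⁻¹) ⟫           ∎) f
  where open ≡-Reasoning

⟪⟫-Θ : ∀ f (u : 𝔖 n) → ⟪ f , F u ⟫ ≡ comp (Θ f) n (u ⁻¹)
⟪⟫-Θ f u = trans (cong (λ v → ⟪ f , F v ⟫) (sym (⁻¹-involutive u))) (sym (comp-Θ f (u ⁻¹)))

Θ-injective : ∀ {f g} → Θ f ≈[ 𝔖Symᴹ ] Θ g → f ≈[ 𝔖Sym*ᴹ ] g
Θ-injective {f} {g} eq = coordinates-injective {f} {g} λ n u →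
  trans (⟪⟫-Θ f u) (trans (eq n (u ⁻¹)) (sym (⟪⟫-Θ g u)))

Θ⁻¹ : ∣ 𝔖Symᴹ ∣ → ∣ 𝔖Sym*ᴹ ∣
Θ⁻¹ x = fromCoordinates (Ψ x)

Θ⁻¹-linear : IsLinear 𝔖Symᴹ 𝔖Sym*ᴹ Θ⁻¹
Θ⁻¹-linear = ∘-linear 𝔖Symᴹ 𝔖Symᴹ 𝔖Sym*ᴹ fromCoordinates-linear Ψ-linear

Θ-Θ⁻¹ : ∀ x → Θ (Θ⁻¹ x) ≈[ 𝔖Symᴹ ] x
Θ-Θ⁻¹ x = 𝕊.≈ᴹ-trans {Θ (Θ⁻¹ x)} {Ψ (Ψ x)} {x}
  (IsModuleHomomorphism.⟦⟧-cong Ψ-linear {coordinates (Θ⁻¹ x)} {Ψ x} (coordinates-fromCoordinates (Ψ x))) (Ψ-involutive x)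

Θ-isModuleIsomorphism : IsModuleIsomorphism (Module.rawModule 𝔖Sym*ᴹ) (Module.rawModule 𝔖Symᴹ) Θ
Θ-isModuleIsomorphism = record
  { isModuleMonomorphism = record { isModuleHomomorphism = Θ-linear ; injective = λ {f} {g} → Θ-injective {f} {g} }
  ; surjective = λ x → Θ⁻¹ x , λ {f} eq → 𝕊.≈ᴹ-trans {Θ f} {Θ (Θ⁻¹ x)} {x}
      (IsModuleHomomorphism.⟦⟧-cong Θ-linear {f} {Θ⁻¹ x} eq) (Θ-Θ⁻¹ x)
  }

-- Multiplicativity of Θ

F-product-coefficient : (u : 𝔖 p) (v : 𝔖 q) (w : 𝔖 (p ℕ.+ q)) →
  comp (F-product u v) (p ℕ.+ q) w ≡ [ isShuffle? p q (w ⁻¹ ∘ₚ (u ×ₚ v)) ]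
F-product-coefficient {p} {q} u v w = begin
  comp (F-product u v) (p ℕ.+ q) w
    ≡⟨ Linear.∑-homo 𝔖Symᴹ ℚ¹ (coordinate-linear w) (filter (isShuffle? p q) (perms (p ℕ.+ q))) (λ ζ → F (s ∘ₚ ζ ⁻¹)) ⟩
  (∑ ℚ¹ (filter (isShuffle? p q) (perms (p ℕ.+ q))) λ ζ → c ζ)
    ≡⟨ ℚ∑.∑-filter (isShuffle? p q) (perms (p ℕ.+ q)) c ⟩
  (∑ ℚ¹ (perms (p ℕ.+ q)) λ ζ → [ isShuffle? p q ζ ] ℚ.* c ζ)
    ≡⟨ ∑-perms-only ℚ¹ ζ₀ (λ ζ → [ isShuffle? p q ζ ] ℚ.* c ζ) (λ ζ ζ≢ζ₀ →
         trans (cong ([ isShuffle? p q ζ ] ℚ.*_) (trans (comp-F-same (s ∘ₚ ζ ⁻¹) w)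
                 ([]-false (ζ≢ζ₀ ∘ quotient-unique s w ζ) ((s ∘ₚ ζ ⁻¹) ≟ w))))
               (ℚₚ.*-zeroʳ [ isShuffle? p q ζ ])) ⟩
  [ isShuffle? p q ζ₀ ] ℚ.* c ζ₀
    ≡⟨ cong ([ isShuffle? p q ζ₀ ] ℚ.*_) (trans (comp-F-same (s ∘ₚ ζ₀ ⁻¹) w)
         ([]-true (quotient-inverse s w) ((s ∘ₚ ζ₀ ⁻¹) ≟ w))) ⟩
  [ isShuffle? p q ζ₀ ] ℚ.* 1ℚ
    ≡⟨ ℚₚ.*-identityʳ [ isShuffle? p q ζ₀ ] ⟩
  [ isShuffle? p q ζ₀ ] ∎
  where
  open ≡-Reasoning
  s ζ₀ : 𝔖 (p ℕ.+ q)
  s = u ×ₚ v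
  ζ₀ = w ⁻¹ ∘ₚ s
  c : 𝔖 (p ℕ.+ q) → ℚ
  c ζ = comp (F (s ∘ₚ ζ ⁻¹)) (p ℕ.+ q) w

F-product-other : ∀ (u : 𝔖 p) (v : 𝔖 q) (w : 𝔖 n) → p ℕ.+ q ≢ n → comp (F-product u v) n w ≡ 0ℚ
F-product-other {p} {q} u v w ≢n = trans
  (Linear.∑-homo 𝔖Symᴹ ℚ¹ (coordinate-linear w) (filter (isShuffle? p q) (perms (p ℕ.+ q))) (λ ζ → F ((u ×ₚ v) ∘ₚ ζ ⁻¹)))
  (ℚ∑.∑-zero (filter (isShuffle? p q) (perms (p ℕ.+ q))) λ ζ → comp-F-other ((u ×ₚ v) ∘ₚ ζ ⁻¹) w (≢n ∘ sym))

module _ (u : 𝔖 p) (v : 𝔖 q) (w : 𝔖 n) where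

  private
    summand : ∀ p′ q′ → p′ ℕ.+ q′ ≡ n → ℚ
    summand p′ q′ e = [ (p , u) ≟Σ (p′ , prefix w p′ q′ e) ] ℚ.* [ (q , v) ≟Σ (q′ , suffix w p′ q′ e) ]

    summand-zero : ∀ p′ q′ e → (p ≡ p′ → ¬ (q ≡ q′)) → summand p′ q′ e ≡ 0ℚ
    summand-zero p′ q′ e differ = trans (sym ([]-× d d′))
      ([]-false (λ (eq , eq′) → differ (cong proj₁ eq) (cong proj₁ eq′)) (d ×-dec d′))
      where
      d  = (p , u) ≟Σ (p′ , prefix w p′ q′ e)
      d′ = (q , v) ≟Σ (q′ , suffix w p′ q′ e)

  convolution-F* : convolution (F* u) (F* v) w ≡
    ∑ ℚ¹ (allFin (suc n)) (λ i → summand (toℕ i) (n ℕ.∸ toℕ i) (splitting i))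
  convolution-F* = ℚ∑.∑-cong (allFin (suc n)) λ i →
    cong₂ ℚ._*_ (F*-dual u (stPrefix w i)) (F*-dual v (stSuffix w i))

  convolution-F*-other : p ℕ.+ q ≢ n → convolution (F* u) (F* v) w ≡ 0ℚ
  convolution-F*-other ≢n = trans convolution-F* (ℚ∑.∑-zero (allFin (suc n)) λ i →
    summand-zero (toℕ i) (n ℕ.∸ toℕ i) (splitting i) λ { refl q≡ → ≢n (trans
      (cong (toℕ i ℕ.+_) q≡) (splitting i)) })

  -- A cut of w contributes only if its left part has the length p of u, so one summand survives.
  convolution-F*-same : (e : p ℕ.+ q ≡ n) →
    convolution (F* u) (F* v) w ≡ [ ((prefix w p q e) ≟ u) ×-dec ((suffix w p q e) ≟ v) ]
  convolution-F*-same e = trans convolution-F* (trans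
    (∑-splittings-only ℚ¹ summand p q e λ p′ q′ e′ p′≢p → summand-zero p′ q′ e′ λ p≡p′ → contradiction (sym p≡p′) p′≢p)
    (trans (cong₂ ℚ._*_
      ([]-cong (λ { refl → refl }) (λ { refl → refl }) ((p , u) ≟Σ (p , prefix w p q e)) ((prefix w p q e) ≟ u))
      ([]-cong (λ { refl → refl }) (λ { refl → refl }) ((q , v) ≟Σ (q , suffix w p q e)) ((suffix w p q e) ≟ v)))
    (sym ([]-× ((prefix w p q e) ≟ u) ((suffix w p q e) ≟ v)))))

-- Both sides are indicators. On the left, w⁻¹ has standardized parts u and v; on the right, w⁻¹
-- (u⁻¹ × v⁻¹) is a shuffle. The inverse introduced by `Θ` is the one that occurs in the product.
Θ-·-F* : (u : 𝔖 p) (v : 𝔖 q) (w : 𝔖 n) →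
  convolution (F* u) (F* v) (w ⁻¹) ≡ comp (F-product (u ⁻¹) (v ⁻¹)) n w
Θ-·-F* {p} {q} u v w = go w (p ℕ.+ q ℕₚ.≟ _)
  where
  go : ∀ {n} (w : 𝔖 n) → Dec (p ℕ.+ q ≡ n) →
    convolution (F* u) (F* v) (w ⁻¹) ≡ comp (F-product (u ⁻¹) (v ⁻¹)) n w
  go w (no ≢n)    = trans (convolution-F*-other u v (w ⁻¹) ≢n) (sym (F-product-other (u ⁻¹) (v ⁻¹) w ≢n))
  go w (yes refl) = trans (convolution-F*-same u v (w ⁻¹) refl) (trans
    ([]-cong (prefix-suffix⇒shuffle u v (w ⁻¹)) (shuffle⇒prefix-suffix u v (w ⁻¹))
      (((prefix (w ⁻¹) p q refl) ≟ u) ×-dec ((suffix (w ⁻¹) p q refl) ≟ v)) (isShuffle? p q (w ⁻¹ ∘ₚ (u ⁻¹ ×ₚ v ⁻¹))))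
    (sym (F-product-coefficient (u ⁻¹) (v ⁻¹) w)))

Θ-· : ∀ f g → Θ (dualProduct f g) ≈[ 𝔖Symᴹ ] Θ f · Θ g
Θ-· f g n w = trans (comp-Θ (dualProduct f g) w) (trans (dualProduct-F f g (w ⁻¹)) (both f g))
  where
  module ⋆ = IsBilinear (convolution-bilinear (w ⁻¹))
  module • = IsBilinear ·-bilinear
  basis : ∀ {p q} (u : 𝔖 p) (v : 𝔖 q) → convolution (F* u) (F* v) (w ⁻¹) ≡ comp (Θ (F* u) · Θ (F* v)) n w
  basis u v = trans (Θ-·-F* u v w) (sym (trans
    (IsModuleHomomorphism.⟦⟧-cong (•.linearˡ (Θ (F* v))) {Θ (F* u)} {F (u ⁻¹)} (Θ-F* u) n w) (trans
    (IsModuleHomomorphism.⟦⟧-cong (•.linearʳ (F (u ⁻¹))) {Θ (F* v)} {F (v ⁻¹)} (Θ-F* v) n w)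
    (·-F-F (u ⁻¹) (v ⁻¹) n w))))
  right : ∀ {p} (u : 𝔖 p) g → convolution (F* u) g (w ⁻¹) ≡ comp (Θ (F* u) · Θ g) n w
  right u = linear-unique* ℚ¹ {λ g → convolution (F* u) g (w ⁻¹)} {λ g → comp (Θ (F* u) · Θ g) n w}
    (⋆.linearʳ (F* u))
    (∘-linear 𝔖Sym*ᴹ 𝔖Symᴹ ℚ¹ (coordinate-linear w)
      (∘-linear 𝔖Sym*ᴹ 𝔖Symᴹ 𝔖Symᴹ (•.linearʳ (Θ (F* u))) Θ-linear))
    (basis u)
  both : ∀ f g → convolution f g (w ⁻¹) ≡ comp (Θ f · Θ g) n w
  both f g = linear-unique* ℚ¹ {λ f → convolution f g (w ⁻¹)} {λ f → comp (Θ f · Θ g) n w}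
    (⋆.linearˡ g)
    (∘-linear 𝔖Sym*ᴹ 𝔖Symᴹ ℚ¹ (coordinate-linear w)
      (∘-linear 𝔖Sym*ᴹ 𝔖Symᴹ 𝔖Symᴹ (•.linearˡ (Θ g)) Θ-linear))
    (λ u → right u g) f

-- The coproduct

private
  𝕊² : ℚ-Module
  𝕊² = 𝔖Symᴹ ⊗ᴹ 𝔖Symᴹ
  module 𝕊² = Module 𝕊²
  module 𝕊²∑ = Sums 𝕊²

-- A number attached to the expression and not to its class: equal tensors can have different
-- bounds, so a comparison uses the maximum.
tensorBound : Tensor 𝔖Symᴹ 𝔖Symᴹ → ℕ
tensorBound (x ⊗ y) = bound x ℕ.⊔ bound y
tensorBound 𝟎       = 0
tensorBound (s ⊞ t) = tensorBound s ℕ.⊔ tensorBound t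
tensorBound (r ⊡ t) = tensorBound t

reconstruct : ℕ → Tensor 𝔖Symᴹ 𝔖Symᴹ → Tensor 𝔖Symᴹ 𝔖Symᴹ
reconstruct N t = ∑< 𝕊² N λ p → ∑ 𝕊² (perms p) λ u → ∑< 𝕊² N λ q → ∑ 𝕊² (perms q) λ v → pair² (F* u) (F* v) t ⊡ F u ⊗ F v

reconstruct-linear : ∀ N → IsLinear 𝕊² 𝕊² (reconstruct N)
reconstruct-linear N = ∑<-linear 𝕊² 𝕊² N λ p → ∑-linear 𝕊² 𝕊² (perms p) λ u →
  ∑<-linear 𝕊² 𝕊² N λ q → ∑-linear 𝕊² 𝕊² (perms q) λ v →
  ∘-linear 𝕊² ℚ¹ 𝕊²
    (mkLinear ℚ¹ 𝕊² (_⊡ F u ⊗ F v) (λ { refl → ∼-refl }) (⊡-distribʳ (F u ⊗ F v)) (λ r s → ⊡-assoc r s (F u ⊗ F v)))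
    (pair²-linear (F* u) (F* v))

expand-truncated : ∀ P {L} → IsLinear 𝔖Symᴹ P L → ∀ {N} x → bound x ℕ.≤ N →
  L x ≈[ P ] (∑< P N λ n → ∑ P (perms n) λ u → Module._*ₗ_ P (comp x n u) (L (F u)))
expand-truncated P {L} L-linear x le = Module.≈ᴹ-trans P
  (expand-linear P L-linear x) (linearExtension-truncate P (λ u → L (F u)) x le)

⊗-bilinear : IsBilinear 𝔖Symᴹ 𝔖Symᴹ 𝕊² _⊗_
⊗-bilinear = bilinear
  (λ y → mkLinear 𝔖Symᴹ 𝕊² (_⊗ y) (λ eq → ⊗-cong eq (λ _ _ → refl)) (λ x x′ → ⊗-+ˡ x x′ y) (λ r x → ⊗-•ˡ r x y))
  (λ x → mkLinear 𝔖Symᴹ 𝕊² (x ⊗_) (λ eq → ⊗-cong (λ _ _ → refl) eq) (λ y y′ → ⊗-+ʳ x y y′) (λ r y → ⊗-•ʳ r x y))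

reconstruct-⊗ : ∀ {N} x y → bound x ℕ.≤ N → bound y ℕ.≤ N → x ⊗ y ≈[ 𝕊² ] reconstruct N (x ⊗ y)
reconstruct-⊗ {N} x y x≤ y≤ = 𝕊².≈ᴹ-trans
  (expand-truncated 𝕊² (IsBilinear.linearˡ ⊗-bilinear y) x x≤)
  (𝕊²∑.∑<-cong N λ p → 𝕊²∑.∑-cong (perms p) λ u → row u)
  where
  row : ∀ {p} (u : 𝔖 p) → comp x p u ⊡ (F u ⊗ y) ≈[ 𝕊² ]
    (∑< 𝕊² N λ q → ∑ 𝕊² (perms q) λ v → (⟪ F* u , x ⟫ ℚ.* ⟪ F* v , y ⟫) ⊡ F u ⊗ F v)
  row {p} u = 𝕊².≈ᴹ-trans
    (⊡-cong a (expand-truncated 𝕊² (IsBilinear.linearʳ ⊗-bilinear (F u)) y y≤)) (𝕊².≈ᴹ-trans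
    (𝕊².≈ᴹ-sym (𝕊²∑.∑<-• a N λ q → ∑ 𝕊² (perms q) λ v → comp y q v ⊡ F u ⊗ F v))
    (𝕊²∑.∑<-cong N λ q → 𝕊².≈ᴹ-trans
      (𝕊².≈ᴹ-sym (𝕊²∑.∑-• a (perms q) λ v → comp y q v ⊡ F u ⊗ F v))
      (𝕊²∑.∑-cong (perms q) λ v → 𝕊².≈ᴹ-trans
        (𝕊².≈ᴹ-sym (⊡-assoc a (comp y q v) (F u ⊗ F v)))
        (𝕊²∑.*ₗ-coeff (F u ⊗ F v) (sym (cong₂ ℚ._*_ (F*-coordinate x u) (F*-coordinate y v)))))))
    where a = comp x p u

-- For a fixed cutoff the expansion is linear in the tensor, so recursion on the expression leaves
-- only pure tensors, where both factors are expanded in the basis F.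
reconstruct-≈ : ∀ {N} t → tensorBound t ℕ.≤ N → t ≈[ 𝕊² ] reconstruct N t
reconstruct-≈ (x ⊗ y) le = reconstruct-⊗ x y (ℕₚ.m⊔n≤o⇒m≤o (bound x) (bound y) le) (ℕₚ.m⊔n≤o⇒n≤o (bound x) (bound y) le)
reconstruct-≈ {N} 𝟎 le = 𝕊².≈ᴹ-sym (IsModuleHomomorphism.0ᴹ-homo (reconstruct-linear N))
reconstruct-≈ {N} (s ⊞ t) le = 𝕊².≈ᴹ-trans
  (⊞-cong (reconstruct-≈ s (ℕₚ.m⊔n≤o⇒m≤o (tensorBound s) (tensorBound t) le))
          (reconstruct-≈ t (ℕₚ.m⊔n≤o⇒n≤o (tensorBound s) (tensorBound t) le)))
  (𝕊².≈ᴹ-sym (IsModuleHomomorphism.+ᴹ-homo (reconstruct-linear N) s t))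
reconstruct-≈ {N} (r ⊡ t) le = 𝕊².≈ᴹ-trans (⊡-cong r (reconstruct-≈ t le))
  (𝕊².≈ᴹ-sym (IsModuleHomomorphism.*ₗ-homo (reconstruct-linear N) r t))

-- Turns an equation in the quotient into equations between rational numbers, since `reconstruct`
-- sees a tensor only through these pairings.
pair²-separates : ∀ s t → (∀ {p q} (u : 𝔖 p) (v : 𝔖 q) → pair² (F* u) (F* v) s ≡ pair² (F* u) (F* v) t) → s ≈[ 𝕊² ] t
pair²-separates s t eq = 𝕊².≈ᴹ-trans (reconstruct-≈ s (ℕₚ.m≤m⊔n (tensorBound s) (tensorBound t))) (𝕊².≈ᴹ-trans
  (𝕊²∑.∑<-cong N λ p → 𝕊²∑.∑-cong (perms p) λ u → 𝕊²∑.∑<-cong N λ q → 𝕊²∑.∑-cong (perms q) λ v →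
    𝕊²∑.*ₗ-coeff (F u ⊗ F v) (eq u v))
  (𝕊².≈ᴹ-sym (reconstruct-≈ t (ℕₚ.m≤n⊔m (tensorBound s) (tensorBound t)))))
  where N = tensorBound s ℕ.⊔ tensorBound t

pair²-Δ : ∀ g h x → pair² g h (Δ x) ≡ ⟪ dualProduct g h , x ⟫
pair²-Δ g h = linear-unique ℚ¹ {pair² g h ∘ Δ} {⟪ dualProduct g h ,_⟫}
  (∘-linear 𝔖Symᴹ 𝕊² ℚ¹ (pair²-linear g h) Δ-linear) (⟪⟫-linearʳ (dualProduct g h))
  (λ {n} u → sym (⟪⟫-ι (dualProduct g h) n λ w → [ u ≟ w ]))

-- The matrix of `Θ` is that of an involution of the basis, hence symmetric. By linearity in `f` it
-- suffices to read off the coordinate of `Θ g` at u.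
Θ-adjoint : ∀ g f → ⟪ g , Θ f ⟫ ≡ ⟪ f , Θ g ⟫
Θ-adjoint g = linear-unique* ℚ¹ {λ f → ⟪ g , Θ f ⟫} {⟪_, Θ g ⟫}
  (∘-linear 𝔖Sym*ᴹ 𝔖Symᴹ ℚ¹ (⟪⟫-linearʳ g) Θ-linear) (⟪⟫-linearˡ (Θ g))
  (λ u → trans (IsModuleHomomorphism.⟦⟧-cong (⟪⟫-linearʳ g) {Θ (F* u)} {F (u ⁻¹)} (Θ-F* u))
    (trans (sym (comp-Θ g u)) (sym (F*-coordinate (Θ g) u))))

Θ⊗Θ : Tensor 𝔖Sym*ᴹ 𝔖Sym*ᴹ → Tensor 𝔖Symᴹ 𝔖Symᴹ
Θ⊗Θ = Θ ⊗₁ Θ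

pair²-Θ⊗Θ : ∀ g h (t : Tensor 𝔖Sym*ᴹ 𝔖Sym*ᴹ) → pair² g h (Θ⊗Θ t) ≡ induced ℚ¹ (λ a b → ⟪ a , Θ g ⟫ ℚ.* ⟪ b , Θ h ⟫) t
pair²-Θ⊗Θ g h (a ⊗ b) = cong₂ ℚ._*_ (Θ-adjoint g a) (Θ-adjoint h b)
pair²-Θ⊗Θ g h 𝟎       = refl
pair²-Θ⊗Θ g h (s ⊞ t) = cong₂ ℚ._+_ (pair²-Θ⊗Θ g h s) (pair²-Θ⊗Θ g h t)
pair²-Θ⊗Θ g h (r ⊡ t) = cong (r ℚ.*_) (pair²-Θ⊗Θ g h t)

-- Θ is self-adjoint, so that its compatibility with the coproduct is the
-- transpose of its compatibility with the product.
Θ-Δ : ∀ f → Δ (Θ f) ≈[ 𝕊² ] Θ⊗Θ (dualCoproduct f)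
Θ-Δ f = pair²-separates (Δ (Θ f)) (Θ⊗Θ (dualCoproduct f)) λ u v → begin
  pair² (F* u) (F* v) (Δ (Θ f))
    ≡⟨ pair²-Δ (F* u) (F* v) (Θ f) ⟩
  ⟪ dualProduct (F* u) (F* v) , Θ f ⟫
    ≡⟨ Θ-adjoint (dualProduct (F* u) (F* v)) f ⟩
  ⟪ f , Θ (dualProduct (F* u) (F* v)) ⟫
    ≡⟨ IsModuleHomomorphism.⟦⟧-cong (⟪⟫-linearʳ f) {Θ (dualProduct (F* u) (F* v))} {Θ (F* u) · Θ (F* v)}
         (Θ-· (F* u) (F* v)) ⟩
  ⟪ f , Θ (F* u) · Θ (F* v) ⟫
    ≡⟨ sym (dualCoproduct-pairing f (Θ (F* u)) (Θ (F* v))) ⟩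
  induced ℚ¹ (λ a b → ⟪ a , Θ (F* u) ⟫ ℚ.* ⟪ b , Θ (F* v) ⟫) (dualCoproduct f)
    ≡⟨ sym (pair²-Θ⊗Θ (F* u) (F* v) (dualCoproduct f)) ⟩
  pair² (F* u) (F* v) (Θ⊗Θ (dualCoproduct f)) ∎
  where open ≡-Reasoning

-- Uniqueness of the antipode

module _ (P : ℚ-Module) where
  open Module P
  open Sums P

  -- The difference of `G` and `H` has at most one nonzero summand, which must then equal its total,
  -- namely zero.
  ∑-splittings-cancel : ∀ {n} (G H : ∀ p q → p ℕ.+ q ≡ n → ∣ P ∣) p q (e : p ℕ.+ q ≡ n) →
    (∀ p′ q′ e′ → p′ ≢ p → G p′ q′ e′ ≈ᴹ H p′ q′ e′) →
    ∑ P (allFin (suc n)) (λ i → G (toℕ i) (n ℕ.∸ toℕ i) (splitting i)) ≈ᴹ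
    ∑ P (allFin (suc n)) (λ i → H (toℕ i) (n ℕ.∸ toℕ i) (splitting i)) →
    G p q e ≈ᴹ H p q e
  ∑-splittings-cancel {n} G H p q e agree sums = begin
    G p q e                                              ≈⟨ +ᴹ-identityʳ _ ⟨
    G p q e +ᴹ 0ᴹ                                        ≈⟨ +ᴹ-congˡ (-1*ₗ-inverse (H p q e)) ⟨
    G p q e +ᴹ ((ℚ.- 1ℚ) *ₗ H p q e +ᴹ H p q e)          ≈⟨ +ᴹ-assoc _ _ _ ⟨
    D p q e +ᴹ H p q e                                   ≈⟨ +ᴹ-congʳ (≈ᴹ-trans (≈ᴹ-sym only) D-sum) ⟩
    0ᴹ +ᴹ H p q e                                        ≈⟨ +ᴹ-identityˡ _ ⟩
    H p q e                                              ∎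
    where
    open SetoidReasoning ≈ᴹ-setoid
    D : ∀ p q → p ℕ.+ q ≡ n → ∣ P ∣
    D p q e = G p q e +ᴹ (ℚ.- 1ℚ) *ₗ H p q e
    at : (∀ p q → p ℕ.+ q ≡ n → ∣ P ∣) → Fin (suc n) → ∣ P ∣
    at K i = K (toℕ i) (n ℕ.∸ toℕ i) (splitting i)
    cancel : ∀ {x y} → x ≈ᴹ y → x +ᴹ (ℚ.- 1ℚ) *ₗ y ≈ᴹ 0ᴹ
    cancel {x} {y} x≈y = ≈ᴹ-trans (+ᴹ-congʳ x≈y) (≈ᴹ-trans (+ᴹ-comm _ _) (-1*ₗ-inverse y))
    only : ∑ P (allFin (suc n)) (at D) ≈ᴹ D p q e
    only = ∑-splittings-only P D p q e λ p′ q′ e′ p′≢p → cancel (agree p′ q′ e′ p′≢p)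
    D-sum : ∑ P (allFin (suc n)) (at D) ≈ᴹ 0ᴹ
    D-sum = ≈ᴹ-trans (∑-+ (allFin (suc n)) (at G) (λ i → (ℚ.- 1ℚ) *ₗ at H i)) (≈ᴹ-trans
      (+ᴹ-congˡ (∑-• (ℚ.- 1ℚ) (allFin (suc n)) (at H))) (cancel sums))

Θ-𝟙 : Θ (F* ∅) ≈[ 𝔖Symᴹ ] F ∅
Θ-𝟙 = subst (λ u → Θ (F* ∅) ≈[ 𝔖Symᴹ ] F u) (𝔖₀-unique (∅ ⁻¹) ∅) (Θ-F* ∅)

Θ-ε : ∀ f → ε (Θ f) ≡ ⟪ f , F ∅ ⟫
Θ-ε f = trans (comp-Θ f ∅) (cong (λ u → ⟪ f , F u ⟫) (𝔖₀-unique (∅ ⁻¹) ∅))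

-- `F* ∅` kills every cut except the one with empty suffix, whose prefix is all of w.
convolution-∅ : ∀ f (w : 𝔖 n) → convolution f (F* ∅) w ≡ ⟪ f , F w ⟫
convolution-∅ {n} f w = trans
  (∑-splittings-only ℚ¹ G n 0 e λ p q e′ p≢n →
    trans (cong (⟪ f , F (prefix w p q e′) ⟫ ℚ.*_) (trans (F*-dual ∅ (suffix w p q e′))
            ([]-false (λ eq → p≢n (trans (sym (ℕₚ.+-identityʳ p)) (trans (cong (p ℕ.+_) (cong proj₁ eq)) e′)))
              ((0 , ∅) ≟Σ (q , suffix w p q e′)))))
          (ℚₚ.*-zeroʳ ⟪ f , F (prefix w p q e′) ⟫))
  (trans
    (cong₂ (λ a b → ⟪ f , F a ⟫ ℚ.* b) (prefix-all w e)
      (trans (F*-dual ∅ (suffix w n 0 e))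
        ([]-true (cong (0 ,_) (𝔖₀-unique ∅ (suffix w n 0 e))) ((0 , ∅) ≟Σ (0 , suffix w n 0 e)))))
    (ℚₚ.*-identityʳ ⟪ f , F w ⟫))
  where
  e = ℕₚ.+-identityʳ n
  G : ∀ p q → p ℕ.+ q ≡ n → ℚ
  G p q e = ⟪ f , F (prefix w p q e) ⟫ ℚ.* ⟪ F* ∅ , F (suffix w p q e) ⟫

-- Every element is some `Θ f`, and `Θ` is multiplicative, so the unit law is inherited from
-- `convolution-∅` without enumerating shuffles.
·-identityʳ : ∀ x → x · F ∅ ≈[ 𝔖Symᴹ ] x
·-identityʳ x = begin
  x · F ∅                     ≈⟨ ⟦⟧-cong (linearˡ (F ∅)) {Θ f} {x} (Θ-Θ⁻¹ x) ⟨
  Θ f · F ∅                   ≈⟨ ⟦⟧-cong (linearʳ (Θ f)) {Θ (F* ∅)} {F ∅} Θ-𝟙 ⟨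
  Θ f · Θ (F* ∅)              ≈⟨ Θ-· f (F* ∅) ⟨
  Θ (dualProduct f (F* ∅))    ≈⟨ (λ n w → trans (comp-Θ (dualProduct f (F* ∅)) w) (trans (dualProduct-F f (F* ∅) (w ⁻¹))
                                   (trans (convolution-∅ f (w ⁻¹)) (sym (comp-Θ f w))))) ⟩
  Θ f                         ≈⟨ Θ-Θ⁻¹ x ⟩
  x                           ∎
  where
  open SetoidReasoning 𝕊.≈ᴹ-setoid
  open IsModuleHomomorphism using (⟦⟧-cong)
  open IsBilinear ·-bilinear
  f = Θ⁻¹ x

module _ {S : ∣ 𝔖Symᴹ ∣ → ∣ 𝔖Symᴹ ∣} (S-linear : IsLinear 𝔖Symᴹ 𝔖Symᴹ S) where

  leftConvolution : ∣ 𝔖Symᴹ ∣ → ∣ 𝔖Symᴹ ∣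
  leftConvolution x = induced 𝔖Symᴹ (λ y z → S y · z) (Δ x)

  leftConvolution-bilinear : IsBilinear 𝔖Symᴹ 𝔖Symᴹ 𝔖Symᴹ (λ y z → S y · z)
  leftConvolution-bilinear = bilinear
    (λ z → ∘-linear 𝔖Symᴹ 𝔖Symᴹ 𝔖Symᴹ (IsBilinear.linearˡ ·-bilinear z) S-linear)
    (λ y → IsBilinear.linearʳ ·-bilinear (S y))

  leftConvolution-F : (u : 𝔖 n) → leftConvolution (F u) ≈[ 𝔖Symᴹ ]
    ∑ 𝔖Symᴹ (allFin (suc n)) (λ i → S (F (stPrefix u i)) · F (stSuffix u i))
  leftConvolution-F {n} u = 𝕊.≈ᴹ-trans {leftConvolution (F u)} {induced 𝔖Symᴹ (λ y z → S y · z) (F-coproduct u)}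
    {∑ 𝔖Symᴹ (allFin (suc n)) λ i → S (F (stPrefix u i)) · F (stSuffix u i)}
    (induced-cong 𝔖Symᴹ 𝔖Symᴹ 𝔖Symᴹ leftConvolution-bilinear (Δ-F u))
    (Linear.∑-homo (𝔖Symᴹ ⊗ᴹ 𝔖Symᴹ) 𝔖Symᴹ (induced-linear 𝔖Symᴹ 𝔖Symᴹ 𝔖Symᴹ leftConvolution-bilinear)
      (allFin (suc n)) λ i → F (stPrefix u i) ⊗ F (stSuffix u i))

-- The summand of F-coproduct u with empty suffix is F u ⊗ 1, so the left antipode
-- equation determines S (F u) from the values of S in lower degrees.
module _ {S T : ∣ 𝔖Symᴹ ∣ → ∣ 𝔖Symᴹ ∣} (S-linear : IsLinear 𝔖Symᴹ 𝔖Symᴹ S) (T-linear : IsLinear 𝔖Symᴹ 𝔖Symᴹ T)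
         (eq : ∀ x → leftConvolution S-linear x ≈[ 𝔖Symᴹ ] leftConvolution T-linear x) where

  private
    open IsBilinear ·-bilinear
    open IsModuleHomomorphism using (⟦⟧-cong)

    step : ∀ n → (∀ {m} → m ℕ.< n → (u : 𝔖 m) → S (F u) ≈[ 𝔖Symᴹ ] T (F u)) →
           (u : 𝔖 n) → S (F u) ≈[ 𝔖Symᴹ ] T (F u)
    step n rec u = 𝕊.≈ᴹ-trans {S (F u)} {S (F u) · F ∅} {T (F u)}
      (𝕊.≈ᴹ-sym {S (F u) · F ∅} {S (F u)} (·-identityʳ (S (F u))))
      (𝕊.≈ᴹ-trans {S (F u) · F ∅} {T (F u) · F ∅} {T (F u)} last′ (·-identityʳ (T (F u))))
      where
      e = ℕₚ.+-identityʳ n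
      G : (∣ 𝔖Symᴹ ∣ → ∣ 𝔖Symᴹ ∣) → ∀ p q → p ℕ.+ q ≡ n → ∣ 𝔖Symᴹ ∣
      G R p q e = R (F (prefix u p q e)) · F (suffix u p q e)
      total : (∣ 𝔖Symᴹ ∣ → ∣ 𝔖Symᴹ ∣) → ∣ 𝔖Symᴹ ∣
      total R = ∑ 𝔖Symᴹ (allFin (suc n)) λ i → G R (toℕ i) (n ℕ.∸ toℕ i) (splitting i)
      total-≈ : ∀ {R} (R-linear : IsLinear 𝔖Symᴹ 𝔖Symᴹ R) → leftConvolution R-linear (F u) ≈[ 𝔖Symᴹ ] total R
      total-≈ {R} R-linear = 𝕊.≈ᴹ-trans {leftConvolution R-linear (F u)}
        {∑ 𝔖Symᴹ (allFin (suc n)) λ i → R (F (stPrefix u i)) · F (stSuffix u i)} {total R}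
        (leftConvolution-F R-linear u)
        (∑-st-cong 𝔖Symᴹ (λ v w → R (F v) · F w) u)
      sums : total S ≈[ 𝔖Symᴹ ] total T
      sums = 𝕊.≈ᴹ-trans {total S} {leftConvolution S-linear (F u)} {total T}
        (𝕊.≈ᴹ-sym {leftConvolution S-linear (F u)} {total S} (total-≈ S-linear))
        (𝕊.≈ᴹ-trans {leftConvolution S-linear (F u)} {leftConvolution T-linear (F u)} {total T}
          (eq (F u)) (total-≈ T-linear))
      agree : ∀ p q e → p ≢ n → G S p q e ≈[ 𝔖Symᴹ ] G T p q e
      agree p q e p≢n = ⟦⟧-cong (linearˡ (F (suffix u p q e))) {S (F (prefix u p q e))} {T (F (prefix u p q e))}
        (rec (ℕₚ.≤∧≢⇒< (ℕₚ.m+n≤o⇒m≤o p (ℕₚ.≤-reflexive e)) p≢n) (prefix u p q e))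
      last : G S n 0 e ≈[ 𝔖Symᴹ ] G T n 0 e
      last = ∑-splittings-cancel 𝔖Symᴹ (G S) (G T) n 0 e agree sums
      last′ : S (F u) · F ∅ ≈[ 𝔖Symᴹ ] T (F u) · F ∅
      -- The full prefix and the empty suffix agree with u and ∅ only propositionally, so the
      -- cancelled summand still has to be rewritten.
      last′ = subst₂ (λ (v : 𝔖 n) (w : 𝔖 0) → S (F v) · F w ≈[ 𝔖Symᴹ ] T (F v) · F w)
        (prefix-all u e) (𝔖₀-unique (suffix u n 0 e) ∅) last

  leftConvolution-injective : ∀ x → S x ≈[ 𝔖Symᴹ ] T x
  leftConvolution-injective = linear-unique 𝔖Symᴹ {S} {T} S-linear T-linear
    λ {n} → <-rec (λ n → (u : 𝔖 n) → S (F u) ≈[ 𝔖Symᴹ ] T (F u)) step n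

-- Transport of antipodes along an isomorphism

induced-⊗₁ : ∀ P Q {L} → IsLinear P Q L → ∀ α β → (∀ x y → β (L x) (L y) ≈[ Q ] L (α x y)) →
  (t : Tensor P P) → induced Q β (_⊗₁_ {P} {Q} {P} {Q} L L t) ≈[ Q ] L (induced P α t)
induced-⊗₁ P Q {L} L-linear α β eq = go
  where
  open Module Q
  open Linear P Q L-linear
  go : (t : Tensor P P) → induced Q β (_⊗₁_ {P} {Q} {P} {Q} L L t) ≈ᴹ L (induced P α t)
  go (x ⊗ y) = eq x y
  go 𝟎       = ≈ᴹ-sym 0ᴹ-homo
  go (s ⊞ t) = ≈ᴹ-trans (+ᴹ-cong (go s) (go t)) (≈ᴹ-sym (+ᴹ-homo _ _))
  go (r ⊡ t) = ≈ᴹ-trans (*ₗ-congˡ (go t)) (≈ᴹ-sym (*ₗ-homo r _))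

module Transport (H K : RawBialgebra) where
  private
    module H = RawBialgebra H
    module K = RawBialgebra K

  module Along
    {f : ∣ H.space ∣ → ∣ K.space ∣} {g : ∣ K.space ∣ → ∣ H.space ∣}
    (f-linear : IsLinear H.space K.space f) (g-linear : IsLinear K.space H.space g)
    (fg : ∀ y → f (g y) ≈[ K.space ] y) (gf : ∀ x → g (f x) ≈[ H.space ] x)
    (·-homo : ∀ x y → f (x H.· y) ≈[ K.space ] f x K.· f y)
    (𝟙-homo : f H.𝟙 ≈[ K.space ] K.𝟙)
    (Δ-homo : ∀ x → K.Δ (f x) ≈[ K.space ⊗ᴹ K.space ] (f ⊗₁ f) (H.Δ x))
    (ε-homo : ∀ x → K.ε (f x) ≡ H.ε x)
    (·-bilinear : IsBilinear K.space K.space K.space K._·_)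
    (Δ-linear : IsLinear K.space (K.space ⊗ᴹ K.space) K.Δ)
    (ε-linear : IsLinear K.space ℚ¹ K.ε)
    {S : ∣ H.space ∣ → ∣ H.space ∣} (S-antipode : IsAntipode H S)
    where

    private
      module S = IsAntipode S-antipode
      module f = IsModuleHomomorphism f-linear
      open Module K.space
      open Sums K.space using (*ₗ-coeff)

    transport-linear : IsLinear K.space K.space (f ∘ S ∘ g)
    transport-linear = ∘-linear K.space H.space K.space f-linear (∘-linear K.space H.space H.space S.linear g-linear)

    transport-f : ∀ x → f (S (g (f x))) ≈ᴹ f (S x)
    transport-f x = f.⟦⟧-cong (IsModuleHomomorphism.⟦⟧-cong S.linear (gf x))

    -- Writing y as f x, compatibility with Δ moves f outside the coproduct and compatibility with
    -- the product pulls it through; what is left is the image of the equation for `S` under f.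
    transport-left : ∀ y → induced K.space (λ y z → f (S (g y)) K.· z) (K.Δ y) ≈ᴹ K.ε y *ₗ K.𝟙
    transport-left y = begin
      induced K.space β (K.Δ y)
        ≈⟨ induced-cong K.space K.space K.space β-bilinear (IsModuleHomomorphism.⟦⟧-cong Δ-linear (fg y)) ⟨
      induced K.space β (K.Δ (f x))
        ≈⟨ induced-cong K.space K.space K.space β-bilinear (Δ-homo x) ⟩
      induced K.space β (_⊗₁_ {H.space} {K.space} {H.space} {K.space} f f (H.Δ x))
        ≈⟨ induced-⊗₁ H.space K.space f-linear (λ y z → S y H.· z) β
             (λ y z → ≈ᴹ-trans (IsModuleHomomorphism.⟦⟧-cong (IsBilinear.linearˡ ·-bilinear (f z)) (transport-f y))
                               (≈ᴹ-sym (·-homo (S y) z)))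
             (H.Δ x) ⟩
      f (induced H.space (λ y z → S y H.· z) (H.Δ x))
        ≈⟨ f.⟦⟧-cong (S.left x) ⟩
      f (Module._*ₗ_ H.space (H.ε x) H.𝟙)
        ≈⟨ f.*ₗ-homo (H.ε x) H.𝟙 ⟩
      H.ε x *ₗ f H.𝟙
        ≈⟨ *ₗ-congˡ 𝟙-homo ⟩
      H.ε x *ₗ K.𝟙
        ≈⟨ *ₗ-coeff K.𝟙 (trans (sym (ε-homo x)) (IsModuleHomomorphism.⟦⟧-cong ε-linear (fg y))) ⟩
      K.ε y *ₗ K.𝟙 ∎
      where
      open SetoidReasoning ≈ᴹ-setoid
      x = g y
      β : ∣ K.space ∣ → ∣ K.space ∣ → ∣ K.space ∣
      β y z = f (S (g y)) K.· z
      β-bilinear : IsBilinear K.space K.space K.space β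
      β-bilinear = bilinear
        (λ z → ∘-linear K.space K.space K.space (IsBilinear.linearˡ ·-bilinear z) transport-linear)
        (λ y → IsBilinear.linearʳ ·-bilinear (f (S (g y))))

Θ⁻¹-Θ : ∀ f → Θ⁻¹ (Θ f) ≈[ 𝔖Sym*ᴹ ] f
Θ⁻¹-Θ f = Θ-injective {Θ⁻¹ (Θ f)} {f} (Θ-Θ⁻¹ (Θ f))

module _ {S : ∣ 𝔖Sym*ᴹ ∣ → ∣ 𝔖Sym*ᴹ ∣} {T : ∣ 𝔖Symᴹ ∣ → ∣ 𝔖Symᴹ ∣}
         (S-antipode : IsAntipode 𝔖Sym* S) (T-antipode : IsAntipode 𝔖Sym T) where

  private
    module T = IsAntipode T-antipode

    transported : ∣ 𝔖Symᴹ ∣ → ∣ 𝔖Symᴹ ∣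
    transported = Θ ∘ S ∘ Θ⁻¹

    open Transport.Along 𝔖Sym* 𝔖Sym Θ-linear Θ⁻¹-linear Θ-Θ⁻¹ Θ⁻¹-Θ Θ-· Θ-𝟙 Θ-Δ Θ-ε
      ·-bilinear Δ-linear (coordinate-linear ∅) S-antipode

  -- Θ S Θ⁻¹ and `T` solve the same left antipode equation on 𝔖Sym, so they coincide; evaluate at
  -- `Θ f`.
  Θ-antipode : ∀ f → Θ (S f) ≈[ 𝔖Symᴹ ] T (Θ f)
  Θ-antipode f = 𝕊.≈ᴹ-trans {Θ (S f)} {transported (Θ f)} {T (Θ f)}
    (𝕊.≈ᴹ-sym {transported (Θ f)} {Θ (S f)} (transport-f f))
    (leftConvolution-injective transport-linear T.linear
      (λ x → 𝕊.≈ᴹ-trans {leftConvolution transport-linear x} {ε x • F ∅} {leftConvolution T.linear x}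
        (transport-left x) (𝕊.≈ᴹ-sym {leftConvolution T.linear x} {ε x • F ∅} (T.left x))) (Θ f))

-- Möbius inversion

-- An inversion set records the relative order of any two letters, so `order-determines` applies.
-- Pairs with j < i use u ≤ v directly, pairs with i < j use v ≤ u in contrapositive form.
≤-antisym : {u v : 𝔖 n} → u ≤ v → v ≤ u → u ≡ v
≤-antisym {u = u} {v} u≤v v≤u = order-determines u v mono
  where
  mono : ∀ i j → u ⟨ i ⟩ Fin.< u ⟨ j ⟩ → v ⟨ i ⟩ Fin.< v ⟨ j ⟩
  mono i j ui<uj with Finₚ.<-cmp i j
  ... | tri≈ _ refl _ = contradiction ui<uj (ℕₚ.<-irrefl refl)
  ... | tri> _ _ j<i  = proj₂ (u≤v {j , i} (j<i , ui<uj))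
  ... | tri< i<j i≢j _ with Finₚ.<-cmp (v ⟨ i ⟩) (v ⟨ j ⟩)
  ...   | tri< vi<vj _ _ = vi<vj
  ...   | tri≈ _ vi≡vj _ = contradiction (⟨⟩-injective v vi≡vj) i≢j
  ...   | tri> _ _ vj<vi = contradiction ui<uj (ℕₚ.<-asym (proj₂ (v≤u {i , j} (i<j , vj<vi))))

≤-refl : (u : 𝔖 n) → u ≤ u
≤-refl u {_} x = x

≤∧≢⇒< : {u v : 𝔖 n} → u ≤ v → u ≢ v → u < v
≤∧≢⇒< {u = u} {v} u≤v u≢v = (λ {x} → u≤v {x}) , λ v≤u → u≢v (≤-antisym {u = u} {v} (λ {x} → u≤v {x}) (λ {x} → v≤u {x}))

<-irrefl : (u : 𝔖 n) → ¬ (u < u)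
<-irrefl u (_ , u≰u) = u≰u (≤-refl u)

ζ : 𝔖 n → 𝔖 n → ℚ
ζ u v = [ u ≤? v ]

ζ-refl : (u : 𝔖 n) → ζ u u ≡ 1ℚ
ζ-refl u = []-true {u ≤ u} (≤-refl u) (u ≤? u)

μ-refl : (u : 𝔖 n) → μ u u ≡ 1ℚ
μ-refl u = trans (μ-unfold u u) (if-true refl (u ≟ u))

μ-≰ : (u v : 𝔖 n) → ¬ (u ≤ v) → μ u v ≡ 0ℚ
μ-≰ u v u≰v = trans (μ-unfold u v) (trans (if-false (λ { refl → u≰v (≤-refl u) }) (u ≟ v)) (if-false u≰v (u ≤? v)))

private
  lower : 𝔖 n → 𝔖 n → 𝔖 n → ℚ
  lower u v w = if does ((u ≤? w) ×-dec (w <? v)) then μ u w else 0ℚ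

μ-< : (u v : 𝔖 n) → u ≢ v → u ≤ v → μ u v ≡ ℚ.- ∑ ℚ¹ (perms n) (lower u v)
μ-< u v u≢v u≤v = trans (μ-unfold u v) (trans (if-false u≢v (u ≟ v)) (if-true (λ {x} → u≤v {x}) (u ≤? v)))

μζ-zero : (u v w : 𝔖 n) → ¬ (u ≤ w × w ≤ v) → μ u w ℚ.* ζ w v ≡ 0ℚ
μζ-zero u v w outside = go (u ≤? w)
  where
  go : Dec (u ≤ w) → μ u w ℚ.* ζ w v ≡ 0ℚ
  go (no  u≰w) = trans (cong (ℚ._* ζ w v) (μ-≰ u w u≰w)) (ℚₚ.*-zeroˡ (ζ w v))
  go (yes u≤w) = trans
    (cong (μ u w ℚ.*_) ([]-false (λ w≤v → outside ((λ {x} → u≤w {x}) , (λ {x} → w≤v {x}))) (w ≤? v)))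
    (ℚₚ.*-zeroʳ (μ u w))

-- The closed interval from u to v is the half-open one together with its top. The half-open part is
-- the sum in the recursion for `μ u v`.
μζ-split : (u v w : 𝔖 n) → μ u w ℚ.* ζ w v ≡ lower u v w ℚ.+ [ v ≟ w ] ℚ.* μ u w
μζ-split u v w = go (u ≤? w) (w ≤? v) (v ≟ w)
  where
  open ≡-Reasoning
  go : Dec (u ≤ w) → Dec (w ≤ v) → Dec (v ≡ w) → μ u w ℚ.* ζ w v ≡ lower u v w ℚ.+ [ v ≟ w ] ℚ.* μ u w
  go (no u≰w) _ _ = trans (μζ-zero u v w (λ (u≤w , _) → u≰w (λ {x} → u≤w {x}))) (sym (begin
    lower u v w ℚ.+ [ v ≟ w ] ℚ.* μ u w
      ≡⟨ cong₂ (λ a b → a ℚ.+ [ v ≟ w ] ℚ.* b)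
           (if-false (λ (u≤w , _) → u≰w (λ {x} → u≤w {x})) ((u ≤? w) ×-dec (w <? v))) (μ-≰ u w u≰w) ⟩
    0ℚ ℚ.+ [ v ≟ w ] ℚ.* 0ℚ
      ≡⟨ trans (ℚₚ.+-identityˡ ([ v ≟ w ] ℚ.* 0ℚ)) (ℚₚ.*-zeroʳ [ v ≟ w ]) ⟩
    0ℚ ∎))
  go (yes _) (no w≰v) _ = trans (μζ-zero u v w (λ (_ , w≤v) → w≰v (λ {x} → w≤v {x}))) (sym (begin
    lower u v w ℚ.+ [ v ≟ w ] ℚ.* μ u w
      ≡⟨ cong₂ (λ a b → a ℚ.+ b ℚ.* μ u w) (if-false (λ (_ , w≤v , _) → w≰v (λ {x} → w≤v {x})) ((u ≤? w) ×-dec (w <? v)))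
           ([]-false (λ { refl → w≰v (≤-refl v) }) (v ≟ w)) ⟩
    0ℚ ℚ.+ 0ℚ ℚ.* μ u w
      ≡⟨ trans (ℚₚ.+-identityˡ (0ℚ ℚ.* μ u w)) (ℚₚ.*-zeroˡ (μ u w)) ⟩
    0ℚ ∎))
  go (yes _) (yes _) (yes refl) = begin
    μ u v ℚ.* ζ v v
      ≡⟨ trans (cong (μ u v ℚ.*_) (ζ-refl v)) (ℚₚ.*-comm (μ u v) 1ℚ) ⟩
    1ℚ ℚ.* μ u v
      ≡⟨ ℚₚ.+-identityˡ (1ℚ ℚ.* μ u v) ⟨
    0ℚ ℚ.+ 1ℚ ℚ.* μ u v
      ≡⟨ cong₂ (λ a b → a ℚ.+ b ℚ.* μ u v) (if-false (λ (_ , v<v) → <-irrefl v v<v) ((u ≤? v) ×-dec (v <? v)))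
           ([]-true refl (v ≟ v)) ⟨
    lower u v v ℚ.+ [ v ≟ v ] ℚ.* μ u v ∎
  go (yes u≤w) (yes w≤v) (no v≢w) = begin
    μ u w ℚ.* ζ w v
      ≡⟨ trans (cong (μ u w ℚ.*_) ([]-true (λ {x} → w≤v {x}) (w ≤? v))) (ℚₚ.*-identityʳ (μ u w)) ⟩
    μ u w
      ≡⟨ trans (cong (μ u w ℚ.+_) (ℚₚ.*-zeroˡ (μ u w))) (ℚₚ.+-identityʳ (μ u w)) ⟨
    μ u w ℚ.+ 0ℚ ℚ.* μ u w
      ≡⟨ cong₂ (λ a b → a ℚ.+ b ℚ.* μ u w)
           (if-true ((λ {x} → u≤w {x}) , ≤∧≢⇒< {u = w} {v} (λ {x} → w≤v {x}) (v≢w ∘ sym)) ((u ≤? w) ×-dec (w <? v)))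
           ([]-false v≢w (v ≟ w)) ⟨
    lower u v w ℚ.+ [ v ≟ w ] ℚ.* μ u w ∎

μζ≡δ : (u v : 𝔖 n) → ∑ ℚ¹ (perms n) (λ w → μ u w ℚ.* ζ w v) ≡ [ u ≟ v ]
μζ≡δ {n} u v = go (u ≟ v) (u ≤? v)
  where
  open ≡-Reasoning
  go : Dec (u ≡ v) → Dec (u ≤ v) → ∑ ℚ¹ (perms n) (λ w → μ u w ℚ.* ζ w v) ≡ [ u ≟ v ]
  go (yes refl) _ = begin
    ∑ ℚ¹ (perms n) (λ w → μ u w ℚ.* ζ w u)
      ≡⟨ ∑-perms-only ℚ¹ u (λ w → μ u w ℚ.* ζ w u) (λ w w≢u → μζ-zero u u w
           λ (u≤w , w≤u) → w≢u (≤-antisym {u = w} {u} (λ {x} → w≤u {x}) (λ {x} → u≤w {x}))) ⟩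
    μ u u ℚ.* ζ u u
      ≡⟨ cong₂ ℚ._*_ (μ-refl u) (ζ-refl u) ⟩
    1ℚ
      ≡⟨ []-true refl (u ≟ u) ⟨
    [ u ≟ u ] ∎
  go (no u≢v) (no u≰v) = trans
    (ℚ∑.∑-zero (perms n) λ w → μζ-zero u v w λ (u≤w , w≤v) → u≰v (λ {x} → w≤v {x} ∘ u≤w {x}))
    (sym ([]-false u≢v (u ≟ v)))
  go (no u≢v) (yes u≤v) = begin
    ∑ ℚ¹ (perms n) (λ w → μ u w ℚ.* ζ w v)
      ≡⟨ ℚ∑.∑-cong (perms n) (μζ-split u v) ⟩
    ∑ ℚ¹ (perms n) (λ w → lower u v w ℚ.+ [ v ≟ w ] ℚ.* μ u w)
      ≡⟨ ℚ∑.∑-+ (perms n) (lower u v) (λ w → [ v ≟ w ] ℚ.* μ u w) ⟩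
    s ℚ.+ ∑ ℚ¹ (perms n) (λ w → [ v ≟ w ] ℚ.* μ u w)
      ≡⟨ cong (s ℚ.+_) (∑-perms-δ ℚ¹ v (λ w → [ v ≟ w ]) (μ u) ([]-true refl (v ≟ v))
           (λ w w≢v → []-false (w≢v ∘ sym) (v ≟ w))) ⟩
    s ℚ.+ μ u v
      ≡⟨ cong (s ℚ.+_) (μ-< u v u≢v (λ {x} → u≤v {x})) ⟩
    s ℚ.+ ℚ.- s
      ≡⟨ ℚₚ.+-inverseʳ s ⟩
    0ℚ
      ≡⟨ []-false u≢v (u ≟ v) ⟨
    [ u ≟ v ] ∎
    where s = ∑ ℚ¹ (perms n) (lower u v)

-- `ζ` is the identity plus a strictly triangular part.
∑ζ-split : ∀ (a : 𝔖 n → ℚ) v →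
  ∑ ℚ¹ (perms n) (λ w → a w ℚ.* ζ w v) ≡ a v ℚ.+ ∑ ℚ¹ (perms n) (λ w → [ w <? v ] ℚ.* a w)
∑ζ-split {n} a v = begin
  ∑ ℚ¹ (perms n) (λ w → a w ℚ.* ζ w v)
    ≡⟨ ℚ∑.∑-cong (perms n) (λ w → trans (ℚₚ.*-comm (a w) (ζ w v)) (trans
         (cong (ℚ._* a w) (ζ-split w (w ≤? v) (v ≟ w))) (ℚₚ.*-distribʳ-+ (a w) [ v ≟ w ] [ w <? v ]))) ⟩
  ∑ ℚ¹ (perms n) (λ w → [ v ≟ w ] ℚ.* a w ℚ.+ [ w <? v ] ℚ.* a w)
    ≡⟨ ℚ∑.∑-+ (perms n) (λ w → [ v ≟ w ] ℚ.* a w) (λ w → [ w <? v ] ℚ.* a w) ⟩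
  ∑ ℚ¹ (perms n) (λ w → [ v ≟ w ] ℚ.* a w) ℚ.+ s
    ≡⟨ cong (ℚ._+ s) (∑-perms-δ ℚ¹ v (λ w → [ v ≟ w ]) a ([]-true refl (v ≟ v))
         (λ w w≢v → []-false (w≢v ∘ sym) (v ≟ w))) ⟩
  a v ℚ.+ s ∎
  where
  open ≡-Reasoning
  s = ∑ ℚ¹ (perms n) (λ w → [ w <? v ] ℚ.* a w)
  ζ-split : ∀ w → Dec (w ≤ v) → Dec (v ≡ w) → ζ w v ≡ [ v ≟ w ] ℚ.+ [ w <? v ]
  ζ-split w (no w≰v) _ = trans ([]-false w≰v (w ≤? v)) (sym (cong₂ ℚ._+_
    ([]-false (λ { refl → w≰v (≤-refl v) }) (v ≟ w)) ([]-false (λ (w≤v , _) → w≰v (λ {x} → w≤v {x})) (w <? v))))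
  ζ-split w (yes _) (yes refl) = trans (ζ-refl v) (sym (cong₂ ℚ._+_
    ([]-true refl (v ≟ v)) ([]-false (λ v<v → <-irrefl v v<v) (v <? v))))
  ζ-split w (yes w≤v) (no v≢w) = trans ([]-true (λ {x} → w≤v {x}) (w ≤? v)) (sym (cong₂ ℚ._+_
    ([]-false v≢w (v ≟ w)) ([]-true (≤∧≢⇒< {u = w} {v} (λ {x} → w≤v {x}) (v≢w ∘ sym)) (w <? v))))

-- By unitriangularity the value at v is determined by the sum at v and the values strictly below v;
-- induct along the weak order.
ζ-cancelʳ : ∀ (a b : 𝔖 n → ℚ) →
  (∀ v → ∑ ℚ¹ (perms n) (λ w → a w ℚ.* ζ w v) ≡ ∑ ℚ¹ (perms n) (λ w → b w ℚ.* ζ w v)) → ∀ v → a v ≡ b v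
ζ-cancelʳ {n} a b eq = WF.All.wfRec <-wellFounded 0ℓ (λ v → a v ≡ b v) λ v rec →
  ∙-cancelʳ ℚₚ.+-0-group (∑ ℚ¹ (perms n) (λ w → [ w <? v ] ℚ.* a w)) (a v) (b v) (begin
    a v ℚ.+ ∑ ℚ¹ (perms n) (λ w → [ w <? v ] ℚ.* a w)  ≡⟨ ∑ζ-split a v ⟨
    ∑ ℚ¹ (perms n) (λ w → a w ℚ.* ζ w v)               ≡⟨ eq v ⟩
    ∑ ℚ¹ (perms n) (λ w → b w ℚ.* ζ w v)               ≡⟨ ∑ζ-split b v ⟩
    b v ℚ.+ ∑ ℚ¹ (perms n) (λ w → [ w <? v ] ℚ.* b w)  ≡⟨ cong (b v ℚ.+_) (ℚ∑.∑-cong (perms n) λ w →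
                                                             below w v (rec {w}) (w <? v)) ⟨
    b v ℚ.+ ∑ ℚ¹ (perms n) (λ w → [ w <? v ] ℚ.* a w)  ∎)
  where
  open ≡-Reasoning
  below : ∀ w v → (w < v → a w ≡ b w) → (d : Dec (w < v)) → [ d ] ℚ.* a w ≡ [ d ] ℚ.* b w
  below w v rec (yes w<v) = cong (1ℚ ℚ.*_) (rec w<v)
  below w v rec (no _)    = trans (ℚₚ.*-zeroˡ (a w)) (sym (ℚₚ.*-zeroˡ (b w)))

module _ (P : ℚ-Module) where
  open Module P
  open Sums P

  ∑-matrix : ∀ (xs : List A) (ys : List B) (a : A → ℚ) (b : A → B → ℚ) (φ : B → ∣ P ∣) →
    ∑ P xs (λ x → a x *ₗ ∑ P ys (λ y → b x y *ₗ φ y)) ≈ᴹ ∑ P ys (λ y → ∑ ℚ¹ xs (λ x → a x ℚ.* b x y) *ₗ φ y)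
  ∑-matrix xs ys a b φ = begin
    ∑ P xs (λ x → a x *ₗ ∑ P ys (λ y → b x y *ₗ φ y))
      ≈⟨ ∑-cong xs (λ x → ∑-• (a x) ys λ y → b x y *ₗ φ y) ⟨
    ∑ P xs (λ x → ∑ P ys (λ y → a x *ₗ b x y *ₗ φ y))
      ≈⟨ ∑-cong xs (λ x → ∑-cong ys λ y → *ₗ-assoc (a x) (b x y) (φ y)) ⟨
    ∑ P xs (λ x → ∑ P ys (λ y → (a x ℚ.* b x y) *ₗ φ y))
      ≈⟨ ∑-swap xs ys (λ x y → (a x ℚ.* b x y) *ₗ φ y) ⟩
    ∑ P ys (λ y → ∑ P xs (λ x → (a x ℚ.* b x y) *ₗ φ y))
      ≈⟨ ∑-cong ys (λ y → ∑-factor xs (λ x → a x ℚ.* b x y) (φ y)) ⟩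
    ∑ P ys (λ y → ∑ ℚ¹ xs (λ x → a x ℚ.* b x y) *ₗ φ y) ∎
    where open SetoidReasoning ≈ᴹ-setoid

-- In the incidence algebra μ ζ = 1 gives (ζ μ) ζ = ζ, and ζ can be cancelled.
ζμ≡δ : (u v : 𝔖 n) → ∑ ℚ¹ (perms n) (λ w → ζ u w ℚ.* μ w v) ≡ [ u ≟ v ]
ζμ≡δ {n} u = ζ-cancelʳ (λ v → ∑ ℚ¹ (perms n) (λ w → ζ u w ℚ.* μ w v)) (λ v → [ u ≟ v ]) λ v → begin
  ∑ ℚ¹ (perms n) (λ x → ∑ ℚ¹ (perms n) (λ w → ζ u w ℚ.* μ w x) ℚ.* ζ x v)
    ≡⟨ ∑-matrix ℚ¹ (perms n) (perms n) (ζ u) μ (λ x → ζ x v) ⟨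
  ∑ ℚ¹ (perms n) (λ w → ζ u w ℚ.* ∑ ℚ¹ (perms n) (λ x → μ w x ℚ.* ζ x v))
    ≡⟨ ℚ∑.∑-cong (perms n) (λ w → trans (cong (ζ u w ℚ.*_) (μζ≡δ w v)) (ℚₚ.*-comm (ζ u w) [ w ≟ v ])) ⟩
  ∑ ℚ¹ (perms n) (λ w → [ w ≟ v ] ℚ.* ζ u w)
    ≡⟨ ∑-perms-δ ℚ¹ v (λ w → [ w ≟ v ]) (ζ u) ([]-true refl (v ≟ v)) (λ w w≢v → []-false w≢v (w ≟ v)) ⟩
  ζ u v
    ≡⟨ ∑-perms-δ ℚ¹ u (λ x → [ u ≟ x ]) (λ x → ζ x v) ([]-true refl (u ≟ u)) (λ x x≢u → []-false (x≢u ∘ sym) (u ≟ x)) ⟨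
  ∑ ℚ¹ (perms n) (λ x → [ u ≟ x ] ℚ.* ζ x v) ∎
  where open ≡-Reasoning

module _ (P : ℚ-Module) where
  open Module P
  open Sums P

  μ-support : ∀ (φ : 𝔖 n → ∣ P ∣) u →
    ∑ P (filter (u ≤?_) (perms n)) (λ v → μ u v *ₗ φ v) ≈ᴹ ∑ P (perms n) (λ v → μ u v *ₗ φ v)
  μ-support {n} φ u = ≈ᴹ-trans (∑-filter (u ≤?_) (perms n) (λ v → μ u v *ₗ φ v))
    (∑-cong (perms n) λ v → go v (u ≤? v))
    where
    go : ∀ v (d : Dec (u ≤ v)) → [ d ] *ₗ μ u v *ₗ φ v ≈ᴹ μ u v *ₗ φ v
    go v (yes _)  = *ₗ-identityˡ _
    go v (no u≰v) = ≈ᴹ-trans (*ₗ-zeroˡ _) (≈ᴹ-sym (*ₗ-zero (φ v) (μ-≰ u v u≰v)))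

  -- The outer sum runs over the first index of `μ`, so the matrix that appears is `ζ` times `μ`.
  möbius-inversion : ∀ (φ : 𝔖 n → ∣ P ∣) u →
    ∑ P (perms n) (λ v → ζ u v *ₗ ∑ P (filter (v ≤?_) (perms n)) (λ w → μ v w *ₗ φ w)) ≈ᴹ φ u
  möbius-inversion {n} φ u = begin
    ∑ P (perms n) (λ v → ζ u v *ₗ ∑ P (filter (v ≤?_) (perms n)) (λ w → μ v w *ₗ φ w))
      ≈⟨ ∑-cong (perms n) (λ v → *ₗ-congˡ {ζ u v} (μ-support φ v)) ⟩
    ∑ P (perms n) (λ v → ζ u v *ₗ ∑ P (perms n) (λ w → μ v w *ₗ φ w))
      ≈⟨ ∑-matrix P (perms n) (perms n) (ζ u) μ φ ⟩
    ∑ P (perms n) (λ w → ∑ ℚ¹ (perms n) (λ v → ζ u v ℚ.* μ v w) *ₗ φ w)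
      ≈⟨ ∑-perms-δ P u _ φ (trans (ζμ≡δ u u) ([]-true refl (u ≟ u)))
           (λ w w≢u → trans (ζμ≡δ u w) ([]-false (w≢u ∘ sym) (u ≟ w))) ⟩
    φ u ∎
    where open SetoidReasoning ≈ᴹ-setoid

F-in-M : (u : 𝔖 n) → ∑ 𝔖Symᴹ (perms n) (λ v → ζ u v • M v) ≈[ 𝔖Symᴹ ] F u
F-in-M = möbius-inversion 𝔖Symᴹ F

length-filter : ∀ {Q : Pred A 0ℓ} (Q? : Decidable Q) xs → + length (filter Q? xs) / 1 ≡ ∑ ℚ¹ xs (λ x → [ Q? x ])
length-filter Q? []       = refl
length-filter Q? (x ∷ xs) with Q? x
... | yes _ = trans (suc/1 (length (filter Q? xs))) (cong (1ℚ ℚ.+_) (length-filter Q? xs))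
  where
  suc/1 : ∀ k → + suc k / 1 ≡ 1ℚ ℚ.+ + k / 1
  -- `_/_` divides by a gcd and does not compute for a variable k. Replacing k/1 by its reduced
  -- fraction lets the addition unfold.
  suc/1 k = sym (trans (cong (1ℚ ℚ.+_) (ℚₚ.↥p/↧p≡p (ℚ.mkℚ (+ k) 0 (Coprime.sym (Coprime.1-coprimeTo k)))))
    (cong (λ z → (+ 1 ℤ.+ z) / 1) (ℤₚ.*-identityʳ (+ k))))
... | no _  = trans (length-filter Q? xs) (sym (ℚₚ.+-identityˡ (∑ ℚ¹ xs λ x → [ Q? x ])))

-- The count is an entry of the matrix product ζᵗ P ζ, with P the permutation matrix of inversion x
-- ↦ x⁻¹.
θ-sum : (u v : 𝔖 n) → ∑ ℚ¹ (perms n) (λ x → ζ x u ℚ.* ζ (x ⁻¹) v) ≡ + θ u v / 1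
θ-sum {n} u v = sym (trans (length-filter (λ x → (x ≤? u) ×-dec (x ⁻¹ ≤? v)) (perms n))
  (ℚ∑.∑-cong (perms n) λ x → []-× (x ≤? u) (x ⁻¹ ≤? v)))

-- The basis dual to M and its image under Θ

module _ {M* : ∀ {n} → 𝔖 n → ∣ 𝔖Sym*ᴹ ∣} (dual : IsDualTo M M*) where

  private
    M*-F : (u : 𝔖 n) (v : 𝔖 m) →
      ⟪ M* u , F v ⟫ ≡ ∑ ℚ¹ (perms m) (λ w → [ (n , u) ≟Σ (m , w) ] ℚ.* ζ v w)
    M*-F {n} {m} u v = begin
      ⟪ M* u , F v ⟫
        ≡⟨ Pair.⟦⟧-cong {∑ 𝔖Symᴹ (perms m) (λ w → ζ v w • M w)} {F v} (F-in-M v) ⟨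
      ⟪ M* u , ∑ 𝔖Symᴹ (perms m) (λ w → ζ v w • M w) ⟫
        ≡⟨ Pair.∑-homo (perms m) (λ w → ζ v w • M w) ⟩
      ∑ ℚ¹ (perms m) (λ w → ⟪ M* u , ζ v w • M w ⟫)
        ≡⟨ ℚ∑.∑-cong (perms m) (λ w → trans (Pair.*ₗ-homo (ζ v w) (M w))
             (trans (cong (ζ v w ℚ.*_) (dual u w)) (ℚₚ.*-comm (ζ v w) [ (n , u) ≟Σ (m , w) ]))) ⟩
      ∑ ℚ¹ (perms m) (λ w → [ (n , u) ≟Σ (m , w) ] ℚ.* ζ v w) ∎
      where
      open ≡-Reasoning
      module Pair = Linear 𝔖Symᴹ ℚ¹ (⟪⟫-linearʳ (M* u))

  M*-F-same : (u v : 𝔖 n) → ⟪ M* u , F v ⟫ ≡ ζ v u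
  M*-F-same {n} u v = trans (M*-F u v) (∑-perms-δ ℚ¹ u (λ w → [ (n , u) ≟Σ (n , w) ]) (ζ v)
    ([]-true refl ((n , u) ≟Σ (n , u))) (λ w w≢u → []-false (λ { refl → w≢u refl }) ((n , u) ≟Σ (n , w))))

  M*-F-other : (u : 𝔖 n) (v : 𝔖 m) → m ≢ n → ⟪ M* u , F v ⟫ ≡ 0ℚ
  M*-F-other {n} {m} u v m≢n = trans (M*-F u v) (ℚ∑.∑-zero (perms m) λ w →
    ℚ∑.*ₗ-zero (ζ v w) ([]-false (m≢n ∘ sym ∘ cong proj₁) ((n , u) ≟Σ (m , w))))

  -- Compared coordinatewise: at w the left side is the value of `M* u` on F(w⁻¹), and on the right
  -- only x = w⁻¹ contributes.
  Θ-M*-in-F : (u : 𝔖 n) → Θ (M* u) ≈[ 𝔖Symᴹ ] ∑ 𝔖Symᴹ (perms n) (λ x → ζ x u • F (x ⁻¹))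
  Θ-M*-in-F {n} u m w = trans (comp-Θ (M* u) w) (trans (go w (m ℕₚ.≟ n))
    (sym (Linear.∑-homo 𝔖Symᴹ ℚ¹ (coordinate-linear w) (perms n) λ x → ζ x u • F (x ⁻¹))))
    where
    open ≡-Reasoning
    go : ∀ {m} (w : 𝔖 m) → Dec (m ≡ n) → ⟪ M* u , F (w ⁻¹) ⟫ ≡ ∑ ℚ¹ (perms n) (λ x → ζ x u ℚ.* comp (F (x ⁻¹)) m w)
    go w (no m≢n) = trans (M*-F-other u (w ⁻¹) m≢n) (sym (ℚ∑.∑-zero (perms n) λ x →
      trans (cong (ζ x u ℚ.*_) (comp-F-other (x ⁻¹) w m≢n)) (ℚₚ.*-zeroʳ (ζ x u))))
    go w (yes refl) = begin
      ⟪ M* u , F (w ⁻¹) ⟫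
        ≡⟨ M*-F-same u (w ⁻¹) ⟩
      ζ (w ⁻¹) u
        ≡⟨ ∑-perms-δ ℚ¹ (w ⁻¹) (λ x → comp (F (x ⁻¹)) n w) (λ x → ζ x u)
             (trans (comp-F-same ((w ⁻¹) ⁻¹) w) ([]-true (⁻¹-involutive w) (((w ⁻¹) ⁻¹) ≟ w)))
             (λ x x≢ → trans (comp-F-same (x ⁻¹) w) ([]-false (x≢ ∘ ⁻¹-swap) ((x ⁻¹) ≟ w))) ⟨
      ∑ ℚ¹ (perms n) (λ x → comp (F (x ⁻¹)) n w ℚ.* ζ x u)
        ≡⟨ ℚ∑.∑-cong (perms n) (λ x → ℚₚ.*-comm (comp (F (x ⁻¹)) n w) (ζ x u)) ⟩
      ∑ ℚ¹ (perms n) (λ x → ζ x u ℚ.* comp (F (x ⁻¹)) n w) ∎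

  Θ-M* : (u : 𝔖 n) → Θ (M* u) ≈[ 𝔖Symᴹ ] ∑ 𝔖Symᴹ (perms n) (λ v → (+ θ u v / 1) • M v)
  Θ-M* {n} u = begin
    Θ (M* u)
      ≈⟨ Θ-M*-in-F u ⟩
    ∑ 𝔖Symᴹ (perms n) (λ x → ζ x u • F (x ⁻¹))
      ≈⟨ Sums.∑-cong 𝔖Symᴹ (perms n) {λ x → ζ x u • ∑ 𝔖Symᴹ (perms n) (λ v → ζ (x ⁻¹) v • M v)} {λ x → ζ x u • F (x ⁻¹)}
           (λ x → 𝕊.*ₗ-congˡ {ζ x u} {∑ 𝔖Symᴹ (perms n) (λ v → ζ (x ⁻¹) v • M v)} {F (x ⁻¹)} (F-in-M (x ⁻¹))) ⟨
    ∑ 𝔖Symᴹ (perms n) (λ x → ζ x u • ∑ 𝔖Symᴹ (perms n) (λ v → ζ (x ⁻¹) v • M v))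
      ≈⟨ ∑-matrix 𝔖Symᴹ (perms n) (perms n) (λ x → ζ x u) (λ x → ζ (x ⁻¹)) M ⟩
    ∑ 𝔖Symᴹ (perms n) (λ v → ∑ ℚ¹ (perms n) (λ x → ζ x u ℚ.* ζ (x ⁻¹) v) • M v)
      ≈⟨ Sums.∑-cong 𝔖Symᴹ (perms n) {λ v → ∑ ℚ¹ (perms n) (λ x → ζ x u ℚ.* ζ (x ⁻¹) v) • M v} {λ v → (+ θ u v / 1) • M v}
           (λ v → Sums.*ₗ-coeff 𝔖Symᴹ (M v) (θ-sum u v)) ⟩
    ∑ 𝔖Symᴹ (perms n) (λ v → (+ θ u v / 1) • M v) ∎
    where open SetoidReasoning 𝕊.≈ᴹ-setoid

mainTheorem16 : (∀ {n} (u : 𝔖 n) → Θ (F* u) ≈[ 𝔖Symᴹ ] F (u ⁻¹))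
    × IsHopfIsomorphism 𝔖Sym* 𝔖Sym Θ
    × ((M* : ∀ {n} → 𝔖 n → ∣ 𝔖Sym*ᴹ ∣) → IsDualTo M M* → ∀ {n} (u : 𝔖 n) →
    Θ (M* u) ≈[ 𝔖Symᴹ ] ∑ 𝔖Symᴹ (perms n) (λ v → (+ θ u v / 1) • M v))
mainTheorem16 = Θ-F* , isHopfIsomorphism , λ M* dual → Θ-M* {M*} dual
  where
  isHopfIsomorphism : IsHopfIsomorphism 𝔖Sym* 𝔖Sym Θ
  isHopfIsomorphism = record
    { isModuleIsomorphism = Θ-isModuleIsomorphism
    ; ·-homo = Θ-·
    ; 𝟙-homo = Θ-𝟙
    ; Δ-homo = Θ-Δ
    ; ε-homo = Θ-ε
    ; S-homo = Θ-antipode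
    }
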